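{- Let $\mathrm{k}$ be an infinite field and $\mathcal{A}$ a finite-dimensional unital associative $\mathrm{k}$-algebra. The following are equivalent: (1) $\mathcal{A}$ has only finitely many subalgebras. (2) There exist finite field extensions $L_1,\ldots,L_n$ of $\mathrm{k}$, each generated over $\mathrm{k}$ by one element, and integers $\delta\in\{0,1\}$, $m\in\{2,3\}$ such that $\mathcal{A}\cong L_1\times\cdots\times L_n\times(\mathrm{k}[T]/(T^m))^{\delta}$ as $\mathrm{k}$-algebras. (3) There exists $g\in\mathcal{A}$ with $\mathcal{A}=\mathrm{k}[g]$ such that the minimal polynomial of $g$ has the form $\mu_g=P_1\cdots P_nQ^{m\delta}$, where $P_1,\ldots,P_n,Q$ are pairwise distinct irreducible polynomials in $\mathrm{k}[T]$, $\delta\in\{0,1\}$, $m\in\{2,3\}$ and $\deg Q=1$.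
   Context: Subalgebras are unital, i.e. contain $1$. $\mathrm{k}[g]$ denotes the subalgebra generated by $g$.
   Formalization: In (3) the irreducible polynomials P_1,…,P_n,Q are required to be monic, since merely distinct ones may be scalar multiples of each other (such as 2T and T/2), which would make (3)⇒(1) false. -}

module Defs where

open import Level using (Level; _⊔_) renaming (suc to lsuc)
open import Algebra.Bundles using (CommutativeSemigroup; Ring; CommutativeRing; RawRing)
open import Algebra.Morphism.Structures using (module RingMorphisms)
import Algebra.Construct.DirectProduct as DirectProduct
import Algebra.Definitions.RawMagma as MagmaDefs
import Algebra.Definitions.RawMonoid as MonoidDefs
import Algebra.Definitions.RawSemiring as SemiringDefs
import Algebra.Properties.Ring as RingProperties
import Algebra.Properties.CommutativeSemigroup as CommutativeSemigroupProperties
open import Data.Fin.Base using (Fin)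
open import Data.List.Base using (List; []; _∷_; map)
open import Data.List.Relation.Unary.Enumerates.Setoid using (IsEnumeration)
open import Data.Nat.Base as ℕ using (ℕ; zero; suc)
open import Data.Product.Base using (_×_; _,_; ∃-syntax; Σ-syntax; proj₁; proj₂)
open import Data.Sum.Base using (_⊎_)
open import Relation.Binary.Bundles using (Setoid)
open import Relation.Binary.PropositionalEquality.Core using (_≡_; _≢_)
import Relation.Binary.Reasoning.Setoid as SetoidReasoning
open import Relation.Nullary.Negation.Core using (¬_)
open import Relation.Unary using (Pred; _≐_)
open import Relation.Unary.Properties using (≐-refl; ≐-sym; ≐-trans)

private
  variable
    a b c ℓ : Level

IsFinite : Setoid a b → Set (a ⊔ b)
IsFinite S = ∃[ xs ] IsEnumeration S xs

IsInfinite : Setoid a b → Set (a ⊔ b)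
IsInfinite S = ¬ IsFinite S

record Field c ℓ : Set (lsuc (c ⊔ ℓ)) where
  field
    commutativeRing : CommutativeRing c ℓ

  open CommutativeRing commutativeRing public

  field
    1≉0     : ¬ (1# ≈ 0#)
    inverse : ∀ x → ¬ (x ≈ 0#) → ∃[ y ] x * y ≈ 1#

-- A unital associative K-algebra is a ring with a homomorphism from K
-- to its centre; the scalar action is k • x = ι k * x. The zero ring is
-- an algebra.
record AssociativeAlgebra (K : Field c ℓ) a b : Set (c ⊔ ℓ ⊔ lsuc (a ⊔ b)) where
  private module K = Field K
  field
    ring : Ring a b

  open Ring ring public

  field
    ι                  : K.Carrier → Carrier
    isRingHomomorphism : RingMorphisms.IsRingHomomorphism K.rawRing rawRing ι
    ι-central          : ∀ k x → ι k * x ≈ x * ι k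

module _ {K : Field c ℓ} where
  private module K = Field K

  record _≅_ {a b a′ b′} (A : AssociativeAlgebra K a b) (B : AssociativeAlgebra K a′ b′)
         : Set (c ⊔ a ⊔ b ⊔ a′ ⊔ b′) where
    private
      module A = AssociativeAlgebra A
      module B = AssociativeAlgebra B
    field
      to                : A.Carrier → B.Carrier
      isRingIsomorphism : RingMorphisms.IsRingIsomorphism A.rawRing B.rawRing to
      to-ι              : ∀ k → to (A.ι k) B.≈ B.ι k

  FiniteDimensional : AssociativeAlgebra K a b → Set (c ⊔ a ⊔ b)
  FiniteDimensional A =
    ∃[ n ] Σ[ e ∈ (Fin n → Carrier) ]
      ∀ x → Σ[ k ∈ (Fin n → K.Carrier) ] x ≈ sum (λ i → ι (k i) * e i)
    where
    open AssociativeAlgebra A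
    open MonoidDefs +-rawMonoid using (sum)

record FieldExtension (K : Field c ℓ) a b : Set (c ⊔ ℓ ⊔ lsuc (a ⊔ b)) where
  private module K = Field K
  field
    extension : Field a b

  open Field extension public

  field
    ι                  : K.Carrier → Carrier
    isRingHomomorphism : RingMorphisms.IsRingHomomorphism K.rawRing rawRing ι

  algebra : AssociativeAlgebra K a b
  algebra = record
    { ring               = ring
    ; ι                  = ι
    ; isRingHomomorphism = isRingHomomorphism
    ; ι-central          = λ k x → *-comm (ι k) x
    }

module _ {K : Field c ℓ} (L : FieldExtension K a b) where
  private module K = Field K
  open FieldExtension L

  -- K(α), as the smallest subfield of L containing K and α.
  data K⟮_⟯ (α : Carrier) : Pred Carrier (c ⊔ a ⊔ b) where
    scalar    : ∀ k → K⟮ α ⟯ (ι k)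
    generator : K⟮ α ⟯ α
    add       : ∀ {x y} → K⟮ α ⟯ x → K⟮ α ⟯ y → K⟮ α ⟯ (x + y)
    neg       : ∀ {x} → K⟮ α ⟯ x → K⟮ α ⟯ (- x)
    mul       : ∀ {x y} → K⟮ α ⟯ x → K⟮ α ⟯ y → K⟮ α ⟯ (x * y)
    inv       : ∀ {x y} → K⟮ α ⟯ x → x * y ≈ 1# → K⟮ α ⟯ y
    resp      : ∀ {x y} → x ≈ y → K⟮ α ⟯ x → K⟮ α ⟯ y

  IsFiniteSimple : Set (c ⊔ a ⊔ b)
  IsFiniteSimple = FiniteDimensional algebra × (∃[ α ] ∀ x → K⟮ α ⟯ x)

module _ {K : Field c ℓ} (A : AssociativeAlgebra K a b) where
  private module K = Field K
  open AssociativeAlgebra A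

  -- Under excluded middle every predicate is equivalent to one of any
  -- given level, so fixing the level of the predicate loses nothing.
  record Subalgebra : Set (lsuc (c ⊔ ℓ ⊔ a ⊔ b)) where
    field
      member   : Pred Carrier (c ⊔ ℓ ⊔ a ⊔ b)
      ≈-closed : ∀ {x y} → x ≈ y → member x → member y
      1∈       : member 1#
      +-closed : ∀ {x y} → member x → member y → member (x + y)
      *-closed : ∀ {x y} → member x → member y → member (x * y)
      •-closed : ∀ k {x} → member x → member (ι k * x)

  subalgebraSetoid : Setoid (lsuc (c ⊔ ℓ ⊔ a ⊔ b)) (c ⊔ ℓ ⊔ a ⊔ b)
  subalgebraSetoid = record
    { Carrier       = Subalgebra
    ; _≈_           = λ B C → member B ≐ member C
    ; isEquivalence = record { refl = ≐-refl ; sym = ≐-sym ; trans = ≐-trans }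
    }
    where open Subalgebra using (member)

  FinitelyManySubalgebras : Set (lsuc (c ⊔ ℓ ⊔ a ⊔ b))
  FinitelyManySubalgebras = IsFinite subalgebraSetoid

  -- As the smallest subalgebra of A containing g.
  data K[_] (g : Carrier) : Pred Carrier (c ⊔ a ⊔ b) where
    one       : K[ g ] 1#
    generator : K[ g ] g
    add       : ∀ {x y} → K[ g ] x → K[ g ] y → K[ g ] (x + y)
    mul       : ∀ {x y} → K[ g ] x → K[ g ] y → K[ g ] (x * y)
    smul      : ∀ k {x} → K[ g ] x → K[ g ] (ι k * x)
    resp      : ∀ {x y} → x ≈ y → K[ g ] x → K[ g ] y

Πring : ∀ n → (Fin n → Ring a b) → Ring a b
Πring n R = record
  { Carrier = ∀ i → Carrier (R i)
  ; _≈_     = λ x y → ∀ i → _≈_ (R i) (x i) (y i)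
  ; _+_     = λ x y i → _+_ (R i) (x i) (y i)
  ; _*_     = λ x y i → _*_ (R i) (x i) (y i)
  ; -_      = λ x i → -_ (R i) (x i)
  ; 0#      = λ i → 0# (R i)
  ; 1#      = λ i → 1# (R i)
  ; isRing  = record
    { +-isAbelianGroup = record
      { isGroup = record
        { isMonoid = record
          { isSemigroup = record
            { isMagma = record
              { isEquivalence = record
                { refl  = λ i → refl (R i)
                ; sym   = λ p i → sym (R i) (p i)
                ; trans = λ p q i → trans (R i) (p i) (q i)
                }
              ; ∙-cong = λ p q i → +-cong (R i) (p i) (q i)
              }
            ; assoc = λ x y z i → +-assoc (R i) (x i) (y i) (z i)
            }
          ; identity = (λ x i → +-identityˡ (R i) (x i))
                     , (λ x i → +-identityʳ (R i) (x i))
          }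
        ; inverse = (λ x i → -‿inverseˡ (R i) (x i))
                  , (λ x i → -‿inverseʳ (R i) (x i))
        ; ⁻¹-cong = λ p i → -‿cong (R i) (p i)
        }
      ; comm = λ x y i → +-comm (R i) (x i) (y i)
      }
    ; *-cong     = λ p q i → *-cong (R i) (p i) (q i)
    ; *-assoc    = λ x y z i → *-assoc (R i) (x i) (y i) (z i)
    ; *-identity = (λ x i → *-identityˡ (R i) (x i))
                 , (λ x i → *-identityʳ (R i) (x i))
    ; distrib    = (λ x y z i → distribˡ (R i) (x i) (y i) (z i))
                 , (λ x y z i → distribʳ (R i) (x i) (y i) (z i))
    }
  }
  where open Ring

module _ {K : Field c ℓ} where

  Π : ∀ n → (Fin n → AssociativeAlgebra K a b) → AssociativeAlgebra K a b
  Π n A = record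
    { ring               = Πring n (λ i → ring (A i))
    ; ι                  = λ k i → ι (A i) k
    ; isRingHomomorphism = record
      { isSemiringHomomorphism = record
        { isNearSemiringHomomorphism = record
          { +-isMonoidHomomorphism = record
            { isMagmaHomomorphism = record
              { isRelHomomorphism = record { cong = λ p i → ⟦⟧-cong i p }
              ; homo              = λ x y i → +-homo i x y
              }
            ; ε-homo = λ i → 0#-homo i
            }
          ; *-homo = λ x y i → *-homo i x y
          }
        ; 1#-homo = λ i → 1#-homo i
        }
      ; -‿homo = λ x i → -‿homo i x
      }
    ; ι-central = λ k x i → ι-central (A i) k (x i)
    }
    where
    open AssociativeAlgebra
    module H i = RingMorphisms.IsRingHomomorphism (isRingHomomorphism (A i))
    open H

  infixr 7 _⊗_
  infixr 8 _^ᴬ_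

  _⊗_ : ∀ {a b a′ b′} → AssociativeAlgebra K a b → AssociativeAlgebra K a′ b′ →
        AssociativeAlgebra K (a ⊔ a′) (b ⊔ b′)
  A ⊗ B = record
    { ring               = DirectProduct.ring A.ring B.ring
    ; ι                  = λ k → A.ι k , B.ι k
    ; isRingHomomorphism = record
      { isSemiringHomomorphism = record
        { isNearSemiringHomomorphism = record
          { +-isMonoidHomomorphism = record
            { isMagmaHomomorphism = record
              { isRelHomomorphism = record { cong = λ p → HA.⟦⟧-cong p , HB.⟦⟧-cong p }
              ; homo              = λ x y → HA.+-homo x y , HB.+-homo x y
              }
            ; ε-homo = HA.0#-homo , HB.0#-homo
            }
          ; *-homo = λ x y → HA.*-homo x y , HB.*-homo x y
          }
        ; 1#-homo = HA.1#-homo , HB.1#-homo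
        }
      ; -‿homo = λ x → HA.-‿homo x , HB.-‿homo x
      }
    ; ι-central = λ k x → A.ι-central k (proj₁ x) , B.ι-central k (proj₂ x)
    }
    where
    module A = AssociativeAlgebra A
    module B = AssociativeAlgebra B
    module HA = RingMorphisms.IsRingHomomorphism A.isRingHomomorphism
    module HB = RingMorphisms.IsRingHomomorphism B.isRingHomomorphism

  _^ᴬ_ : AssociativeAlgebra K a b → ℕ → AssociativeAlgebra K a b
  A ^ᴬ n = Π n (λ _ → A)

-- A polynomial is its list of coefficients, constant term first. Lists
-- differing by trailing zeros are identified.
module Polynomial (R : CommutativeRing c ℓ) where
  open CommutativeRing R
  open RingProperties ring using (-0#≈0#)

  Poly : Set c
  Poly = List Carrier

  coeff : Poly → ℕ → Carrier
  coeff []      _       = 0#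
  coeff (a ∷ _) zero    = a
  coeff (_ ∷ p) (suc i) = coeff p i

  infix 4 _≋_

  -- A record, so that p and q can be inferred from p ≋ q.
  record _≋_ (p q : Poly) : Set ℓ where
    constructor mk≋
    field
      at : ∀ i → coeff p i ≈ coeff q i

  open _≋_ public

  infixl 6 _+ᴾ_
  infixl 7 _*ᴾ_
  infixr 7 _·_
  infix  8 -ᴾ_

  _+ᴾ_ : Poly → Poly → Poly
  []      +ᴾ q       = q
  (a ∷ p) +ᴾ []      = a ∷ p
  (a ∷ p) +ᴾ (b ∷ q) = (a + b) ∷ (p +ᴾ q)

  -ᴾ_ : Poly → Poly
  -ᴾ_ = map (-_)

  _·_ : Carrier → Poly → Poly
  a · p = map (a *_) p

  _*ᴾ_ : Poly → Poly → Poly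
  []      *ᴾ q = []
  (a ∷ p) *ᴾ q = a · q +ᴾ (0# ∷ p *ᴾ q)

  0ᴾ 1ᴾ T : Poly
  0ᴾ = []
  1ᴾ = 1# ∷ []
  T  = 0# ∷ 1# ∷ []

  HasDegree : Poly → ℕ → Set ℓ
  HasDegree p d = ¬ (coeff p d ≈ 0#) × (∀ i → d ℕ.< i → coeff p i ≈ 0#)

  Monic : Poly → Set ℓ
  Monic p = ∃[ d ] HasDegree p d × coeff p d ≈ 1#

  ≋-refl : ∀ {p} → p ≋ p
  ≋-refl = mk≋ λ _ → refl

  ≋-sym : ∀ {p q} → p ≋ q → q ≋ p
  ≋-sym e = mk≋ λ i → sym (at e i)

  ≋-trans : ∀ {p q r} → p ≋ q → q ≋ r → p ≋ r
  ≋-trans e f = mk≋ λ i → trans (at e i) (at f i)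

  ≋-setoid : Setoid c ℓ
  ≋-setoid = record
    { Carrier       = Poly
    ; _≈_           = _≋_
    ; isEquivalence = record { refl = ≋-refl ; sym = ≋-sym ; trans = ≋-trans }
    }

  coeff-+ : ∀ p q i → coeff (p +ᴾ q) i ≈ coeff p i + coeff q i
  coeff-+ []      q       i       = sym (+-identityˡ _)
  coeff-+ (a ∷ p) []      i       = sym (+-identityʳ _)
  coeff-+ (a ∷ p) (b ∷ q) zero    = refl
  coeff-+ (a ∷ p) (b ∷ q) (suc i) = coeff-+ p q i

  coeff-neg : ∀ p i → coeff (-ᴾ p) i ≈ - coeff p i
  coeff-neg []      i       = sym -0#≈0#
  coeff-neg (a ∷ p) zero    = refl
  coeff-neg (a ∷ p) (suc i) = coeff-neg p i

  coeff-· : ∀ a p i → coeff (a · p) i ≈ a * coeff p i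
  coeff-· a []      i       = sym (zeroʳ a)
  coeff-· a (b ∷ p) zero    = refl
  coeff-· a (b ∷ p) (suc i) = coeff-· a p i

  ∷-cong : ∀ {a b p q} → a ≈ b → p ≋ q → (a ∷ p) ≋ (b ∷ q)
  ∷-cong e f = mk≋ λ { zero → e ; (suc i) → at f i }

  +ᴾ-cong : ∀ {p p′ q q′} → p ≋ p′ → q ≋ q′ → p +ᴾ q ≋ p′ +ᴾ q′
  +ᴾ-cong {p} {p′} {q} {q′} e f = mk≋ λ i →
    trans (coeff-+ p q i) (trans (+-cong (at e i) (at f i)) (sym (coeff-+ p′ q′ i)))

  +ᴾ-assoc : ∀ p q r → (p +ᴾ q) +ᴾ r ≋ p +ᴾ (q +ᴾ r)
  +ᴾ-assoc p q r = mk≋ λ i → begin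
    coeff ((p +ᴾ q) +ᴾ r) i              ≈⟨ coeff-+ (p +ᴾ q) r i ⟩
    coeff (p +ᴾ q) i + coeff r i         ≈⟨ +-congʳ (coeff-+ p q i) ⟩
    (coeff p i + coeff q i) + coeff r i  ≈⟨ +-assoc _ _ _ ⟩
    coeff p i + (coeff q i + coeff r i)  ≈⟨ +-congˡ (coeff-+ q r i) ⟨
    coeff p i + coeff (q +ᴾ r) i         ≈⟨ coeff-+ p (q +ᴾ r) i ⟨
    coeff (p +ᴾ (q +ᴾ r)) i              ∎
    where open SetoidReasoning setoid

  +ᴾ-comm : ∀ p q → p +ᴾ q ≋ q +ᴾ p
  +ᴾ-comm p q = mk≋ λ i →
    trans (coeff-+ p q i) (trans (+-comm _ _) (sym (coeff-+ q p i)))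

  +ᴾ-identityʳ : ∀ p → p +ᴾ [] ≋ p
  +ᴾ-identityʳ p = +ᴾ-comm p []

  -ᴾ-cong : ∀ {p q} → p ≋ q → -ᴾ p ≋ -ᴾ q
  -ᴾ-cong {p} {q} e = mk≋ λ i →
    trans (coeff-neg p i) (trans (-‿cong (at e i)) (sym (coeff-neg q i)))

  -ᴾ-inverseˡ : ∀ p → -ᴾ p +ᴾ p ≋ []
  -ᴾ-inverseˡ p = mk≋ λ i →
    trans (coeff-+ (-ᴾ p) p i) (trans (+-congʳ (coeff-neg p i)) (-‿inverseˡ _))

  -ᴾ-inverseʳ : ∀ p → p +ᴾ -ᴾ p ≋ []
  -ᴾ-inverseʳ p = ≋-trans (+ᴾ-comm p (-ᴾ p)) (-ᴾ-inverseˡ p)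

  +ᴾ-commutativeSemigroup : CommutativeSemigroup c ℓ
  +ᴾ-commutativeSemigroup = record
    { isCommutativeSemigroup = record
      { isSemigroup = record
        { isMagma = record
          { isEquivalence = Setoid.isEquivalence ≋-setoid
          ; ∙-cong        = +ᴾ-cong
          }
        ; assoc = +ᴾ-assoc
        }
      ; comm = +ᴾ-comm
      }
    }

  private module SG = CommutativeSemigroupProperties +ᴾ-commutativeSemigroup

  ·-cong : ∀ {a b p q} → a ≈ b → p ≋ q → a · p ≋ b · q
  ·-cong {a} {b} {p} {q} e f = mk≋ λ i →
    trans (coeff-· a p i) (trans (*-cong e (at f i)) (sym (coeff-· b q i)))

  ·-distrib-+ᴾ : ∀ a p q → a · (p +ᴾ q) ≋ a · p +ᴾ a · q
  ·-distrib-+ᴾ a p q = mk≋ λ i → begin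
    coeff (a · (p +ᴾ q)) i               ≈⟨ coeff-· a (p +ᴾ q) i ⟩
    a * coeff (p +ᴾ q) i                 ≈⟨ *-congˡ (coeff-+ p q i) ⟩
    a * (coeff p i + coeff q i)          ≈⟨ distribˡ a _ _ ⟩
    a * coeff p i + a * coeff q i        ≈⟨ +-cong (coeff-· a p i) (coeff-· a q i) ⟨
    coeff (a · p) i + coeff (a · q) i    ≈⟨ coeff-+ (a · p) (a · q) i ⟨
    coeff (a · p +ᴾ a · q) i             ∎
    where open SetoidReasoning setoid

  ·-assoc : ∀ a b p → (a * b) · p ≋ a · (b · p)
  ·-assoc a b p = mk≋ λ i → begin
    coeff ((a * b) · p) i    ≈⟨ coeff-· (a * b) p i ⟩
    a * b * coeff p i        ≈⟨ *-assoc a b _ ⟩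
    a * (b * coeff p i)      ≈⟨ *-congˡ (coeff-· b p i) ⟨
    a * coeff (b · p) i      ≈⟨ coeff-· a (b · p) i ⟨
    coeff (a · (b · p)) i    ∎
    where open SetoidReasoning setoid

  ·-identity : ∀ p → 1# · p ≋ p
  ·-identity p = mk≋ λ i → trans (coeff-· 1# p i) (*-identityˡ _)

  ·-zero : ∀ p → 0# · p ≋ []
  ·-zero p = mk≋ λ i → trans (coeff-· 0# p i) (zeroˡ _)

  0∷[] : (0# ∷ []) ≋ []
  0∷[] = mk≋ λ { zero → refl ; (suc i) → refl }

  0∷-+ : ∀ p q → (0# ∷ (p +ᴾ q)) ≋ (0# ∷ p) +ᴾ (0# ∷ q)
  0∷-+ p q = ∷-cong (sym (+-identityˡ 0#)) ≋-refl

  ·-0∷ : ∀ a p → a · (0# ∷ p) ≋ (0# ∷ a · p)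
  ·-0∷ a p = ∷-cong (zeroʳ a) ≋-refl

  *ᴾ-zeroʳ : ∀ p → p *ᴾ [] ≋ []
  *ᴾ-zeroʳ []      = ≋-refl
  *ᴾ-zeroʳ (a ∷ p) = ≋-trans (∷-cong refl (*ᴾ-zeroʳ p)) 0∷[]

  *ᴾ-congˡ : ∀ p {q r} → q ≋ r → p *ᴾ q ≋ p *ᴾ r
  *ᴾ-congˡ []      e = ≋-refl
  *ᴾ-congˡ (a ∷ p) e = +ᴾ-cong (·-cong refl e) (∷-cong refl (*ᴾ-congˡ p e))

  *ᴾ-∷ʳ : ∀ p b q → p *ᴾ (b ∷ q) ≋ b · p +ᴾ (0# ∷ p *ᴾ q)
  *ᴾ-∷ʳ []      b q = ≋-sym 0∷[]
  *ᴾ-∷ʳ (a ∷ p) b q = ∷-cong (+-congʳ (*-comm a b)) (begin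
    a · q +ᴾ p *ᴾ (b ∷ q)               ≈⟨ +ᴾ-cong ≋-refl (*ᴾ-∷ʳ p b q) ⟩
    a · q +ᴾ (b · p +ᴾ (0# ∷ p *ᴾ q))   ≈⟨ SG.x∙yz≈y∙xz (a · q) (b · p) _ ⟩
    b · p +ᴾ (a · q +ᴾ (0# ∷ p *ᴾ q))   ∎)
    where open SetoidReasoning ≋-setoid

  *ᴾ-comm : ∀ p q → p *ᴾ q ≋ q *ᴾ p
  *ᴾ-comm []      q = ≋-sym (*ᴾ-zeroʳ q)
  *ᴾ-comm (a ∷ p) q =
    ≋-trans (+ᴾ-cong ≋-refl (∷-cong refl (*ᴾ-comm p q))) (≋-sym (*ᴾ-∷ʳ q a p))

  *ᴾ-cong : ∀ {p p′ q q′} → p ≋ p′ → q ≋ q′ → p *ᴾ q ≋ p′ *ᴾ q′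
  *ᴾ-cong {p} {p′} {q} {q′} e f = begin
    p *ᴾ q    ≈⟨ *ᴾ-congˡ p f ⟩
    p *ᴾ q′   ≈⟨ *ᴾ-comm p q′ ⟩
    q′ *ᴾ p   ≈⟨ *ᴾ-congˡ q′ e ⟩
    q′ *ᴾ p′  ≈⟨ *ᴾ-comm q′ p′ ⟩
    p′ *ᴾ q′  ∎
    where open SetoidReasoning ≋-setoid

  *ᴾ-distribˡ : ∀ p q r → p *ᴾ (q +ᴾ r) ≋ p *ᴾ q +ᴾ p *ᴾ r
  *ᴾ-distribˡ []      q r = ≋-refl
  *ᴾ-distribˡ (a ∷ p) q r = begin
    a · (q +ᴾ r) +ᴾ (0# ∷ p *ᴾ (q +ᴾ r))
      ≈⟨ +ᴾ-cong (·-distrib-+ᴾ a q r)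
                 (≋-trans (∷-cong refl (*ᴾ-distribˡ p q r)) (0∷-+ (p *ᴾ q) (p *ᴾ r))) ⟩
    (a · q +ᴾ a · r) +ᴾ ((0# ∷ p *ᴾ q) +ᴾ (0# ∷ p *ᴾ r))
      ≈⟨ SG.interchange (a · q) (a · r) _ _ ⟩
    (a ∷ p) *ᴾ q +ᴾ (a ∷ p) *ᴾ r ∎
    where open SetoidReasoning ≋-setoid

  *ᴾ-distribʳ : ∀ p q r → (q +ᴾ r) *ᴾ p ≋ q *ᴾ p +ᴾ r *ᴾ p
  *ᴾ-distribʳ p q r = begin
    (q +ᴾ r) *ᴾ p      ≈⟨ *ᴾ-comm (q +ᴾ r) p ⟩
    p *ᴾ (q +ᴾ r)      ≈⟨ *ᴾ-distribˡ p q r ⟩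
    p *ᴾ q +ᴾ p *ᴾ r   ≈⟨ +ᴾ-cong (*ᴾ-comm p q) (*ᴾ-comm p r) ⟩
    q *ᴾ p +ᴾ r *ᴾ p   ∎
    where open SetoidReasoning ≋-setoid

  ·-*ᴾ : ∀ a p q → (a · p) *ᴾ q ≋ a · (p *ᴾ q)
  ·-*ᴾ a []      q = ≋-refl
  ·-*ᴾ a (b ∷ p) q = begin
    (a * b) · q +ᴾ (0# ∷ (a · p) *ᴾ q)
      ≈⟨ +ᴾ-cong (·-assoc a b q)
                 (≋-trans (∷-cong refl (·-*ᴾ a p q)) (≋-sym (·-0∷ a (p *ᴾ q)))) ⟩
    a · (b · q) +ᴾ a · (0# ∷ p *ᴾ q)
      ≈⟨ ·-distrib-+ᴾ a (b · q) (0# ∷ p *ᴾ q) ⟨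
    a · ((b ∷ p) *ᴾ q) ∎
    where open SetoidReasoning ≋-setoid

  *ᴾ-assoc : ∀ p q r → (p *ᴾ q) *ᴾ r ≋ p *ᴾ (q *ᴾ r)
  *ᴾ-assoc []      q r = ≋-refl
  *ᴾ-assoc (a ∷ p) q r = begin
    (a · q +ᴾ (0# ∷ p *ᴾ q)) *ᴾ r
      ≈⟨ *ᴾ-distribʳ r (a · q) (0# ∷ p *ᴾ q) ⟩
    (a · q) *ᴾ r +ᴾ (0# · r +ᴾ (0# ∷ (p *ᴾ q) *ᴾ r))
      ≈⟨ +ᴾ-cong (·-*ᴾ a q r) (+ᴾ-cong (·-zero r) (∷-cong refl (*ᴾ-assoc p q r))) ⟩
    (a ∷ p) *ᴾ (q *ᴾ r) ∎
    where open SetoidReasoning ≋-setoid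

  *ᴾ-identityˡ : ∀ p → 1ᴾ *ᴾ p ≋ p
  *ᴾ-identityˡ p =
    ≋-trans (+ᴾ-cong (·-identity p) 0∷[]) (+ᴾ-identityʳ p)

  polynomialRing : CommutativeRing c ℓ
  polynomialRing = record
    { _≈_ = _≋_
    ; _+_ = _+ᴾ_
    ; _*_ = _*ᴾ_
    ; -_  = -ᴾ_
    ; 0#  = 0ᴾ
    ; 1#  = 1ᴾ
    ; isCommutativeRing = record
      { isRing = record
        { +-isAbelianGroup = record
          { isGroup = record
            { isMonoid = record
              { isSemigroup = CommutativeSemigroup.isSemigroup +ᴾ-commutativeSemigroup
              ; identity = (λ _ → ≋-refl) , +ᴾ-identityʳ
              }
            ; inverse = -ᴾ-inverseˡ , -ᴾ-inverseʳ
            ; ⁻¹-cong = -ᴾ-cong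
            }
          ; comm = +ᴾ-comm
          }
        ; *-cong     = *ᴾ-cong
        ; *-assoc    = *ᴾ-assoc
        ; *-identity = *ᴾ-identityˡ
                     , (λ p → ≋-trans (*ᴾ-comm p 1ᴾ) (*ᴾ-identityˡ p))
        ; distrib    = *ᴾ-distribˡ , *ᴾ-distribʳ
        }
      ; *-comm = *ᴾ-comm
      }
    }

  open SemiringDefs (RawRing.rawSemiring (CommutativeRing.rawRing polynomialRing)) public
    using (_∣_; Irreducible; _^_) renaming (product to ∏)

-- The quotient of R by the principal ideal (f).
module Quotient (R : CommutativeRing c ℓ) (f : CommutativeRing.Carrier R) where
  open CommutativeRing R
  open MagmaDefs *-rawMagma using (_∣_; _,_)
  open RingProperties ring
  private
    module +S = CommutativeSemigroupProperties +-commutativeSemigroup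
    module *S = CommutativeSemigroupProperties *-commutativeSemigroup

  private open module ≈-Reasoning = SetoidReasoning setoid

  infix 4 _∼_

  _∼_ : Carrier → Carrier → Set (c ⊔ ℓ)
  x ∼ y = f ∣ (x - y)

  ∼-refl : ∀ x → x ∼ x
  ∼-refl x = 0# , trans (zeroˡ f) (sym (-‿inverseʳ x))

  ≈⇒∼ : ∀ {x y} → x ≈ y → x ∼ y
  ≈⇒∼ {x} {y} e = 0# , trans (zeroˡ f) (sym (x≈y⇒x∙y⁻¹≈ε e))

  ∼-neg-cong : ∀ {x y} → x ∼ y → - x ∼ - y
  ∼-neg-cong {x} {y} (u , d) = - u , (begin
    - u * f    ≈⟨ -‿distribˡ-* _ _ ⟨
    - (u * f)  ≈⟨ -‿cong d ⟩
    - (x - y)  ≈⟨ -‿+-comm x (- y) ⟨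
    - x - - y  ∎)

  ∼-sym : ∀ {x y} → x ∼ y → y ∼ x
  ∼-sym {x} {y} (u , d) = - u , (begin
    - u * f    ≈⟨ -‿distribˡ-* _ _ ⟨
    - (u * f)  ≈⟨ -‿cong d ⟩
    - (x - y)  ≈⟨ ⁻¹-anti-homo‿- x y ⟩
    y - x      ∎)

  ∼-+-cong : ∀ {x x′ y y′} → x ∼ x′ → y ∼ y′ → x + y ∼ x′ + y′
  ∼-+-cong {x} {x′} {y} {y′} (u , d) (v , e) = u + v , (begin
    (u + v) * f            ≈⟨ distribʳ f _ _ ⟩
    u * f + v * f          ≈⟨ +-cong d e ⟩
    (x - x′) + (y - y′)    ≈⟨ +S.interchange x (- x′) y (- y′) ⟩
    (x + y) + (- x′ - y′)  ≈⟨ +-congˡ (-‿+-comm x′ y′) ⟩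
    (x + y) - (x′ + y′)    ∎)

  telescope : ∀ x y z → (x - y) + (y - z) ≈ x - z
  telescope x y z = begin
    (x - y) + (y - z)    ≈⟨ +-assoc x (- y) (y - z) ⟩
    x + (- y + (y - z))  ≈⟨ +-congˡ (+-assoc (- y) y (- z)) ⟨
    x + ((- y + y) - z)  ≈⟨ +-congˡ (+-congʳ (-‿inverseˡ y)) ⟩
    x + (0# - z)         ≈⟨ +-congˡ (+-identityˡ (- z)) ⟩
    x - z                ∎

  ∼-trans : ∀ {x y z} → x ∼ y → y ∼ z → x ∼ z
  ∼-trans {x} {y} {z} (u , d) (v , e) = u + v , (begin
    (u + v) * f        ≈⟨ distribʳ f _ _ ⟩
    u * f + v * f      ≈⟨ +-cong d e ⟩
    (x - y) + (y - z)  ≈⟨ telescope x y z ⟩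
    x - z              ∎)

  ∼-*-congʳ : ∀ z {x y} → x ∼ y → x * z ∼ y * z
  ∼-*-congʳ z {x} {y} (u , d) = u * z , (begin
    u * z * f      ≈⟨ *S.xy∙z≈xz∙y _ z f ⟩
    u * f * z      ≈⟨ *-congʳ d ⟩
    (x - y) * z    ≈⟨ [y-z]x≈yx-zx z x y ⟩
    x * z - y * z  ∎)

  ∼-*-cong : ∀ {x x′ y y′} → x ∼ x′ → y ∼ y′ → x * y ∼ x′ * y′
  ∼-*-cong {x} {x′} {y} {y′} p q =
    ∼-trans (∼-*-congʳ y p)
      (∼-trans (≈⇒∼ (*-comm x′ y))
        (∼-trans (∼-*-congʳ x′ q) (≈⇒∼ (*-comm y′ x′))))

  quotientRing : CommutativeRing c (c ⊔ ℓ)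
  quotientRing = record
    { _≈_ = _∼_
    ; _+_ = _+_
    ; _*_ = _*_
    ; -_  = -_
    ; 0#  = 0#
    ; 1#  = 1#
    ; isCommutativeRing = record
      { isRing = record
        { +-isAbelianGroup = record
          { isGroup = record
            { isMonoid = record
              { isSemigroup = record
                { isMagma = record
                  { isEquivalence = record { refl = ∼-refl _ ; sym = ∼-sym ; trans = ∼-trans }
                  ; ∙-cong        = ∼-+-cong
                  }
                ; assoc = λ x y z → ≈⇒∼ (+-assoc x y z)
                }
              ; identity = (λ x → ≈⇒∼ (+-identityˡ x)) , (λ x → ≈⇒∼ (+-identityʳ x))
              }
            ; inverse = (λ x → ≈⇒∼ (-‿inverseˡ x)) , (λ x → ≈⇒∼ (-‿inverseʳ x))
            ; ⁻¹-cong = ∼-neg-cong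
            }
          ; comm = λ x y → ≈⇒∼ (+-comm x y)
          }
        ; *-cong     = ∼-*-cong
        ; *-assoc    = λ x y z → ≈⇒∼ (*-assoc x y z)
        ; *-identity = (λ x → ≈⇒∼ (*-identityˡ x)) , (λ x → ≈⇒∼ (*-identityʳ x))
        ; distrib    = (λ x y z → ≈⇒∼ (distribˡ x y z)) , (λ x y z → ≈⇒∼ (distribʳ x y z))
        }
      ; *-comm = λ x y → ≈⇒∼ (*-comm x y)
      }
    }

module _ (K : Field c ℓ) where
  private module K = Field K
  open Polynomial K.commutativeRing

  infix 8 K[T]/⟨_⟩

  K[T]/⟨_⟩ : Poly → AssociativeAlgebra K c (c ⊔ ℓ)
  K[T]/⟨ f ⟩ = record
    { ring               = CommutativeRing.ring quotientRing
    ; ι                  = λ k → k ∷ []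
    ; isRingHomomorphism = record
      { isSemiringHomomorphism = record
        { isNearSemiringHomomorphism = record
          { +-isMonoidHomomorphism = record
            { isMagmaHomomorphism = record
              { isRelHomomorphism = record { cong = λ e → ≈⇒∼ (∷-cong {p = []} {[]} e ≋-refl) }
              ; homo              = λ x y → ∼-refl ((x K.+ y) ∷ [])
              }
            ; ε-homo = ≈⇒∼ 0∷[]
            }
          ; *-homo = λ x y → ≈⇒∼ (∷-cong {p = []} {[]} (K.sym (K.+-identityʳ (x K.* y))) ≋-refl)
          }
        ; 1#-homo = ∼-refl 1ᴾ
        }
      ; -‿homo = λ x → ∼-refl ((K.- x) ∷ [])
      }
    ; ι-central = λ k x → ≈⇒∼ (*ᴾ-comm (k ∷ []) x)
    }
    where
    open Quotient polynomialRing f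

module _ {K : Field c ℓ} (A : AssociativeAlgebra K a b) where
  open AssociativeAlgebra A
  open Polynomial (Field.commutativeRing K)

  evaluate : Poly → Carrier → Carrier
  evaluate []      g = 0#
  evaluate (k ∷ p) g = ι k + g * evaluate p g

  -- The monic generator of the ideal of polynomials vanishing at g.
  record IsMinimalPolynomial (μ : Poly) (g : Carrier) : Set (c ⊔ ℓ ⊔ b) where
    field
      monic    : Monic μ
      vanishes : evaluate μ g ≈ 0#
      divides  : ∀ p → evaluate p g ≈ 0# → μ ∣ p

module _ {K : Field c ℓ} (A : AssociativeAlgebra K a b) where
  open Polynomial (Field.commutativeRing K)
  open AssociativeAlgebra A using (Carrier)

  -- Every finite extension of K is isomorphic to one at the levels
  -- chosen here for the extensions L i.
  IsProductOfPrescribedForm : Set (lsuc (c ⊔ ℓ) ⊔ a ⊔ b)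
  IsProductOfPrescribedForm =
    ∃[ n ] Σ[ L ∈ (Fin n → FieldExtension K c (c ⊔ ℓ)) ] ∃[ δ ] ∃[ m ]
      (∀ i → IsFiniteSimple (L i)) ×
      (δ ≡ 0 ⊎ δ ≡ 1) ×
      (m ≡ 2 ⊎ m ≡ 3) ×
      A ≅ (Π n (λ i → FieldExtension.algebra (L i)) ⊗ K[T]/⟨_⟩ K (T ^ m) ^ᴬ δ)

  -- The irreducible factors are normalised to be monic, so that pairwise
  -- distinct factors are pairwise non-associate.
  IsMonogenicOfPrescribedForm : Set (c ⊔ ℓ ⊔ a ⊔ b)
  IsMonogenicOfPrescribedForm =
    ∃[ g ] (∀ x → (K[_] A g) x) ×
      (∃[ μ ] IsMinimalPolynomial A μ g ×
        (∃[ n ] Σ[ P ∈ (Fin n → Poly) ] ∃[ Q ] ∃[ δ ] ∃[ m ]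
          (∀ i → Irreducible (P i) × Monic (P i)) ×
          (Irreducible Q × Monic Q × HasDegree Q 1) ×
          (∀ i j → i ≢ j → ¬ (P i ≋ P j)) ×
          (∀ i → ¬ (P i ≋ Q)) ×
          (δ ≡ 0 ⊎ δ ≡ 1) ×
          (m ≡ 2 ⊎ m ≡ 3) ×
          μ ≋ ∏ P *ᴾ Q ^ (m ℕ.* δ)))

{-# OPTIONS --safe #-}
-- (1) ⇒ (3).  Over an infinite field a subalgebra is not a finite union
-- of proper subspaces, so finitely many subalgebras force A = K[g].  If
-- q f² is the minimal polynomial μ of g and deg f ≥ 2, then the
-- subalgebras K + K (g + k) q(g) f(g), k in K, are pairwise distinct.
-- Hence f² ∣ μ only for deg f ≤ 1, and applying this to products of two
-- factors of μ leaves exactly the factorisations of (3).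
--
-- (3) ⇒ (2).  Chinese remainder theorem for K[T] / (μ), followed by the
-- translation which takes the linear factor Q to T.
--
-- (2) ⇒ (1).  Induction on the number of fields.  A subalgebra of L × B
-- either contains (1 , 0), and is the product of its two projections,
-- or is the graph of a homomorphism D → L for a subalgebra D of B.  As
-- B has finitely many subalgebras, D = K[d], and d is sent to one of the
-- finitely many roots in L of a polynomial killing d.  Subfields of a
-- simple extension K(α) are counted following Steinitz: a subfield is
-- determined by the minimal polynomial of α over it, which is a monic
-- divisor of the minimal polynomial over K.
module Submission where

open import Defs
open import Algebra.Bundles using (CommutativeMonoid; CommutativeRing; RawRing)
import Algebra.Definitions.RawMonoid as RawMonoidDefs
import Algebra.Definitions.RawSemiring as RawSemiringDefs
open import Algebra.Morphism.Structures using (module RingMorphisms)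
import Algebra.Properties.CommutativeSemigroup as CommutativeSemigroupProperties
import Algebra.Properties.CommutativeSemigroup.Divisibility as CommutativeSemigroupDivisibility
import Algebra.Properties.Ring as RingProperties
import Algebra.Properties.Semiring.Divisibility as SemiringDivisibility
import Algebra.Properties.Semiring.Mult.TCOptimised as SemiringMult
import Algebra.Solver.Ring
open import Algebra.Solver.Ring.AlmostCommutativeRing using (fromCommutativeRing; _-Raw-AlmostCommutative⟶_)
open import Axiom.ExcludedMiddle using (ExcludedMiddle)
import Data.Empty as Empty
open import Data.Empty.Polymorphic using (⊥)
open import Data.Fin.Base using (Fin; zero; suc; toℕ)
open import Data.Fin.Properties using (suc-injective)
open import Data.Integer.Base as ℤ using (ℤ; +_; -[1+_])
import Data.Integer.Properties as ℤ
open import Data.List.Base using (List; []; _∷_; _++_; length; map; drop; allFin)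
open import Data.List.Membership.Propositional using (lose)
open import Data.List.Membership.Propositional.Properties using (∈-allFin)
open import Data.List.Relation.Unary.Any as Any using (Any; here; there)
import Data.List.Relation.Unary.Any.Properties as Any
open import Data.Maybe.Base using (Maybe; just; nothing)
open import Data.Nat.Base as ℕ using (ℕ; zero; suc; z≤n; s≤s)
open import Data.Nat.Induction using (<-rec)
import Data.Nat.Properties as ℕ
open import Data.Product.Base using (_×_; _,_; ∃-syntax; Σ-syntax; proj₁; proj₂)
open import Data.Sign.Base as Sign using (Sign)
open import Data.Sum.Base using (_⊎_; inj₁; inj₂)
open import Data.Unit.Polymorphic using (⊤; tt)
open import Function.Base using (_∘_)
open import Function.Bundles using (_⇔_; mk⇔)
open import Level using (Level; _⊔_) renaming (suc to lsuc)
open import Relation.Binary.Bundles using (Setoid)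
open import Relation.Binary.PropositionalEquality as ≡ using (_≡_; _≢_)
import Relation.Binary.Reasoning.Setoid as SetoidReasoning
open import Relation.Nullary using (¬_; Dec; yes; no; contradiction)

-- The exponents in (3) come from the bound on square divisors. Let `Q` be linear with `Q²` dividing
-- `μ`. A square `f²` in the cofactor, with `f` nonconstant, would give `(f Q)²`, and a factor `Q⁴`
-- is `(Q²)²`; both are squares of polynomials of degree at least 2. Hence at most one irreducible
-- factor is repeated, it is linear, and its exponent is 2 or 3. The bound 2 on the degree arises
-- when two of the subalgebras coincide: then `f` divides a polynomial of degree at most 1, which
-- must vanish. The implications form a cycle, so (2) ⇒ (3) goes through finiteness and no generator
-- of the product is exhibited. The induction for (2) ⇒ (1) carries along that every element is
-- algebraic. Inverses are then polynomials, so they stay inside subalgebras, and every generator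
-- `d` has a polynomial killing it. Finiteness means a list covering everything up to setoid
-- equality. The counts attach to each object an invariant (an image, a root, a monic divisor) from
-- a collection known to be finite.

private
  variable
    a a′ b b′ c ℓ ℓ₁ ℓ₂ ℓ₃ ℓ₄ : Level

-- Classical logic and finiteness up to setoid equality.

module Classical (em : ∀ {e} → ExcludedMiddle e) where

  ¬¬-elim : {P : Set ℓ₁} → ¬ ¬ P → P
  ¬¬-elim {P = P} ¬¬p with em {P = P}
  ... | yes x = x
  ... | no ¬p = contradiction ¬p ¬¬p

  -- Propositional resizing: subalgebras of algebras at different levels
  -- are predicates at different levels.
  Resize : ∀ e → Set ℓ₁ → Set e
  Resize e P with em {P = P}
  ... | yes _ = ⊤
  ... | no  _ = ⊥

  resize : ∀ {e} {P : Set ℓ₁} → P → Resize e P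
  resize {P = P} x with em {P = P}
  ... | yes _ = _
  ... | no ¬p = contradiction x ¬p

  unresize : ∀ {e} {P : Set ℓ₁} → Resize e P → P
  unresize {P = P} x with em {P = P}
  unresize x  | yes p = p
  unresize () | no _

  least : {P : ℕ → Set ℓ₁} → ∃[ n ] P n → ∃[ n ] P n × (∀ m → m ℕ.< n → ¬ P m)
  least {P = P} (n , pn) = <-rec (λ n → P n → ∃[ n ] P n × (∀ m → m ℕ.< n → ¬ P m)) step n pn
    where
    step : ∀ n → (∀ {m} → m ℕ.< n → P m → ∃[ n ] P n × (∀ m → m ℕ.< n → ¬ P m)) →
           P n → ∃[ n ] P n × (∀ m → m ℕ.< n → ¬ P m)
    step n rec pn with em {P = ∃[ m ] m ℕ.< n × P m}
    ... | yes (m , m<n , pm) = rec m<n pm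
    ... | no ∄               = n , pn , λ m m<n pm → ∄ (m , m<n , pm)

  module _ (S : Setoid a b) where
    open Setoid S

    -- The list has to cover `P` but may contain elements outside `P`, so finiteness passes to
    -- smaller predicates without deciding anything.
    FinitelyMany : (Carrier → Set ℓ₁) → Set (a ⊔ b ⊔ ℓ₁)
    FinitelyMany P = ∃[ xs ] ∀ x → P x → Any (x ≈_) xs

  module _ {S : Setoid a b} where
    open Setoid S

    finite-⊆ : {P : Carrier → Set ℓ₁} {Q : Carrier → Set ℓ₂} →
               (∀ x → P x → Q x) → FinitelyMany S Q → FinitelyMany S P
    finite-⊆ P⊆Q (xs , enum) = xs , λ x px → enum x (P⊆Q x px)

    finite-⇒ : {P : Carrier → Set ℓ₁} → (∀ x → P x) → FinitelyMany S P → IsFinite S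
    finite-⇒ all (xs , enum) = xs , λ x → enum x (all x)

    atMostOne⇒finite : (P : Carrier → Set ℓ₁) → (∀ x y → P x → P y → x ≈ y) → FinitelyMany S P
    atMostOne⇒finite P unique with em {P = ∃[ x ] P x}
    ... | yes (x , px) = x ∷ [] , λ y py → here (unique y x py px)
    ... | no ∄         = []     , λ y py → contradiction (y , py) ∄

    finite-∪ : {P : Carrier → Set ℓ₁} {Q : Carrier → Set ℓ₂} →
               FinitelyMany S P → FinitelyMany S Q → FinitelyMany S (λ x → P x ⊎ Q x)
    finite-∪ (xs , enum) (ys , enum′) = xs ++ ys , λ where
      x (inj₁ px) → Any.++⁺ˡ (enum x px)
      x (inj₂ qx) → Any.++⁺ʳ xs (enum′ x qx)

    finite-⋃ : {Z : Set ℓ₄} {Q : Z → Carrier → Set ℓ₂} (zs : List Z) →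
               (∀ z → FinitelyMany S (Q z)) → FinitelyMany S (λ x → Any (λ z → Q z x) zs)
    finite-⋃ []       fin = [] , λ _ ()
    finite-⋃ (z ∷ zs) fin with fin z | finite-⋃ zs fin
    ... | xs , enum | ys , enum′ = xs ++ ys , λ where
      x (here qx)  → Any.++⁺ˡ (enum x qx)
      x (there qx) → Any.++⁺ʳ xs (enum′ x qx)

    -- Each entry of `zs` rules out at most one point, so finitely many are ruled out in all. This
    -- is how the infinitude of the base field enters whenever a scalar has to be chosen
    -- generically.
    avoid : IsInfinite S → {Z : Set ℓ₄} (Q : Z → Carrier → Set ℓ₂) (zs : List Z) →
            (∀ z x y → Q z x → Q z y → x ≈ y) → ∃[ x ] ¬ Any (λ z → Q z x) zs
    avoid infinite Q zs unique = ¬¬-elim λ ∄ → infinite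
      (finite-⇒ (λ x → ¬¬-elim λ ¬any → ∄ (x , ¬any))
                (finite-⋃ zs λ z → atMostOne⇒finite (Q z) (unique z)))

  module _ {S : Setoid a b} {S′ : Setoid c ℓ} where
    private
      module S  = Setoid S
      module S′ = Setoid S′

    -- Invariants are attached by a relation `R` and not by a function, because they come from
    -- existence statements. Equal invariants force equal objects, so every entry of the list for
    -- `Q` accounts for at most one `x`.
    finite-preimage :
      {P : S.Carrier → Set ℓ₁} {Q : S′.Carrier → Set ℓ₂} (R : S.Carrier → S′.Carrier → Set ℓ₃) →
      (∀ x → P x → ∃[ y ] Q y × R x y) →
      (∀ {x x′ y y′} → P x → P x′ → R x y → R x′ y′ → y S′.≈ y′ → x S.≈ x′) →
      FinitelyMany S′ Q → FinitelyMany S P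
    finite-preimage {P = P} R total injective (ys , enum) =
      finite-⊆ {S = S}
        (λ x px → let y , qy , xRy = total x px in
          Any.map (λ y≈z → px , y , xRy , y≈z) (enum y qy))
        (finite-⋃ {S = S} ys λ z →
          atMostOne⇒finite {S = S} (λ x → P x × ∃[ y ] R x y × y S′.≈ z) λ where
            x x′ (px , y , xRy , y≈z) (px′ , y′ , x′Ry′ , y′≈z) →
              injective px px′ xRy x′Ry′ (S′.trans y≈z (S′.sym y′≈z)))

-- Identities in commutative rings.

-- Equality in R is undecidable, so cancellation is only visible to the
-- solver when the coefficients are integers.
module RingSolver (R : CommutativeRing c ℓ) where
  open CommutativeRing R
  open RingProperties ring
  open SemiringMult semiring using (1+×; ×-homo-+; ×1-homo-*) renaming (_×_ to _⨉_)
  open SetoidReasoning setoid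

  ⟦_⟧ℤ : ℤ → Carrier
  ⟦ + n ⟧ℤ      = n ⨉ 1#
  ⟦ -[1+ n ] ⟧ℤ = - (suc n ⨉ 1#)

  -‿homo-ℤ : ∀ i → ⟦ ℤ.- i ⟧ℤ ≈ - ⟦ i ⟧ℤ
  -‿homo-ℤ (+ zero)  = sym -0#≈0#
  -‿homo-ℤ (+ suc n) = refl
  -‿homo-ℤ -[1+ n ]  = sym (-‿involutive _)

  cancel : ∀ x y z → (x + y) - (x + z) ≈ y - z
  cancel x y z = begin
    (x + y) - (x + z)      ≈⟨ +-cong (+-comm x y) (sym (-‿+-comm x z)) ⟩
    (y + x) + (- x + - z)  ≈⟨ +-assoc y x _ ⟩
    y + (x + (- x + - z))  ≈⟨ +-congˡ (sym (+-assoc x (- x) (- z))) ⟩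
    y + ((x + - x) + - z)  ≈⟨ +-congˡ (+-congʳ (-‿inverseʳ x)) ⟩
    y + (0# + - z)         ≈⟨ +-congˡ (+-identityˡ _) ⟩
    y - z                  ∎

  ⊖-homo : ∀ m n → ⟦ m ℤ.⊖ n ⟧ℤ ≈ m ⨉ 1# - n ⨉ 1#
  ⊖-homo zero    zero    = sym (-‿inverseʳ 0#)
  ⊖-homo zero    (suc n) = sym (+-identityˡ _)
  ⊖-homo (suc m) zero    = sym (trans (+-congˡ -0#≈0#) (+-identityʳ _))
  ⊖-homo (suc m) (suc n) = begin
    ⟦ suc m ℤ.⊖ suc n ⟧ℤ       ≡⟨ ≡.cong ⟦_⟧ℤ (ℤ.[1+m]⊖[1+n]≡m⊖n m n) ⟩
    ⟦ m ℤ.⊖ n ⟧ℤ               ≈⟨ ⊖-homo m n ⟩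
    m ⨉ 1# - n ⨉ 1#            ≈⟨ cancel 1# (m ⨉ 1#) (n ⨉ 1#) ⟨
    (1# + m ⨉ 1#) - (1# + n ⨉ 1#)  ≈⟨ +-cong (1+× m 1#) (-‿cong (1+× n 1#)) ⟨
    suc m ⨉ 1# - suc n ⨉ 1#    ∎

  +-homo-ℤ : ∀ i j → ⟦ i ℤ.+ j ⟧ℤ ≈ ⟦ i ⟧ℤ + ⟦ j ⟧ℤ
  +-homo-ℤ (+ m)    (+ n)    = ×-homo-+ 1# m n
  +-homo-ℤ (+ m)    -[1+ n ] = ⊖-homo m (suc n)
  +-homo-ℤ -[1+ m ] (+ n)    = trans (⊖-homo n (suc m)) (+-comm _ _)
  +-homo-ℤ -[1+ m ] -[1+ n ] = begin
    - (suc (suc (m ℕ.+ n)) ⨉ 1#)        ≡⟨ ≡.cong (λ k → - (k ⨉ 1#)) (≡.cong suc (ℕ.+-suc m n)) ⟨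
    - ((suc m ℕ.+ suc n) ⨉ 1#)          ≈⟨ -‿cong (×-homo-+ 1# (suc m) (suc n)) ⟩
    - (suc m ⨉ 1# + suc n ⨉ 1#)         ≈⟨ -‿+-comm _ _ ⟨
    - (suc m ⨉ 1#) + - (suc n ⨉ 1#)     ∎

  -◃-homo : ∀ n → ⟦ Sign.- ℤ.◃ n ⟧ℤ ≈ - (n ⨉ 1#)
  -◃-homo zero    = sym -0#≈0#
  -◃-homo (suc n) = refl

  *-homo-ℤ : ∀ i j → ⟦ i ℤ.* j ⟧ℤ ≈ ⟦ i ⟧ℤ * ⟦ j ⟧ℤ
  *-homo-ℤ (+ m) (+ n) = begin
    ⟦ Sign.+ ℤ.◃ (m ℕ.* n) ⟧ℤ  ≡⟨ ≡.cong ⟦_⟧ℤ (ℤ.+◃n≡+n (m ℕ.* n)) ⟩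
    (m ℕ.* n) ⨉ 1#             ≈⟨ ×1-homo-* m n ⟩
    m ⨉ 1# * n ⨉ 1#            ∎
  *-homo-ℤ (+ m) -[1+ n ] = begin
    ⟦ Sign.- ℤ.◃ (m ℕ.* suc n) ⟧ℤ  ≈⟨ -◃-homo (m ℕ.* suc n) ⟩
    - ((m ℕ.* suc n) ⨉ 1#)         ≈⟨ -‿cong (×1-homo-* m (suc n)) ⟩
    - (m ⨉ 1# * suc n ⨉ 1#)        ≈⟨ -‿distribʳ-* _ _ ⟩
    m ⨉ 1# * - (suc n ⨉ 1#)        ∎
  *-homo-ℤ -[1+ m ] (+ n) = begin
    ⟦ Sign.- ℤ.◃ (suc m ℕ.* n) ⟧ℤ  ≈⟨ -◃-homo (suc m ℕ.* n) ⟩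
    - ((suc m ℕ.* n) ⨉ 1#)         ≈⟨ -‿cong (×1-homo-* (suc m) n) ⟩
    - (suc m ⨉ 1# * n ⨉ 1#)        ≈⟨ -‿distribˡ-* _ _ ⟩
    - (suc m ⨉ 1#) * n ⨉ 1#        ∎
  *-homo-ℤ -[1+ m ] -[1+ n ] = begin
    (suc m ℕ.* suc n) ⨉ 1#            ≈⟨ ×1-homo-* (suc m) (suc n) ⟩
    suc m ⨉ 1# * suc n ⨉ 1#           ≈⟨ -‿involutive _ ⟨
    - - (suc m ⨉ 1# * suc n ⨉ 1#)       ≈⟨ -‿cong (-‿distribʳ-* _ _) ⟩
    - (suc m ⨉ 1# * - (suc n ⨉ 1#))     ≈⟨ -‿distribˡ-* _ _ ⟩
    - (suc m ⨉ 1#) * - (suc n ⨉ 1#)   ∎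

  ℤ-homomorphism : ℤ.+-*-rawRing -Raw-AlmostCommutative⟶ fromCommutativeRing R
  ℤ-homomorphism = record
    { ⟦_⟧    = ⟦_⟧ℤ
    ; +-homo = +-homo-ℤ
    ; *-homo = *-homo-ℤ
    ; -‿homo = -‿homo-ℤ
    ; 0-homo = refl
    ; 1-homo = refl
    }

  ℤ-equal? : ∀ i j → Maybe (⟦ i ⟧ℤ ≈ ⟦ j ⟧ℤ)
  ℤ-equal? i j with i ℤ.≟ j
  ... | yes i≡j = just (reflexive (≡.cong ⟦_⟧ℤ i≡j))
  ... | no _    = nothing

  open Algebra.Solver.Ring ℤ.+-*-rawRing (fromCommutativeRing R) ℤ-homomorphism ℤ-equal? public
    using (solve; _:=_; con; _:+_; _:*_; _:-_; :-_)

module RingIdentities (R : CommutativeRing c ℓ) where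
  open CommutativeRing R
  open RingSolver R using (solve; _:=_; con; _:+_; _:*_; _:-_; :-_)

  [x-y]+y≈x : ∀ x y → (x - y) + y ≈ x
  [x-y]+y≈x = solve 2 (λ x y → (x :- y) :+ y := x) refl

  [x-y]z≈xz-yz : ∀ x y z → (x - y) * z ≈ x * z - y * z
  [x-y]z≈xz-yz = solve 3 (λ x y z → (x :- y) :* z := x :* z :- y :* z) refl

  x+y≈[z+x]+[y-z] : ∀ x y z → x + y ≈ (z + x) + (y - z)
  x+y≈[z+x]+[y-z] = solve 3 (λ x y z → x :+ y := (z :+ x) :+ (y :- z)) refl

  [xy+z]-xy≈z : ∀ x y z → (x * y + z) + (- x) * y ≈ z
  [xy+z]-xy≈z = solve 3 (λ x y z → (x :* y :+ z) :+ (:- x) :* y := z) refl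

  xy∙zw≈xz∙yw : ∀ x y z w → x * y * (z * w) ≈ x * z * (y * w)
  xy∙zw≈xz∙yw = solve 4 (λ x y z w → x :* y :* (z :* w) := x :* z :* (y :* w)) refl

  -x*y≈z*w-[x*y+w*z] : ∀ x y z w → (- x) * y ≈ z * w - (x * y + w * z)
  -x*y≈z*w-[x*y+w*z] = solve 4 (λ x y z w → (:- x) :* y := z :* w :- (x :* y :+ w :* z)) refl

  x-[x-y]≈y : ∀ x y → x + - (x - y) ≈ y
  x-[x-y]≈y = solve 2 (λ x y → x :+ :- (x :- y) := y) refl

  square-product : ∀ x y z → x * (y * z) * (x * (y * z)) ≈ x * x * y * (y * (z * z))
  square-product = solve 3 (λ x y z → x :* (y :* z) :* (x :* (y :* z)) := x :* x :* y :* (y :* (z :* z))) refl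

  x∙yy≈x∙y[y1] : ∀ x y → x * (y * y) ≈ x * (y * (y * 1#))
  x∙yy≈x∙y[y1] = solve 2 (λ x y → x :* (y :* y) := x :* (y :* (y :* con (+ 1)))) refl

  xy∙zz≈y∙[x∙zz] : ∀ x y z → x * y * (z * z) ≈ y * (x * (z * z))
  xy∙zz≈y∙[x∙zz] = solve 3 (λ x y z → x :* y :* (z :* z) := y :* (x :* (z :* z))) refl

  xy∙yy≈x∙y[y[y1]] : ∀ x y → x * y * (y * y) ≈ x * (y * (y * (y * 1#)))
  xy∙yy≈x∙y[y[y1]] =
    solve 2 (λ x y → x :* y :* (y :* y) := x :* (y :* (y :* (y :* con (+ 1))))) refl

  combination-+ : ∀ u v u′ v′ x y →
    (u + u′) * x + (v + v′) * y ≈ (u * x + v * y) + (u′ * x + v′ * y)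
  combination-+ = solve 6 (λ u v u′ v′ x y →
    (u :+ u′) :* x :+ (v :+ v′) :* y := (u :* x :+ v :* y) :+ (u′ :* x :+ v′ :* y)) refl

  combination-* : ∀ k u v x y → k * u * x + k * v * y ≈ k * (u * x + v * y)
  combination-* = solve 5 (λ k u v x y → k :* u :* x :+ k :* v :* y := k :* (u :* x :+ v :* y)) refl

-- Comaximal elements and the Chinese remainder theorem.

module Divisibility (R : CommutativeRing c ℓ) where
  open CommutativeRing R hiding (zero)
  open RingSolver R using (solve; _:=_; con; _:+_; _:*_; _:-_; :-_)
  open RawSemiringDefs (RawRing.rawSemiring rawRing) public
    using (_^_) renaming (product to ∏)
  open SemiringDivisibility semiring public
    using (_∣_; _∣0; 1∣_; ∣-refl; ∣-trans; ∣-respˡ; ∣-respʳ; x∣ʳy⇒x∣ʳzy; _,_)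
  open CommutativeSemigroupDivisibility *-commutativeSemigroup public
    using (x∣xy; ∙-cong-∣)
  open SetoidReasoning setoid

  x∣y*z : ∀ {x y} z → x ∣ y → x ∣ y * z
  x∣y*z z x∣y = ∣-respʳ (*-comm z _) (x∣ʳy⇒x∣ʳzy z x∣y)

  ∣-+ : ∀ {x y z} → x ∣ y → x ∣ z → x ∣ y + z
  ∣-+ {x} (u , ux≈y) (v , vx≈z) = u + v , trans (distribʳ x u v) (+-cong ux≈y vx≈z)

  ∣-neg : ∀ {x y} → x ∣ y → x ∣ - y
  ∣-neg {x} (u , ux≈y) =
    - u , trans (solve 2 (λ u x → :- u :* x := :- (u :* x)) refl u x) (-‿cong ux≈y)

  ∣-telescope : ∀ {d} x {y} z → d ∣ x - y → d ∣ y - z → d ∣ x - z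
  ∣-telescope x {y} z d∣x-y d∣y-z =
    ∣-respʳ (solve 3 (λ x y z → (x :- y) :+ (y :- z) := x :- z) refl x y z) (∣-+ d∣x-y d∣y-z)

  record Comaximal (x y : Carrier) : Set (c ⊔ ℓ) where
    constructor bezout
    field
      u v      : Carrier
      identity : u * x + v * y ≈ 1#

  comaximal-sym : ∀ {x y} → Comaximal x y → Comaximal y x
  comaximal-sym (bezout u v e) = bezout v u (trans (+-comm _ _) e)

  comaximal-1 : ∀ x → Comaximal x 1#
  comaximal-1 x = bezout 0# 1#
    (solve 1 (λ x → con (+ 0) :* x :+ con (+ 1) :* con (+ 1) := con (+ 1)) refl x)

  -- The product of the two Bézout identities is again one: every term except `v * y * (v′ * z)` is
  -- a multiple of `x`.
  comaximal-* : ∀ {x y z} → Comaximal x y → Comaximal x z → Comaximal x (y * z)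
  comaximal-* {x} {y} {z} (bezout u v e) (bezout u′ v′ e′) =
    bezout (u * (u′ * x + v′ * z) + v * y * u′) (v * v′) (begin
      (u * (u′ * x + v′ * z) + v * y * u′) * x + v * v′ * (y * z)
        ≈⟨ solve 7 (λ x y z u v u′ v′ →
             (u :* (u′ :* x :+ v′ :* z) :+ v :* y :* u′) :* x :+ v :* v′ :* (y :* z) :=
             (u :* x :+ v :* y) :* (u′ :* x :+ v′ :* z)) refl x y z u v u′ v′ ⟩
      (u * x + v * y) * (u′ * x + v′ * z)  ≈⟨ *-cong e e′ ⟩
      1# * 1#                              ≈⟨ *-identityˡ 1# ⟩
      1#                                   ∎)

  comaximal-^ : ∀ {x y} n → Comaximal x y → Comaximal x (y ^ n)
  comaximal-^ zero    _ = comaximal-1 _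
  comaximal-^ (suc n) e = comaximal-* e (comaximal-^ n e)

  comaximal-∏ : ∀ {x} n {P : Fin n → Carrier} → (∀ i → Comaximal x (P i)) → Comaximal x (∏ P)
  comaximal-∏ zero    _ = comaximal-1 _
  comaximal-∏ (suc n) e = comaximal-* (e zero) (comaximal-∏ n (e ∘ suc))

  -- Multiply the Bézout identity by `z`; in `u * x * z` write `z` as a multiple of `y`, and in
  -- `v * y * z` as a multiple of `x`.
  comaximal⇒*∣ : ∀ {x y z} → Comaximal x y → x ∣ z → y ∣ z → x * y ∣ z
  comaximal⇒*∣ {x} {y} {z} (bezout u v e) (a , ax≈z) (b , by≈z) = u * b + v * a , (begin
    (u * b + v * a) * (x * y)
      ≈⟨ solve 6 (λ x y u v a b →
           (u :* b :+ v :* a) :* (x :* y) := u :* x :* (b :* y) :+ v :* y :* (a :* x))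
           refl x y u v a b ⟩
    u * x * (b * y) + v * y * (a * x)  ≈⟨ +-cong (*-congˡ by≈z) (*-congˡ ax≈z) ⟩
    u * x * z + v * y * z              ≈⟨ distribʳ z _ _ ⟨
    (u * x + v * y) * z                ≈⟨ *-congʳ e ⟩
    1# * z                             ≈⟨ *-identityˡ z ⟩
    z                                  ∎)

  comaximal-∣ : ∀ {x y z} → Comaximal x y → x ∣ z * y → x ∣ z
  comaximal-∣ {x} {y} {z} (bezout u v e) (a , ax≈zy) = z * u + v * a , (begin
    (z * u + v * a) * x
      ≈⟨ solve 5 (λ x z u v a → (z :* u :+ v :* a) :* x := z :* (u :* x) :+ v :* (a :* x))
           refl x z u v a ⟩
    z * (u * x) + v * (a * x)  ≈⟨ +-congˡ (*-congˡ ax≈zy) ⟩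
    z * (u * x) + v * (z * y)
      ≈⟨ solve 5 (λ x y z u v → z :* (u :* x) :+ v :* (z :* y) := z :* (u :* x :+ v :* y))
           refl x y z u v ⟩
    z * (u * x + v * y)        ≈⟨ *-congˡ e ⟩
    z * 1#                     ≈⟨ *-identityʳ z ⟩
    z                          ∎)

  chineseRemainder : ∀ {x y} → Comaximal x y → ∀ a b → ∃[ z ] (x ∣ z - a) × (y ∣ z - b)
  chineseRemainder {x} {y} (bezout u v e) a b = z , (u * (b - a) , eqˣ) , (v * (a - b) , eqʸ)
    where
    -- By the Bézout identity `v * y` is 1 modulo `x` and `u * x` is 1 modulo `y`.
    z = u * x * b + v * y * a
    eqˣ : u * (b - a) * x ≈ z - a
    eqˣ = begin
      u * (b - a) * x
        ≈⟨ solve 6 (λ x y u v a b →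
             u :* (b :- a) :* x :=
             (u :* x :* b :+ v :* y :* a) :- (u :* x :+ v :* y) :* a) refl x y u v a b ⟩
      z - (u * x + v * y) * a  ≈⟨ +-congˡ (-‿cong (trans (*-congʳ e) (*-identityˡ a))) ⟩
      z - a                    ∎
    eqʸ : v * (a - b) * y ≈ z - b
    eqʸ = begin
      v * (a - b) * y
        ≈⟨ solve 6 (λ x y u v a b →
             v :* (a :- b) :* y :=
             (u :* x :* b :+ v :* y :* a) :- (u :* x :+ v :* y) :* b) refl x y u v a b ⟩
      z - (u * x + v * y) * b  ≈⟨ +-congˡ (-‿cong (trans (*-congʳ e) (*-identityˡ b))) ⟩
      z - b                    ∎

  factor∣∏ : ∀ {n} (P : Fin n → Carrier) i → P i ∣ ∏ P
  factor∣∏ P zero    = x∣xy _ _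
  factor∣∏ P (suc i) = x∣ʳy⇒x∣ʳzy _ (factor∣∏ (P ∘ suc) i)

  PairwiseComaximal : ∀ {n} → (Fin n → Carrier) → Set (c ⊔ ℓ)
  PairwiseComaximal P = ∀ i j → i ≢ j → Comaximal (P i) (P j)

  pairwise-tail : ∀ {n} {P : Fin (suc n) → Carrier} → PairwiseComaximal P → PairwiseComaximal (P ∘ suc)
  pairwise-tail com i j i≢j = com (suc i) (suc j) (i≢j ∘ suc-injective)

  comaximal-head : ∀ {n} {P : Fin (suc n) → Carrier} → PairwiseComaximal P → Comaximal (P zero) (∏ (P ∘ suc))
  comaximal-head com = comaximal-∏ _ λ i → com zero (suc i) λ ()

  ∏∣ : ∀ n {P : Fin n → Carrier} {z} → PairwiseComaximal P → (∀ i → P i ∣ z) → ∏ P ∣ z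
  ∏∣ zero    com d = 1∣ _
  ∏∣ (suc n) com d = comaximal⇒*∣ (comaximal-head com) (d zero) (∏∣ n (pairwise-tail com) (d ∘ suc))

  chineseRemainder-∏ : ∀ n {P : Fin n → Carrier} → PairwiseComaximal P →
                       (a : Fin n → Carrier) → ∃[ z ] ∀ i → P i ∣ z - a i
  chineseRemainder-∏ zero    com a = 0# , λ ()
  chineseRemainder-∏ (suc n) {P} com a =
    let y , y≡a         = chineseRemainder-∏ n (pairwise-tail com) (a ∘ suc)
        z , z≡a₀ , z≡y = chineseRemainder (comaximal-head com) (a zero) y
    in z , λ where
      zero    → z≡a₀
      (suc i) → ∣-telescope z (a (suc i)) (∣-trans (factor∣∏ (P ∘ suc) i) z≡y) (y≡a i)

-- Polynomials over a field: degree, division, irreducible factors, monic divisors.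

module PolynomialsOver (em : ∀ {e} → ExcludedMiddle e) (F : Field c ℓ) where
  open Classical em
  open Field F hiding (zero)
  open RingProperties ring using (-0#≈0#)
  open Polynomial commutativeRing hiding (_∣_; _^_; ∏)
  private
    module P  = CommutativeRing polynomialRing
    module SR = SetoidReasoning setoid
    module PR = SetoidReasoning ≋-setoid
  open Divisibility polynomialRing
  open RingIdentities polynomialRing

  *ᴾ-congʳ : ∀ {p q} r → p ≋ q → p *ᴾ r ≋ q *ᴾ r
  *ᴾ-congʳ {p} {q} r p≋q = *ᴾ-cong {p} {q} {r} {r} p≋q ≋-refl

  integral : ∀ {x y} → ¬ x ≈ 0# → x * y ≈ 0# → y ≈ 0#
  integral {x} {y} x≉0 xy≈0 = let x⁻¹ , xx⁻¹≈1 = inverse x x≉0 in begin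
    y                ≈⟨ *-identityˡ y ⟨
    1# * y           ≈⟨ *-congʳ xx⁻¹≈1 ⟨
    x * x⁻¹ * y      ≈⟨ *-congʳ (*-comm x x⁻¹) ⟩
    x⁻¹ * x * y      ≈⟨ *-assoc x⁻¹ x y ⟩
    x⁻¹ * (x * y)    ≈⟨ *-congˡ xy≈0 ⟩
    x⁻¹ * 0#         ≈⟨ zeroʳ x⁻¹ ⟩
    0#               ∎
    where open SR

  -- Degree strictly below `n`. Unlike `HasDegree` it admits the zero polynomial, so it applies
  -- directly to remainders.
  Bound : Poly → ℕ → Set ℓ
  Bound p n = ∀ i → n ℕ.≤ i → coeff p i ≈ 0#

  bound-length : ∀ p → Bound p (length p)
  bound-length []      i       _         = refl
  bound-length (a ∷ p) (suc i) (s≤s n≤i) = bound-length p i n≤i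

  bound-≋ : ∀ {p q} {n} → p ≋ q → Bound p n → Bound q n
  bound-≋ e b i n≤i = trans (sym (at e i)) (b i n≤i)

  bound-+ : ∀ p q {n} → Bound p n → Bound q n → Bound (p +ᴾ q) n
  bound-+ p q b b′ i n≤i =
    trans (coeff-+ p q i) (trans (+-cong (b i n≤i) (b′ i n≤i)) (+-identityˡ 0#))

  bound-neg : ∀ p {n} → Bound p n → Bound (-ᴾ p) n
  bound-neg p b i n≤i = trans (coeff-neg p i) (trans (-‿cong (b i n≤i)) -0#≈0#)

  bound-· : ∀ k p {n} → Bound p n → Bound (k · p) n
  bound-· k p b i n≤i = trans (coeff-· k p i) (trans (*-congˡ (b i n≤i)) (zeroʳ k))

  bound-zero : ∀ p → Bound p 0 → p ≋ []
  bound-zero p b = mk≋ λ i → b i z≤n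

  coeff-∷* : ∀ a p q i → coeff ((a ∷ p) *ᴾ q) i ≈ a * coeff q i + coeff (0# ∷ p *ᴾ q) i
  coeff-∷* a p q i = trans (coeff-+ (a · q) (0# ∷ p *ᴾ q) i) (+-congʳ (coeff-· a q i))

  -- Phrased with bounds, so that the coefficients at `m` and `n` may vanish. The absence of zero
  -- divisors enters only afterwards, in `degree-*`.
  *-leading : ∀ p q {m n} → Bound p (suc m) → Bound q (suc n) →
              Bound (p *ᴾ q) (suc (m ℕ.+ n)) × coeff (p *ᴾ q) (m ℕ.+ n) ≈ coeff p m * coeff q n
  *-leading []      q         bp bq = (λ _ _ → refl) , sym (zeroˡ _)
  *-leading (a ∷ p) q {zero}  {n} bp bq =
      (λ i n<i → trans (coefficient i) (trans (*-congˡ (bq i n<i)) (zeroʳ a)))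
    , coefficient n
    where
    pq≋0 : (0# ∷ p *ᴾ q) ≋ []
    pq≋0 = ≋-trans (∷-cong refl (*ᴾ-cong {p} {[]} {q} {q} (mk≋ λ i → bp (suc i) (s≤s z≤n)) ≋-refl)) 0∷[]
    coefficient : ∀ i → coeff ((a ∷ p) *ᴾ q) i ≈ a * coeff q i
    coefficient i = trans (coeff-∷* a p q i) (trans (+-congˡ (at pq≋0 i)) (+-identityʳ _))
  *-leading (a ∷ p) q {suc m} {n} bp bq =
      bound
    , (begin
        coeff ((a ∷ p) *ᴾ q) (suc (m ℕ.+ n))  ≈⟨ coefficient (m ℕ.+ n) (ℕ.m≤n+m n m) ⟩
        coeff (p *ᴾ q) (m ℕ.+ n)              ≈⟨ proj₂ rec ⟩
        coeff p m * coeff q n                 ∎)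
    where
    open SR
    rec = *-leading p q {m} {n} (λ i m<i → bp (suc i) (s≤s m<i)) bq
    coefficient : ∀ i → n ℕ.≤ i → coeff ((a ∷ p) *ᴾ q) (suc i) ≈ coeff (p *ᴾ q) i
    coefficient i n≤i = begin
      coeff ((a ∷ p) *ᴾ q) (suc i)              ≈⟨ coeff-∷* a p q (suc i) ⟩
      a * coeff q (suc i) + coeff (p *ᴾ q) i    ≈⟨ +-congʳ (*-congˡ (bq (suc i) (s≤s n≤i))) ⟩
      a * 0# + coeff (p *ᴾ q) i                 ≈⟨ +-congʳ (zeroʳ a) ⟩
      0# + coeff (p *ᴾ q) i                     ≈⟨ +-identityˡ _ ⟩
      coeff (p *ᴾ q) i                          ∎
    bound : Bound ((a ∷ p) *ᴾ q) (suc (suc m ℕ.+ n))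
    bound (suc i) (s≤s mn<i) =
      trans (coefficient i (ℕ.≤-trans (ℕ.m≤n+m n (suc m)) mn<i)) (proj₁ rec i mn<i)

  -- The list may end in zeros that cannot be recognised; excluded middle tells whether the tail
  -- vanishes.
  hasDegree : ∀ p → ¬ p ≋ [] → ∃[ d ] HasDegree p d
  hasDegree []      p≢0 = contradiction ≋-refl p≢0
  hasDegree (a ∷ p) a∷p≢0 with em {P = p ≋ []}
  ... | yes p≋0 = 0 , (λ a≈0 → a∷p≢0 (≋-trans (∷-cong a≈0 p≋0) 0∷[])) , λ where
    (suc i) _ → at p≋0 i
  ... | no p≢0 with hasDegree p p≢0
  ...   | d , lead , bound = suc d , lead , λ where
    (suc i) (s≤s d<i) → bound i d<i

  nonzero : ∀ p {d} → HasDegree p d → ¬ p ≋ []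
  nonzero p (lead , _) p≋0 = lead (at p≋0 _)

  degree< : ∀ p {d n} → HasDegree p d → Bound p n → d ℕ.< n
  degree< p {n = n} (lead , _) b = ℕ.≰⇒> λ n≤d → lead (b _ n≤d)

  degree-unique : ∀ p {d e} → HasDegree p d → HasDegree p e → d ≡ e
  degree-unique p hd he =
    ℕ.≤-antisym (ℕ.s≤s⁻¹ (degree< p hd (proj₂ he))) (ℕ.s≤s⁻¹ (degree< p he (proj₂ hd)))

  degree-≋ : ∀ {p q d} → p ≋ q → HasDegree p d → HasDegree q d
  degree-≋ {d = d} p≋q (lead , b) = (λ q≈0 → lead (trans (at p≋q d) q≈0)) , bound-≋ p≋q b

  degree-* : ∀ p q {m n} → HasDegree p m → HasDegree q n → HasDegree (p *ᴾ q) (m ℕ.+ n)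
  degree-* p q (p-lead , p-bound) (q-lead , q-bound) =
    let bound , lead = *-leading p q p-bound q-bound in
    (λ e → q-lead (integral p-lead (trans (sym lead) e))) , bound

  *-nonzero : ∀ p q → ¬ p ≋ [] → ¬ q ≋ [] → ¬ p *ᴾ q ≋ []
  *-nonzero p q p≢0 q≢0 =
    nonzero (p *ᴾ q) (degree-* p q (proj₂ (hasDegree _ p≢0)) (proj₂ (hasDegree _ q≢0)))

  *-nonzeroˡ : ∀ p q {r} → p *ᴾ q ≋ r → ¬ r ≋ [] → ¬ p ≋ []
  *-nonzeroˡ p q pq≋r r≢0 p≋0 = r≢0 (≋-trans (≋-sym pq≋r) (*ᴾ-cong {p} {[]} {q} {q} p≋0 ≋-refl))

  *-nonzeroʳ : ∀ p q {r} → p *ᴾ q ≋ r → ¬ r ≋ [] → ¬ q ≋ []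
  *-nonzeroʳ p q pq≋r = *-nonzeroˡ q p (≋-trans (*ᴾ-comm q p) pq≋r)

  degree-factors : ∀ p q {r d} → p *ᴾ q ≋ r → HasDegree r d →
                   ∃[ m ] ∃[ n ] HasDegree p m × HasDegree q n × m ℕ.+ n ≡ d
  degree-factors p q {r} pq≋r hr =
    let m , hp = hasDegree p (*-nonzeroˡ p q pq≋r (nonzero r hr))
        n , hq = hasDegree q (*-nonzeroʳ p q pq≋r (nonzero r hr))
    in m , n , hp , hq , degree-unique r (degree-≋ pq≋r (degree-* p q hp hq)) hr

  *-cancelʳ : ∀ p q r → ¬ r ≋ [] → p *ᴾ r ≋ q *ᴾ r → p ≋ q
  *-cancelʳ p q r r≢0 pr≋qr with em {P = p P.- q ≋ []}
  ... | yes p-q≋0 = begin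
    p                ≈⟨ ≋-sym ([x-y]+y≈x p q) ⟩
    (p P.- q) +ᴾ q   ≈⟨ +ᴾ-cong p-q≋0 (≋-refl {q}) ⟩
    q                ∎
    where open PR
  ... | no p-q≢0 = contradiction
    (begin
      (p P.- q) *ᴾ r
        ≈⟨ [x-y]z≈xz-yz p q r ⟩
      p *ᴾ r P.- q *ᴾ r  ≈⟨ +ᴾ-cong pr≋qr ≋-refl ⟩
      q *ᴾ r P.- q *ᴾ r  ≈⟨ -ᴾ-inverseʳ (q *ᴾ r) ⟩
      []                 ∎)
    (*-nonzero (p P.- q) r p-q≢0 r≢0)
    where open PR

  ∣-degree : ∀ {f p d e} → f ∣ p → HasDegree f d → HasDegree p e → d ℕ.≤ e
  ∣-degree {f} (q , qf≋p) hf hp with degree-factors q f qf≋p hp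
  ... | m , n , _ , hf′ , ≡.refl rewrite degree-unique f hf hf′ = ℕ.m≤n+m n m

  ∣-bound⇒zero : ∀ {f p d} → f ∣ p → HasDegree f d → Bound p d → p ≋ []
  ∣-bound⇒zero {p = p} f∣p hf b = ¬¬-elim λ p≢0 →
    let e , hp = hasDegree p p≢0 in
    ℕ.<⇒≱ (degree< p hp b) (∣-degree f∣p hf hp)

  const : Carrier → Poly
  const k = k ∷ []

  const* : ∀ k p → const k *ᴾ p ≋ k · p
  const* k p = ≋-trans (+ᴾ-cong ≋-refl 0∷[]) (+ᴾ-identityʳ (k · p))

  degree-const : ∀ {k} → ¬ k ≈ 0# → HasDegree (const k) 0
  degree-const k≉0 = k≉0 , λ { (suc i) _ → refl }

  degree-zero⇒∣1 : ∀ {p} → HasDegree p 0 → p ∣ 1ᴾ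
  degree-zero⇒∣1 {p} (lead , bound) with inverse (coeff p 0) lead
  ... | k , pk≈1 = const k , (begin
    const k *ᴾ p              ≈⟨ *ᴾ-congˡ (const k) p≋const ⟩
    const k *ᴾ const (coeff p 0)
      ≈⟨ ∷-cong {p = []} (trans (+-identityʳ _) (trans (*-comm _ _) pk≈1)) ≋-refl ⟩
    1ᴾ                        ∎)
    where
    open PR
    p≋const : p ≋ const (coeff p 0)
    p≋const = mk≋ λ { zero → refl ; (suc i) → bound (suc i) (s≤s z≤n) }

  degree-1 : HasDegree 1ᴾ 0
  degree-1 = degree-const 1≉0

  ∤1 : ∀ {p d} → HasDegree p (suc d) → ¬ p ∣ 1ᴾ
  ∤1 hp p∣1 with ∣-degree p∣1 hp degree-1
  ... | ()

  IsMonic : Poly → ℕ → Set ℓ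
  IsMonic p d = HasDegree p d × coeff p d ≈ 1#

  isMonic : ∀ p {d} → coeff p d ≈ 1# → Bound p (suc d) → IsMonic p d
  isMonic p lead bound = ((λ e → 1≉0 (trans (sym lead) e)) , bound) , lead

  monic-1 : Monic 1ᴾ
  monic-1 = 0 , degree-1 , refl

  monic-degree-zero : ∀ {p} → IsMonic p 0 → p ≋ 1ᴾ
  monic-degree-zero ((_ , bound) , lead) = mk≋ λ where
    zero    → lead
    (suc i) → bound (suc i) (s≤s z≤n)

  normalise : ∀ p {d} → HasDegree p d → ∃[ k ] (k * coeff p d ≈ 1#) × IsMonic (k · p) d
  normalise p {d} (lead , bound) with inverse (coeff p d) lead
  ... | k , pk≈1 = k , kp≈1 , isMonic (k · p) (trans (coeff-· k p d) kp≈1) (bound-· k p bound)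
    where kp≈1 = trans (*-comm k _) pk≈1

  ·∣ : ∀ f {k l} → k * l ≈ 1# → k · f ∣ f
  ·∣ f {k} {l} kl≈1 = const l , (begin
    const l *ᴾ (k · f)  ≈⟨ const* l (k · f) ⟩
    l · (k · f)         ≈⟨ ·-assoc l k f ⟨
    (l * k) · f         ≈⟨ ·-cong (trans (*-comm l k) kl≈1) ≋-refl ⟩
    1# · f              ≈⟨ ·-identity f ⟩
    f                   ∎)
    where open PR

  monic-* : ∀ p q → Monic p → Monic q → Monic (p *ᴾ q)
  monic-* p q (m , hp , p-lead) (n , hq , q-lead) = m ℕ.+ n , degree-* p q hp hq ,
    trans (proj₂ (*-leading p q (proj₂ hp) (proj₂ hq)))
          (trans (*-cong p-lead q-lead) (*-identityˡ 1#))

  monic-/ : ∀ p q {r} → p *ᴾ q ≋ r → Monic q → Monic r → Monic p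
  monic-/ p q {r} pq≋r (n , hq , q-lead) (d , hr , r-lead) with degree-factors p q pq≋r hr
  ... | m , n′ , hp , hq′ , ≡.refl with degree-unique q hq hq′
  ...   | ≡.refl = m , hp , (begin
    coeff p m                      ≈⟨ *-identityʳ _ ⟨
    coeff p m * 1#                 ≈⟨ *-congˡ q-lead ⟨
    coeff p m * coeff q n          ≈⟨ proj₂ (*-leading p q (proj₂ hp) (proj₂ hq)) ⟨
    coeff (p *ᴾ q) (m ℕ.+ n)       ≈⟨ at pq≋r (m ℕ.+ n) ⟩
    coeff r (m ℕ.+ n)              ≈⟨ r-lead ⟩
    1#                             ∎)
    where open SR

  monic-linear : ∀ k → IsMonic (k ∷ 1# ∷ []) 1
  monic-linear k = isMonic (k ∷ 1# ∷ []) refl λ { (suc zero) (s≤s ()) ; (suc (suc i)) _ → refl }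

  record IsSubring (S : Carrier → Set ℓ₁) : Set (c ⊔ ℓ ⊔ ℓ₁) where
    field
      ≈-closed   : ∀ {x y} → x ≈ y → S x → S y
      0∈         : S 0#
      +-closed   : ∀ {x y} → S x → S y → S (x + y)
      neg-closed : ∀ {x} → S x → S (- x)
      *-closed   : ∀ {x y} → S x → S y → S (x * y)

  Coeffs : (Carrier → Set ℓ₁) → Poly → Set ℓ₁
  Coeffs S p = ∀ i → S (coeff p i)

  module _ {S : Carrier → Set ℓ₁} (isSubring : IsSubring S) where
    open IsSubring isSubring

    coeffs-+ : ∀ p q → Coeffs S p → Coeffs S q → Coeffs S (p +ᴾ q)
    coeffs-+ p q sp sq i = ≈-closed (sym (coeff-+ p q i)) (+-closed (sp i) (sq i))

    coeffs-neg : ∀ p → Coeffs S p → Coeffs S (-ᴾ p)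
    coeffs-neg p sp i = ≈-closed (sym (coeff-neg p i)) (neg-closed (sp i))

    coeffs-· : ∀ {k} p → S k → Coeffs S p → Coeffs S (k · p)
    coeffs-· {k} p sk sp i = ≈-closed (sym (coeff-· k p i)) (*-closed sk (sp i))

    -- A monic divisor needs no inverses, so the remainder keeps its coefficients in any subring
    -- containing those of `f` and `p`. The count of subfields relies on this for the intersection
    -- of two subfields.
    divMod : ∀ {f d} → IsMonic f d → Coeffs S f → ∀ p → Coeffs S p →
             ∃[ q ] ∃[ r ] p ≋ q *ᴾ f +ᴾ r × Bound r d × Coeffs S r
    divMod {f} {d} monic sf [] sp = [] , [] , ≋-refl , (λ _ _ → refl) , λ _ → 0∈
    divMod {f} {d} monic@((_ , f-bound) , lead) sf (a ∷ p) sp with divMod monic sf p (sp ∘ suc)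
    ... | q , r , p≋qf+r , r-bound , sr =
      k ∷ q , (a ∷ r) P.- k · f , eq , bound
        , coeffs-+ (a ∷ r) (-ᴾ (k · f)) s[a∷r] (coeffs-neg (k · f) (coeffs-· f (s[a∷r] d) sf))
      where
      -- `a ∷ r` stands for `a + T r` and has degree at most `d`; subtracting `k · f` removes its
      -- coefficient at `d`.
      k = coeff (a ∷ r) d
      s[a∷r] : Coeffs S (a ∷ r)
      s[a∷r] zero    = sp 0
      s[a∷r] (suc i) = sr i
      eq : (a ∷ p) ≋ (k · f +ᴾ (0# ∷ q *ᴾ f)) +ᴾ ((a ∷ r) P.- k · f)
      eq = begin
        a ∷ p                             ≈⟨ ∷-cong (sym (+-identityˡ a)) p≋qf+r ⟩
        (0# ∷ q *ᴾ f) +ᴾ (a ∷ r)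
          ≈⟨ x+y≈[z+x]+[y-z] (0# ∷ q *ᴾ f) (a ∷ r) (k · f) ⟩
        (k · f +ᴾ (0# ∷ q *ᴾ f)) +ᴾ ((a ∷ r) P.- k · f) ∎
        where open PR
      a∷r-bound : Bound (a ∷ r) (suc d)
      a∷r-bound (suc i) (s≤s d≤i) = r-bound i d≤i
      bound : Bound ((a ∷ r) P.- k · f) d
      bound i d≤i with ℕ.m≤n⇒m<n∨m≡n d≤i
      ... | inj₁ d<i = bound-+ (a ∷ r) (-ᴾ (k · f)) a∷r-bound (bound-neg (k · f) (bound-· k f f-bound)) i d<i
      ... | inj₂ ≡.refl = begin
        coeff ((a ∷ r) P.- k · f) d    ≈⟨ coeff-+ (a ∷ r) (-ᴾ (k · f)) d ⟩
        k + coeff (-ᴾ (k · f)) d     ≈⟨ +-congˡ (coeff-neg (k · f) d) ⟩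
        k - coeff (k · f) d          ≈⟨ +-congˡ (-‿cong (coeff-· k f d)) ⟩
        k - k * coeff f d            ≈⟨ +-congˡ (-‿cong (*-congˡ lead)) ⟩
        k - k * 1#                   ≈⟨ +-congˡ (-‿cong (*-identityʳ k)) ⟩
        k - k                        ≈⟨ -‿inverseʳ k ⟩
        0#                           ∎
        where open SR

  _mod_ : ∀ {f d} p → IsMonic f d → ∃[ q ] ∃[ r ] p ≋ q *ᴾ f +ᴾ r × Bound r d
  p mod monic =
    let q , r , p≋qf+r , bound , _ = divMod everything monic (λ _ → tt) p (λ _ → tt)
    in q , r , p≋qf+r , bound
    where
    everything : IsSubring (λ _ → ⊤ {ℓ})
    everything = record
      { ≈-closed = λ _ _ → tt ; 0∈ = tt ; +-closed = λ _ _ → tt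
      ; neg-closed = λ _ → tt ; *-closed = λ _ _ → tt }

  remainder-zero⇒∣ : ∀ {f p} q {r} → p ≋ q *ᴾ f +ᴾ r → r ≋ [] → f ∣ p
  remainder-zero⇒∣ {f} {p} q {r} p≋qf+r r≋0 = q , (begin
    q *ᴾ f        ≈⟨ +ᴾ-identityʳ (q *ᴾ f) ⟨
    q *ᴾ f +ᴾ []  ≈⟨ +ᴾ-cong (≋-refl {q *ᴾ f}) r≋0 ⟨
    q *ᴾ f +ᴾ r   ≈⟨ p≋qf+r ⟨
    p             ∎)
    where open PR

  record IsIdeal (I : Poly → Set ℓ₁) : Set (c ⊔ ℓ ⊔ ℓ₁) where
    field
      ≋-closed : ∀ {f g} → f ≋ g → I f → I g
      +-closed : ∀ {f g} → I f → I g → I (f +ᴾ g)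
      *-closed : ∀ f {g} → I g → I (f *ᴾ g)

  -- Take an element of least degree in the ideal and make it monic. The remainder of any other
  -- element lies in the ideal too, and would have smaller degree if it were nonzero.
  monicGenerator : {I : Poly → Set ℓ₁} → IsIdeal I → ∃[ f ] I f × ¬ f ≋ [] →
                   ∃[ f ] Monic f × I f × (∀ g → I g → f ∣ g)
  monicGenerator {I = I} isIdeal (f₀ , f₀∈I , f₀≢0)
    with least {P = λ d → ∃[ f ] I f × HasDegree f d} (proj₁ (hasDegree f₀ f₀≢0) , f₀ , f₀∈I , proj₂ (hasDegree f₀ f₀≢0))
  ... | d , (f , f∈I , hf) , minimal with normalise f hf
  ...   | k , _ , monic = k · f , (d , monic) , kf∈I , divides
    where
    open IsIdeal isIdeal
    kf∈I = ≋-closed (const* k f) (*-closed (const k) f∈I)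
    divides : ∀ g → I g → k · f ∣ g
    divides g g∈I with g mod monic
    ... | q , r , g≋qf+r , bound with em {P = r ≋ []}
    ...   | yes r≋0 = remainder-zero⇒∣ q g≋qf+r r≋0
    ...   | no r≢0 = let e , hr = hasDegree r r≢0 in
      contradiction (r , r∈I , hr) (minimal e (degree< r hr bound))
      where
      open PR
      r∈I : I r
      r∈I = ≋-closed (begin
        g +ᴾ (-ᴾ q) *ᴾ (k · f)                     ≈⟨ +ᴾ-cong g≋qf+r ≋-refl ⟩
        (q *ᴾ (k · f) +ᴾ r) +ᴾ (-ᴾ q) *ᴾ (k · f)
          ≈⟨ [xy+z]-xy≈z q (k · f) r ⟩
        r ∎) (+-closed g∈I (*-closed (-ᴾ q) kf∈I))

  IsCombination : Poly → Poly → Poly → Set (c ⊔ ℓ)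
  IsCombination f g h = ∃[ u ] ∃[ v ] u *ᴾ f +ᴾ v *ᴾ g ≋ h

  combinations-isIdeal : ∀ f g → IsIdeal (IsCombination f g)
  combinations-isIdeal f g = record
    { ≋-closed = λ { h≋h′ (u , v , e) → u , v , ≋-trans e h≋h′ }
    ; +-closed = λ { (u , v , e) (u′ , v′ , e′) → u +ᴾ u′ , v +ᴾ v′ ,
        ≋-trans (combination-+ u v u′ v′ f g) (+ᴾ-cong e e′) }
    ; *-closed = λ { k (u , v , e) → k *ᴾ u , k *ᴾ v ,
        ≋-trans (combination-* k u v f g) (*ᴾ-congˡ k e) }
    }

  -- `Irreducible` does not mention zero. If `p` were zero, the factorisation `p = p * 0` would make
  -- `p` or `0` a unit.
  irreducible⇒nonzero : ∀ {p} → Irreducible p → ¬ p ≋ []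
  irreducible⇒nonzero {p} irreducible p≋0
    with Irreducible.split-∣1 irreducible {p} {[]} (≋-trans p≋0 (≋-sym (*ᴾ-zeroʳ p)))
  ... | inj₁ p∣1        = Irreducible.p∤1 irreducible p∣1
  ... | inj₂ (q , q0≋1) = 1≉0 (sym (at (≋-trans (≋-sym (*ᴾ-zeroʳ q)) q0≋1) 0))

  -- The generator `d` of the ideal of combinations is a greatest common divisor. From `f = h d`
  -- either `h` is a unit, and then `f` divides `d` and so `g`, or `d` is a unit and its combination
  -- can be scaled to 1.
  irreducible⇒comaximal : ∀ {f g} → Irreducible f → ¬ f ∣ g → Comaximal f g
  irreducible⇒comaximal {f} {g} irreducible f∤g =
    fromGenerator (monicGenerator (combinations-isIdeal f g)
                                  (f , f∈ , irreducible⇒nonzero irreducible))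
    where
    open PR
    f∈ : IsCombination f g f
    f∈ = 1ᴾ , 0ᴾ , ≋-trans (+ᴾ-identityʳ (1ᴾ *ᴾ f)) (*ᴾ-identityˡ f)
    g∈ : IsCombination f g g
    g∈ = 0ᴾ , 1ᴾ , *ᴾ-identityˡ g
    fromFactor : ∀ d h → h *ᴾ d ≋ f → d ∣ g → IsCombination f g d → h ∣ 1ᴾ ⊎ d ∣ 1ᴾ → Comaximal f g
    fromFactor d h hd≋f d∣g _ (inj₁ (e , eh≋1)) = contradiction (∣-trans (e , (begin
      e *ᴾ f           ≈⟨ *ᴾ-congˡ e hd≋f ⟨
      e *ᴾ (h *ᴾ d)    ≈⟨ *ᴾ-assoc e h d ⟨
      e *ᴾ h *ᴾ d      ≈⟨ *ᴾ-congʳ d eh≋1 ⟩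
      1ᴾ *ᴾ d          ≈⟨ *ᴾ-identityˡ d ⟩
      d                ∎)) d∣g) f∤g
    fromFactor d h hd≋f d∣g (u , v , uf+vg≋d) (inj₂ (e , ed≋1)) = bezout (e *ᴾ u) (e *ᴾ v) (begin
      e *ᴾ u *ᴾ f +ᴾ e *ᴾ v *ᴾ g  ≈⟨ combination-* e u v f g ⟩
      e *ᴾ (u *ᴾ f +ᴾ v *ᴾ g)     ≈⟨ *ᴾ-congˡ e uf+vg≋d ⟩
      e *ᴾ d                      ≈⟨ ed≋1 ⟩
      1ᴾ                          ∎)
    fromGenerator : ∃[ d ] Monic d × IsCombination f g d × (∀ h → IsCombination f g h → d ∣ h) →
                    Comaximal f g
    fromGenerator (d , _ , d∈ , d∣) with d∣ f f∈
    ... | h , hd≋f = fromFactor d h hd≋f (d∣ g g∈) d∈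
                       (Irreducible.split-∣1 irreducible (≋-sym hd≋f))

  -- A divisor of least positive degree is irreducible.
  irreducibleFactor : ∀ {p d} → HasDegree p (suc d) →
                      ∃[ f ] ∃[ e ] IsMonic f (suc e) × Irreducible f × f ∣ p
  irreducibleFactor {p} {d} hp with least {P = λ e → ∃[ f ] HasDegree f (suc e) × f ∣ p} (d , p , hp , ∣-refl)
  ... | e , (f , hf , q , qf≋p) , minimal with normalise f hf
  ...   | k , kf≈1 , monic = k · f , e , monic , record { p∤1 = ∤1 (proj₁ monic) ; split-∣1 = split } , kf∣p
    where
    open PR
    kf∣p : k · f ∣ p
    kf∣p = ∣-trans (·∣ f kf≈1) (q , qf≋p)
    split : ∀ {x y} → k · f ≋ x *ᴾ y → x ∣ 1ᴾ ⊎ y ∣ 1ᴾ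
    split {x} {y} kf≋xy with degree-factors x y (≋-sym kf≋xy) (proj₁ monic)
    ... | zero  , _     , hx , _  , _ = inj₁ (degree-zero⇒∣1 hx)
    ... | suc m , zero  , _  , hy , _ = inj₂ (degree-zero⇒∣1 hy)
    ... | suc m , suc n , hx , hy , m+n≡e =
      contradiction (x , hx , ∣-trans (y , ≋-trans (*ᴾ-comm y x) (≋-sym kf≋xy)) kf∣p)
        (minimal m (ℕ.≤-trans (ℕ.m<m+n m (s≤s z≤n)) (ℕ.≤-reflexive (ℕ.suc-injective m+n≡e))))

  MonicDivisor : Poly → Poly → Set (c ⊔ ℓ)
  MonicDivisor p f = Monic f × f ∣ p

  MultipleOfDivisor : Poly → Poly → Poly → Set (c ⊔ ℓ)
  MultipleOfDivisor h g f = ∃[ f′ ] MonicDivisor h f′ × f′ *ᴾ g ≋ f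

  monicDivisor-split : ∀ {g h p} → Monic g → Irreducible g → h *ᴾ g ≋ p → ∀ f →
                       MonicDivisor p f → MonicDivisor h f ⊎ MultipleOfDivisor h g f
  monicDivisor-split {g} {h} {p} (e , g-monic) irreducible hg≋p f (monic , f∣p) with em {P = g ∣ f}
  ... | no g∤f = inj₁ (monic ,
    comaximal-∣ (comaximal-sym (irreducible⇒comaximal irreducible g∤f))
                (∣-respʳ (≋-sym hg≋p) f∣p))
  ... | yes (f′ , f′g≋f) = inj₂ (f′ , (monic-/ f′ g f′g≋f (e , g-monic) monic , quotient f∣p) , f′g≋f)
    where
    open PR
    quotient : f ∣ p → f′ ∣ h
    quotient (q , qf≋p) = q , *-cancelʳ (q *ᴾ f′) h g (nonzero g (proj₁ g-monic)) (begin
      q *ᴾ f′ *ᴾ g    ≈⟨ *ᴾ-assoc q f′ g ⟩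
      q *ᴾ (f′ *ᴾ g)  ≈⟨ *ᴾ-congˡ q f′g≋f ⟩
      q *ᴾ f          ≈⟨ qf≋p ⟩
      p               ≈⟨ hg≋p ⟨
      h *ᴾ g          ∎)

  finite-multiples : ∀ {h g} → FinitelyMany ≋-setoid (MonicDivisor h) →
                     FinitelyMany ≋-setoid (MultipleOfDivisor h g)
  finite-multiples {h} {g} = finite-preimage {S = ≋-setoid} {S′ = ≋-setoid} (λ f f′ → f′ *ᴾ g ≋ f)
    (λ f w → w)
    (λ {f} {f̃} {f′} {f̃′} _ _ f′g≋f f̃′g≋f̃ f′≋f̃′ →
      ≋-trans (≋-sym f′g≋f) (≋-trans (*ᴾ-congʳ g f′≋f̃′) f̃′g≋f̃))

  -- Splitting off one irreducible factor at a time reduces the degree, and unique factorisation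
  -- never has to be stated. Both the roots of a polynomial and the subfields of a simple extension
  -- are counted through this list.
  finitelyManyMonicDivisors : ∀ {p} → ¬ p ≋ [] → FinitelyMany ≋-setoid (MonicDivisor p)
  finitelyManyMonicDivisors {p} p≢0 = let d , hp = hasDegree p p≢0 in <-rec Claim step d p hp
    where
    Claim : ℕ → Set (c ⊔ ℓ)
    Claim d = ∀ p → HasDegree p d → FinitelyMany ≋-setoid (MonicDivisor p)
    ≋1 : ∀ {p f} → HasDegree p 0 → MonicDivisor p f → f ≋ 1ᴾ
    ≋1 hp ((d , monic) , f∣p) with ∣-degree f∣p (proj₁ monic) hp
    ... | z≤n = monic-degree-zero monic
    step : ∀ d → (∀ {e} → e ℕ.< d → Claim e) → Claim d
    step zero rec p hp = atMostOne⇒finite {S = ≋-setoid} (MonicDivisor p)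
      λ f g f∣p g∣p → ≋-trans (≋1 hp f∣p) (≋-sym (≋1 hp g∣p))
    step (suc d) rec p hp = fromFactor (irreducibleFactor hp)
      where
      fromFactor : ∃[ f ] ∃[ e ] IsMonic f (suc e) × Irreducible f × f ∣ p →
                   FinitelyMany ≋-setoid (MonicDivisor p)
      fromFactor (g , e , g-monic , irreducible , h , hg≋p) =
        finite-⊆ {S = ≋-setoid} (monicDivisor-split (suc e , g-monic) irreducible hg≋p)
          (finite-∪ {S = ≋-setoid} divisors (finite-multiples divisors))
        where
        divisors : FinitelyMany ≋-setoid (MonicDivisor h)
        divisors = let m , n , hh , hg , m+n≡d = degree-factors h g hg≋p hp in
          rec (ℕ.<-≤-trans (ℕ.m<m+n m (ℕ.≤-trans (s≤s z≤n) (ℕ.≤-reflexive (degree-unique g (proj₁ g-monic) hg))))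
                           (ℕ.≤-reflexive m+n≡d)) h hh

-- Algebra homomorphisms, evaluation of polynomials and algebraic elements.

module _ {K : Field c ℓ} (A : AssociativeAlgebra K a b) (B : AssociativeAlgebra K a′ b′) where
  private
    module A = AssociativeAlgebra A
    module B = AssociativeAlgebra B

  record AlgebraHomomorphism : Set (c ⊔ a ⊔ b ⊔ a′ ⊔ b′) where
    field
      ⟦_⟧    : A.Carrier → B.Carrier
      ⟦⟧-cong : ∀ {x y} → x A.≈ y → ⟦ x ⟧ B.≈ ⟦ y ⟧
      +-homo : ∀ x y → ⟦ x A.+ y ⟧ B.≈ ⟦ x ⟧ B.+ ⟦ y ⟧
      *-homo : ∀ x y → ⟦ x A.* y ⟧ B.≈ ⟦ x ⟧ B.* ⟦ y ⟧
      ι-homo : ∀ k → ⟦ A.ι k ⟧ B.≈ B.ι k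

module AlgebraProperties {K : Field c ℓ} (A : AssociativeAlgebra K a b) where
  private module K = Field K
  open Polynomial K.commutativeRing hiding (_∣_; _^_; ∏)
  open AssociativeAlgebra A hiding (zero)
  open RingProperties ring using (-‿distribˡ-*)
  open RingMorphisms.IsRingHomomorphism isRingHomomorphism public
    renaming (⟦⟧-cong to ι-cong; +-homo to ι-+; *-homo to ι-*; 0#-homo to ι-0; 1#-homo to ι-1; -‿homo to ι-neg)
    using ()
  open CommutativeSemigroupProperties (CommutativeMonoid.commutativeSemigroup +-commutativeMonoid) public
    using (interchange)
  open SetoidReasoning setoid

  eval : Poly → Carrier → Carrier
  eval = evaluate A

  ι-0* : ∀ x → ι K.0# * x ≈ 0#
  ι-0* x = trans (*-congʳ ι-0) (zeroˡ x)

  ι-1* : ∀ x → ι K.1# * x ≈ x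
  ι-1* x = trans (*-congʳ ι-1) (*-identityˡ x)

  ι-*-assoc : ∀ k l x → ι (k K.* l) * x ≈ ι k * (ι l * x)
  ι-*-assoc k l x = trans (*-congʳ (ι-* k l)) (*-assoc _ _ x)

  ι-neg* : ∀ k x → ι (K.- k) * x ≈ - (ι k * x)
  ι-neg* k x = trans (*-congʳ (ι-neg k)) (sym (-‿distribˡ-* (ι k) x))

  -1•x≈-x : ∀ x → ι (K.- K.1#) * x ≈ - x
  -1•x≈-x x = trans (ι-neg* K.1# x) (-‿cong (ι-1* x))

  x∙ky≈k∙xy : ∀ k x y → x * (ι k * y) ≈ ι k * (x * y)
  x∙ky≈k∙xy k x y = begin
    x * (ι k * y)  ≈⟨ *-assoc x (ι k) y ⟨
    x * ι k * y    ≈⟨ *-congʳ (ι-central k x) ⟨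
    ι k * x * y    ≈⟨ *-assoc (ι k) x y ⟩
    ι k * (x * y)  ∎

  eval-0 : ∀ {p} g → p ≋ [] → eval p g ≈ 0#
  eval-0 {[]}    g p≋0 = refl
  eval-0 {k ∷ p} g p≋0 = begin
    ι k + g * eval p g  ≈⟨ +-cong (trans (ι-cong (at p≋0 0)) ι-0)
                                  (*-congˡ (eval-0 {p} g (mk≋ λ i → at p≋0 (suc i)))) ⟩
    0# + g * 0#         ≈⟨ +-identityˡ _ ⟩
    g * 0#              ≈⟨ zeroʳ g ⟩
    0#                  ∎

  eval-≋ : ∀ {p q} g → p ≋ q → eval p g ≈ eval q g
  eval-≋ {[]}    {q}     g p≋q = sym (eval-0 {q} g (≋-sym p≋q))
  eval-≋ {k ∷ p} {[]}    g p≋q = eval-0 {k ∷ p} g p≋q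
  eval-≋ {k ∷ p} {l ∷ q} g p≋q =
    +-cong (ι-cong (at p≋q 0)) (*-congˡ (eval-≋ {p} {q} g (mk≋ λ i → at p≋q (suc i))))

  eval-cong : ∀ p {g h} → g ≈ h → eval p g ≈ eval p h
  eval-cong []      g≈h = refl
  eval-cong (k ∷ p) g≈h = +-congˡ (*-cong g≈h (eval-cong p g≈h))

  eval-+ : ∀ p q g → eval (p +ᴾ q) g ≈ eval p g + eval q g
  eval-+ []      q       g = sym (+-identityˡ _)
  eval-+ (k ∷ p) []      g = sym (+-identityʳ _)
  eval-+ (k ∷ p) (l ∷ q) g = begin
    ι (k K.+ l) + g * eval (p +ᴾ q) g
      ≈⟨ +-cong (ι-+ k l) (trans (*-congˡ (eval-+ p q g)) (distribˡ g _ _)) ⟩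
    (ι k + ι l) + (g * eval p g + g * eval q g)  ≈⟨ interchange _ _ _ _ ⟩
    eval (k ∷ p) g + eval (l ∷ q) g              ∎

  eval-· : ∀ k p g → eval (k · p) g ≈ ι k * eval p g
  eval-· k []      g = sym (zeroʳ (ι k))
  eval-· k (l ∷ p) g = begin
    ι (k K.* l) + g * eval (k · p) g         ≈⟨ +-cong (ι-* k l) (*-congˡ (eval-· k p g)) ⟩
    ι k * ι l + g * (ι k * eval p g)         ≈⟨ +-congˡ (x∙ky≈k∙xy k g _) ⟩
    ι k * ι l + ι k * (g * eval p g)         ≈⟨ distribˡ (ι k) _ _ ⟨
    ι k * eval (l ∷ p) g                     ∎

  eval-0∷ : ∀ p g → eval (K.0# ∷ p) g ≈ g * eval p g
  eval-0∷ p g = trans (+-congʳ ι-0) (+-identityˡ _)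

  -- Commutativity of the algebra is not assumed: scalars are central, and only powers of the single
  -- element `g` are multiplied.
  eval-* : ∀ p q g → eval (p *ᴾ q) g ≈ eval p g * eval q g
  eval-* []      q g = sym (zeroˡ _)
  eval-* (k ∷ p) q g = begin
    eval (k · q +ᴾ (K.0# ∷ p *ᴾ q)) g          ≈⟨ eval-+ (k · q) (K.0# ∷ p *ᴾ q) g ⟩
    eval (k · q) g + eval (K.0# ∷ p *ᴾ q) g    ≈⟨ +-cong (eval-· k q g) (eval-0∷ (p *ᴾ q) g) ⟩
    ι k * eval q g + g * eval (p *ᴾ q) g       ≈⟨ +-congˡ (*-congˡ (eval-* p q g)) ⟩
    ι k * eval q g + g * (eval p g * eval q g) ≈⟨ +-congˡ (*-assoc g _ _) ⟨
    ι k * eval q g + g * eval p g * eval q g   ≈⟨ distribʳ _ _ _ ⟨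
    eval (k ∷ p) g * eval q g                  ∎

  eval-const : ∀ k g → eval (k ∷ []) g ≈ ι k
  eval-const k g = trans (+-congˡ (zeroʳ g)) (+-identityʳ _)

  eval-1 : ∀ g → eval 1ᴾ g ≈ 1#
  eval-1 g = trans (eval-const K.1# g) ι-1

  eval-linear : ∀ k g → eval (k ∷ K.1# ∷ []) g ≈ ι k + g
  eval-linear k g = +-congˡ (trans (*-congˡ (eval-1 g)) (*-identityʳ g))

  eval-T : ∀ g → eval T g ≈ g
  eval-T g = trans (eval-linear K.0# g) (trans (+-congʳ ι-0) (+-identityˡ g))

  eval-neg : ∀ p g → eval (-ᴾ p) g ≈ - eval p g
  eval-neg p g = begin
    eval (-ᴾ p) g                  ≈⟨ eval-≋ g -p≋-1·p ⟩
    eval ((K.- K.1#) · p) g        ≈⟨ eval-· (K.- K.1#) p g ⟩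
    ι (K.- K.1#) * eval p g        ≈⟨ -1•x≈-x _ ⟩
    - eval p g                     ∎
    where
    -p≋-1·p : -ᴾ p ≋ (K.- K.1#) · p
    -p≋-1·p = mk≋ λ i → K.trans (coeff-neg p i)
      (K.sym (K.trans (coeff-· (K.- K.1#) p i) (RingProperties.-1*x≈-x K.ring (coeff p i))))

  eval-- : ∀ p q g → eval (p +ᴾ -ᴾ q) g ≈ eval p g - eval q g
  eval-- p q g = trans (eval-+ p (-ᴾ q) g) (+-congˡ (eval-neg q g))

  K[]⇒eval : ∀ {g x} → (K[_] A g) x → ∃[ p ] eval p g ≈ x
  K[]⇒eval {g} one          = 1ᴾ , eval-1 g
  K[]⇒eval {g} generator    = T , eval-T g
  K[]⇒eval {g} (add x y)    = let p , e = K[]⇒eval x ; q , e′ = K[]⇒eval y in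
    p +ᴾ q , trans (eval-+ p q g) (+-cong e e′)
  K[]⇒eval {g} (mul x y)    = let p , e = K[]⇒eval x ; q , e′ = K[]⇒eval y in
    p *ᴾ q , trans (eval-* p q g) (*-cong e e′)
  K[]⇒eval {g} (smul k x)   = let p , e = K[]⇒eval x in
    k · p , trans (eval-· k p g) (*-congˡ e)
  K[]⇒eval {g} (resp x≈y x) = let p , e = K[]⇒eval x in p , trans e x≈y

  -- The closure conditions for a predicate at an arbitrary level; `toSubalgebra` resizes such a
  -- predicate to the level fixed by `Subalgebra`.
  record IsSubalgebra (P : Carrier → Set ℓ₁) : Set (c ⊔ a ⊔ b ⊔ ℓ₁) where
    field
      ≈-closed : ∀ {x y} → x ≈ y → P x → P y
      1∈       : P 1#
      +-closed : ∀ {x y} → P x → P y → P (x + y)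
      *-closed : ∀ {x y} → P x → P y → P (x * y)
      •-closed : ∀ k {x} → P x → P (ι k * x)

    ι∈ : ∀ k → P (ι k)
    ι∈ k = ≈-closed (*-identityʳ (ι k)) (•-closed k 1∈)

    0∈ : P 0#
    0∈ = ≈-closed ι-0 (ι∈ K.0#)

    neg-closed : ∀ {x} → P x → P (- x)
    neg-closed {x} px = ≈-closed (-1•x≈-x x) (•-closed (K.- K.1#) px)

    ∸-closed : ∀ {x y} → P x → P y → P (x - y)
    ∸-closed px py = +-closed px (neg-closed py)

    eval∈ : ∀ p {g} → P g → P (eval p g)
    eval∈ []      pg = 0∈
    eval∈ (k ∷ p) pg = +-closed (ι∈ k) (*-closed pg (eval∈ p pg))

  K[]-isSubalgebra : ∀ g → IsSubalgebra (K[_] A g)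
  K[]-isSubalgebra g = record
    { ≈-closed = resp ; 1∈ = one ; +-closed = add ; *-closed = mul ; •-closed = smul }

  isSubalgebra : (S : Subalgebra A) → IsSubalgebra (Subalgebra.member S)
  isSubalgebra S = record
    { ≈-closed = S.≈-closed ; 1∈ = S.1∈ ; +-closed = S.+-closed ; *-closed = S.*-closed ; •-closed = S.•-closed }
    where module S = Subalgebra S

module HomomorphismProperties
  {K : Field c ℓ} {A : AssociativeAlgebra K a b} {B : AssociativeAlgebra K a′ b′}
  (φ : AlgebraHomomorphism A B) where
  private
    module K = Field K
    module A where
      open AssociativeAlgebra A public
      open AlgebraProperties A public
    module B where
      open AssociativeAlgebra B public
      open AlgebraProperties B public
  open AlgebraHomomorphism φ public
  open SetoidReasoning B.setoid

  0-homo : ⟦ A.0# ⟧ B.≈ B.0#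
  0-homo = B.trans (⟦⟧-cong (A.sym A.ι-0)) (B.trans (ι-homo K.0#) B.ι-0)

  1-homo : ⟦ A.1# ⟧ B.≈ B.1#
  1-homo = B.trans (⟦⟧-cong (A.sym A.ι-1)) (B.trans (ι-homo K.1#) B.ι-1)

  neg-homo : ∀ x → ⟦ A.- x ⟧ B.≈ B.- ⟦ x ⟧
  neg-homo x = begin
    ⟦ A.- x ⟧                        ≈⟨ ⟦⟧-cong (A.-1•x≈-x x) ⟨
    ⟦ A.ι (K.- K.1#) A.* x ⟧         ≈⟨ *-homo _ x ⟩
    ⟦ A.ι (K.- K.1#) ⟧ B.* ⟦ x ⟧     ≈⟨ B.*-congʳ (ι-homo _) ⟩
    B.ι (K.- K.1#) B.* ⟦ x ⟧         ≈⟨ B.-1•x≈-x _ ⟩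
    B.- ⟦ x ⟧                        ∎

  ∸-homo : ∀ x y → ⟦ x A.- y ⟧ B.≈ ⟦ x ⟧ B.- ⟦ y ⟧
  ∸-homo x y = B.trans (+-homo x (A.- y)) (B.+-congˡ (neg-homo y))

  eval-homo : ∀ p x → ⟦ A.eval p x ⟧ B.≈ B.eval p ⟦ x ⟧
  eval-homo []      x = 0-homo
  eval-homo (k ∷ p) x = begin
    ⟦ A.ι k A.+ x A.* A.eval p x ⟧           ≈⟨ +-homo _ _ ⟩
    ⟦ A.ι k ⟧ B.+ ⟦ x A.* A.eval p x ⟧       ≈⟨ B.+-cong (ι-homo k) (*-homo x _) ⟩
    B.ι k B.+ ⟦ x ⟧ B.* ⟦ A.eval p x ⟧       ≈⟨ B.+-congˡ (B.*-congˡ (eval-homo p x)) ⟩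
    B.eval (k ∷ p) ⟦ x ⟧                     ∎

module Algebraicity (em : ∀ {e} → ExcludedMiddle e) {K : Field c ℓ} (A : AssociativeAlgebra K a b) where
  private module K = Field K
  open Classical em
  open Polynomial K.commutativeRing hiding (_∣_; _^_; ∏)
  open PolynomialsOver em K
  open AssociativeAlgebra A hiding (zero)
  open AlgebraProperties A
  open RawMonoidDefs +-rawMonoid using (sum)
  open SetoidReasoning setoid

  -- A polynomial is used as the coefficient list of a linear relation in a sequence. On the
  -- sequence of powers of `x` this becomes evaluation at `x`, so linear dependence yields an
  -- annihilating polynomial.
  combination : Poly → (ℕ → Carrier) → Carrier
  combination []      v = 0#
  combination (k ∷ p) v = ι k * v 0 + combination p (v ∘ suc)

  pairing : Poly → (ℕ → K.Carrier) → K.Carrier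
  pairing []      κ = K.0#
  pairing (k ∷ p) κ = k K.* κ 0 K.+ pairing p (κ ∘ suc)

  combination-decompose : ∀ p {v w : ℕ → Carrier} {κ x} → (∀ i → v i ≈ ι (κ i) * x + w i) →
                          combination p v ≈ ι (pairing p κ) * x + combination p w
  combination-decompose []      {x = x} v≈ = sym (trans (+-identityʳ _) (ι-0* x))
  combination-decompose (k ∷ p) {v} {w} {κ} {x} v≈ = begin
    ι k * v 0 + combination p (v ∘ suc)
      ≈⟨ +-cong (trans (*-congˡ (v≈ 0)) (distribˡ (ι k) _ _)) (combination-decompose p (v≈ ∘ suc)) ⟩
    (ι k * (ι (κ 0) * x) + ι k * w 0) + (ι rest * x + combination p (w ∘ suc))
      ≈⟨ interchange _ _ _ _ ⟩
    (ι k * (ι (κ 0) * x) + ι rest * x) + combination (k ∷ p) w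
      ≈⟨ +-congʳ (+-congʳ (ι-*-assoc k (κ 0) x)) ⟨
    (ι (k K.* κ 0) * x + ι rest * x) + combination (k ∷ p) w
      ≈⟨ +-congʳ (distribʳ x _ _) ⟨
    (ι (k K.* κ 0) + ι rest) * x + combination (k ∷ p) w
      ≈⟨ +-congʳ (*-congʳ (ι-+ _ _)) ⟨
    ι (pairing (k ∷ p) κ) * x + combination (k ∷ p) w ∎
    where rest = pairing p (κ ∘ suc)

  combination-zero : ∀ p {v} → (∀ i → v i ≈ 0#) → combination p v ≈ 0#
  combination-zero []      v≈0 = refl
  combination-zero (k ∷ p) v≈0 =
    trans (+-cong (trans (*-congˡ (v≈0 0)) (zeroʳ _)) (combination-zero p (v≈0 ∘ suc))) (+-identityˡ 0#)

  combination-+ : ∀ p q v → combination (p +ᴾ q) v ≈ combination p v + combination q v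
  combination-+ []      q       v = sym (+-identityˡ _)
  combination-+ (k ∷ p) []      v = sym (+-identityʳ _)
  combination-+ (k ∷ p) (l ∷ q) v = begin
    ι (k K.+ l) * v 0 + combination (p +ᴾ q) (v ∘ suc)
      ≈⟨ +-cong (trans (*-congʳ (ι-+ k l)) (distribʳ _ _ _)) (combination-+ p q (v ∘ suc)) ⟩
    (ι k * v 0 + ι l * v 0) + (combination p (v ∘ suc) + combination q (v ∘ suc))
      ≈⟨ interchange _ _ _ _ ⟩
    combination (k ∷ p) v + combination (l ∷ q) v ∎

  combination-· : ∀ k p v → combination (k · p) v ≈ ι k * combination p v
  combination-· k []      v = sym (zeroʳ _)
  combination-· k (l ∷ p) v =
    trans (+-cong (ι-*-assoc k l _) (combination-· k p (v ∘ suc))) (sym (distribˡ (ι k) _ _))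

  -- Multiplication by `T ^ s`. It moves the second relation in `dependent` past all the
  -- coefficients of the first, which keeps the two independent.
  shift : ℕ → Poly → Poly
  shift zero    p = p
  shift (suc s) p = K.0# ∷ shift s p

  coeff-shift : ∀ s p i → coeff (shift s p) (s ℕ.+ i) ≡ coeff p i
  coeff-shift zero    p i = ≡.refl
  coeff-shift (suc s) p i = coeff-shift s p i

  combination-shift : ∀ s p v → combination (shift s p) v ≈ combination p (λ i → v (s ℕ.+ i))
  combination-shift zero    p v = refl
  combination-shift (suc s) p v =
    trans (+-cong (ι-0* (v 0)) (combination-shift s p (v ∘ suc))) (+-identityˡ _)

  Span : ∀ {n} → (Fin n → Carrier) → Carrier → Set (c ⊔ b)
  Span {n} e x = Σ[ k ∈ (Fin n → K.Carrier) ] x ≈ sum (λ i → ι (k i) * e i)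

  -- Induction on n: the sequence minus its components along e 0 has two
  -- independent relations, a suitable combination of which also kills
  -- the components along e 0.
  dependent : ∀ n (e : Fin n → Carrier) (v : ℕ → Carrier) → (∀ i → Span e (v i)) →
              ∃[ p ] ¬ p ≋ [] × combination p v ≈ 0#
  dependent zero    e v v∈ = 1ᴾ , nonzero 1ᴾ degree-1 , combination-zero 1ᴾ (proj₂ ∘ v∈)
  dependent (suc n) e v v∈ = result
    where
    κ : ℕ → K.Carrier
    κ i = proj₁ (v∈ i) zero
    w : ℕ → Carrier
    w i = sum (λ j → ι (proj₁ (v∈ i) (suc j)) * e (suc j))
    result : ∃[ p ] ¬ p ≋ [] × combination p v ≈ 0#
    result with dependent n (e ∘ suc) w (λ i → proj₁ (v∈ i) ∘ suc , refl)
    ... | p , p≢0 , pw≈0 with dependent n (e ∘ suc) (λ i → w (length p ℕ.+ i))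
                                        (λ i → proj₁ (v∈ (length p ℕ.+ i)) ∘ suc , refl)
    ...   | q , q≢0 , qw≈0 = result′
      where
      s = length p
      k = pairing p κ
      l = pairing q (λ i → κ (s ℕ.+ i))
      pv≈ : combination p v ≈ ι k * e zero
      pv≈ = trans (combination-decompose p (proj₂ ∘ v∈)) (trans (+-congˡ pw≈0) (+-identityʳ _))
      qv≈ : combination (shift s q) v ≈ ι l * e zero
      qv≈ = trans (combination-shift s q v) (trans (combination-decompose q (λ i → proj₂ (v∈ (s ℕ.+ i))))
              (trans (+-congˡ qw≈0) (+-identityʳ _)))
      result′ : ∃[ p ] ¬ p ≋ [] × combination p v ≈ 0#
      result′ with em {P = k K.≈ K.0#}
      ... | yes k≈0 = p , p≢0 , trans pv≈ (trans (*-congʳ (trans (ι-cong k≈0) ι-0)) (zeroˡ _))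
      ... | no  k≉0 = k · shift s q +ᴾ (K.- l) · p , r≢0 , (begin
        combination (k · shift s q +ᴾ (K.- l) · p) v
          ≈⟨ combination-+ (k · shift s q) ((K.- l) · p) v ⟩
        combination (k · shift s q) v + combination ((K.- l) · p) v
          ≈⟨ +-cong (combination-· k (shift s q) v) (combination-· (K.- l) p v) ⟩
        ι k * combination (shift s q) v + ι (K.- l) * combination p v
          ≈⟨ +-cong (*-congˡ qv≈) (*-congˡ pv≈) ⟩
        ι k * (ι l * e zero) + ι (K.- l) * (ι k * e zero)
          ≈⟨ +-cong (sym (ι-*-assoc k l _)) (ι-neg* l _) ⟩
        ι (k K.* l) * e zero - ι l * (ι k * e zero)
          ≈⟨ +-congˡ (-‿cong (trans (sym (ι-*-assoc l k _)) (*-congʳ (ι-cong (K.*-comm l k))))) ⟩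
        ι (k K.* l) * e zero - ι (k K.* l) * e zero
          ≈⟨ -‿inverseʳ _ ⟩
        0# ∎)
        where
        -- From position `s` on the first relation has no coefficients left, so those of the
        -- combination are `k` times the coefficients of `q`.
        r≢0 : ¬ k · shift s q +ᴾ (K.- l) · p ≋ []
        r≢0 r≋0 = q≢0 (mk≋ λ i → integral k≉0 (q-coeff i))
          where
          q-coeff : ∀ i → k K.* coeff q i K.≈ K.0#
          q-coeff i = KR.begin
            k K.* coeff q i
              KR.≡⟨ ≡.cong (k K.*_) (coeff-shift s q i) ⟨
            k K.* coeff (shift s q) (s ℕ.+ i)
              KR.≈⟨ K.+-identityʳ _ ⟨
            k K.* coeff (shift s q) (s ℕ.+ i) K.+ K.0#
              KR.≈⟨ K.+-cong (coeff-· k (shift s q) (s ℕ.+ i))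
                             (bound-· (K.- l) p (bound-length p) (s ℕ.+ i) (ℕ.m≤m+n s i)) ⟨
            coeff (k · shift s q) (s ℕ.+ i) K.+ coeff ((K.- l) · p) (s ℕ.+ i)
              KR.≈⟨ coeff-+ (k · shift s q) ((K.- l) · p) (s ℕ.+ i) ⟨
            coeff (k · shift s q +ᴾ (K.- l) · p) (s ℕ.+ i)
              KR.≈⟨ at r≋0 (s ℕ.+ i) ⟩
            K.0# KR.∎
            where module KR = SetoidReasoning K.setoid

  power : Carrier → ℕ → Carrier
  power x zero    = 1#
  power x (suc i) = x * power x i

  combination-*ˡ : ∀ p x v → combination p (λ i → x * v i) ≈ x * combination p v
  combination-*ˡ []      x v = sym (zeroʳ x)
  combination-*ˡ (k ∷ p) x v =
    trans (+-cong (sym (x∙ky≈k∙xy k x (v 0))) (combination-*ˡ p x (v ∘ suc))) (sym (distribˡ x _ _))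

  combination-power : ∀ p x → combination p (power x) ≈ eval p x
  combination-power []      x = refl
  combination-power (k ∷ p) x =
    +-cong (*-identityʳ (ι k)) (trans (combination-*ˡ p x (power x)) (*-congˡ (combination-power p x)))

  Algebraic : Carrier → Set (c ⊔ ℓ ⊔ b)
  Algebraic x = ∃[ p ] ¬ p ≋ [] × eval p x ≈ 0#

  finiteDimensional⇒algebraic : FiniteDimensional A → ∀ x → Algebraic x
  finiteDimensional⇒algebraic (n , e , spans) x with dependent n e (power x) (spans ∘ power x)
  ... | p , p≢0 , px≈0 = p , p≢0 , trans (sym (combination-power p x)) px≈0

  minimalPolynomial : ∀ {g} → Algebraic g → ∃[ μ ] IsMinimalPolynomial A μ g
  minimalPolynomial {g} (p , p≢0 , pg≈0) with monicGenerator isIdeal (p , pg≈0 , p≢0)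
    where
    isIdeal : IsIdeal (λ f → eval f g ≈ 0#)
    isIdeal = record
      { ≋-closed = λ f≋h fg≈0 → trans (eval-≋ g (≋-sym f≋h)) fg≈0
      ; +-closed = λ {f} {h} fg≈0 hg≈0 → trans (eval-+ f h g) (trans (+-cong fg≈0 hg≈0) (+-identityˡ 0#))
      ; *-closed = λ f {h} hg≈0 → trans (eval-* f h g) (trans (*-congˡ hg≈0) (zeroʳ _))
      }
  ... | μ , monic , μg≈0 , divides = μ , record { monic = monic ; vanishes = μg≈0 ; divides = divides }

  -- Multiplying `x * p(x) = 0` by `y` strips a vanishing constant term from an annihilating
  -- polynomial. Once the constant term `k` is nonzero, multiplying `k + x * p(x) = 0` by `y` gives
  -- `k y + p(x) = 0`, which is solved for `y`.
  leftInverse∈K[x] : ∀ {x y} → Algebraic x → y * x ≈ 1# → ∃[ p ] eval p x ≈ y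
  leftInverse∈K[x] {x} {y} (p , p≢0 , px≈0) yx≈1 = go p p≢0 px≈0
    where
    cancel : ∀ z → y * (x * z) ≈ z
    cancel z = trans (sym (*-assoc y x z)) (trans (*-congʳ yx≈1) (*-identityˡ z))
    go : ∀ p → ¬ p ≋ [] → eval p x ≈ 0# → ∃[ q ] eval q x ≈ y
    go []      p≢0 _    = contradiction ≋-refl p≢0
    go (k ∷ p) p≢0 px≈0 with em {P = k K.≈ K.0#}
    ... | yes k≈0 = go p (λ p≋0 → p≢0 (≋-trans (∷-cong k≈0 p≋0) 0∷[])) (begin
      eval p x               ≈⟨ cancel _ ⟨
      y * (x * eval p x)     ≈⟨ *-congˡ (eval-0∷ p x) ⟨
      y * eval (K.0# ∷ p) x  ≈⟨ *-congˡ (+-congʳ (ι-cong k≈0)) ⟨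
      y * eval (k ∷ p) x     ≈⟨ *-congˡ px≈0 ⟩
      y * 0#                 ≈⟨ zeroʳ y ⟩
      0#                     ∎)
    ... | no k≉0 with K.inverse k k≉0
    ...   | k⁻¹ , kk⁻¹≈1 = (K.- k⁻¹) · p , (begin
      eval ((K.- k⁻¹) · p) x             ≈⟨ eval-· (K.- k⁻¹) p x ⟩
      ι (K.- k⁻¹) * eval p x             ≈⟨ ι-neg* k⁻¹ _ ⟩
      - (ι k⁻¹ * eval p x)               ≈⟨ +-identityʳ _ ⟨
      - (ι k⁻¹ * eval p x) + 0#          ≈⟨ +-congˡ (zeroʳ y) ⟨
      - (ι k⁻¹ * eval p x) + y * 0#
        ≈⟨ +-congˡ (*-congˡ (trans (*-congˡ px≈0) (zeroʳ (ι k⁻¹)))) ⟨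
      - (ι k⁻¹ * eval p x) + y * (ι k⁻¹ * eval (k ∷ p) x)
        ≈⟨ +-congˡ (x∙ky≈k∙xy k⁻¹ y _) ⟩
      - (ι k⁻¹ * eval p x) + ι k⁻¹ * (y * (ι k + x * eval p x))
        ≈⟨ +-congˡ (*-congˡ (trans (distribˡ y _ _) (+-cong (sym (ι-central k y)) (cancel _)))) ⟩
      - (ι k⁻¹ * eval p x) + ι k⁻¹ * (ι k * y + eval p x)
        ≈⟨ +-congˡ (distribˡ _ _ _) ⟩
      - (ι k⁻¹ * eval p x) + (ι k⁻¹ * (ι k * y) + ι k⁻¹ * eval p x)
        ≈⟨ +-congˡ (+-comm _ _) ⟩
      - (ι k⁻¹ * eval p x) + (ι k⁻¹ * eval p x + ι k⁻¹ * (ι k * y))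
        ≈⟨ +-assoc _ _ _ ⟨
      (- (ι k⁻¹ * eval p x) + ι k⁻¹ * eval p x) + ι k⁻¹ * (ι k * y)
        ≈⟨ +-cong (-‿inverseˡ _) (sym (ι-*-assoc k⁻¹ k y)) ⟩
      0# + ι (k⁻¹ K.* k) * y
        ≈⟨ +-identityˡ _ ⟩
      ι (k⁻¹ K.* k) * y
        ≈⟨ *-congʳ (ι-cong (K.trans (K.*-comm k⁻¹ k) kk⁻¹≈1)) ⟩
      ι K.1# * y
        ≈⟨ ι-1* y ⟩
      y ∎)

-- Factorisations of polynomials with few square divisors.

module Factorisation (em : ∀ {e} → ExcludedMiddle e) (F : Field c ℓ) where
  open Classical em
  open Field F hiding (zero)
  open Polynomial commutativeRing hiding (_∣_; _^_; ∏)
  open PolynomialsOver em F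
  open Divisibility polynomialRing
  open RingIdentities polynomialRing
  private module PR = SetoidReasoning ≋-setoid

  degree-one⇒irreducible : ∀ {p} → HasDegree p 1 → Irreducible p
  degree-one⇒irreducible {p} hp = record { p∤1 = ∤1 hp ; split-∣1 = split }
    where
    split : ∀ {x y} → p ≋ x *ᴾ y → x ∣ 1ᴾ ⊎ y ∣ 1ᴾ
    split {x} {y} p≋xy with degree-factors x y (≋-sym p≋xy) hp
    ... | zero  , _    , hx , _  , _ = inj₁ (degree-zero⇒∣1 hx)
    ... | suc _ , zero , _  , hy , _ = inj₂ (degree-zero⇒∣1 hy)
    ... | suc zero , suc _ , _ , _ , ()
    ... | suc (suc _) , suc _ , _ , _ , ()

  monic-∣1 : ∀ {p} → Monic p → p ∣ 1ᴾ → p ≋ 1ᴾ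
  monic-∣1 (d , monic) p∣1 with ∣-degree p∣1 (proj₁ monic) degree-1
  ... | z≤n = monic-degree-zero monic

  monic-irreducible-∣ : ∀ {p q} → Irreducible p → Monic p → Irreducible q → Monic q → p ∣ q → p ≋ q
  monic-irreducible-∣ {p} {q} irr-p monic-p irr-q monic-q (h , hp≋q)
    with Irreducible.split-∣1 irr-q {h} {p} (≋-sym hp≋q)
  ... | inj₂ p∣1 = contradiction p∣1 (Irreducible.p∤1 irr-p)
  ... | inj₁ h∣1 = begin
    p         ≈⟨ *ᴾ-identityˡ p ⟨
    1ᴾ *ᴾ p   ≈⟨ *ᴾ-congʳ p (monic-∣1 (monic-/ h p hp≋q monic-p monic-q) h∣1) ⟨
    h *ᴾ p    ≈⟨ hp≋q ⟩
    q         ∎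
    where open PR

  SquareFree : Poly → Set (c ⊔ ℓ)
  SquareFree p = ∀ f d → HasDegree f (suc d) → ¬ f *ᴾ f ∣ p

  record DistinctIrreducibles (p : Poly) : Set (c ⊔ ℓ) where
    field
      n           : ℕ
      P           : Fin n → Poly
      irreducible : ∀ i → Irreducible (P i) × Monic (P i)
      distinct    : ∀ i j → i ≢ j → ¬ (P i ≋ P j)
      product     : p ≋ ∏ P

    factor∣ : ∀ i → P i ∣ p
    factor∣ i = ∣-respʳ (≋-sym product) (factor∣∏ P i)

  distinctIrreducibles-∷ : ∀ {f h p} → Irreducible f × Monic f → h *ᴾ f ≋ p → ¬ f ∣ h →
                           DistinctIrreducibles h → DistinctIrreducibles p
  distinctIrreducibles-∷ {f} {h} {p} f-irreducible hf≋p f∤h factors = record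
    { n           = suc n
    ; P           = P′
    ; irreducible = irreducible′
    ; distinct    = distinct′
    ; product     = begin
        p            ≈⟨ hf≋p ⟨
        h *ᴾ f       ≈⟨ *ᴾ-comm h f ⟩
        f *ᴾ h       ≈⟨ *ᴾ-congˡ f product ⟩
        f *ᴾ ∏ P     ∎
    }
    where
    open PR
    open DistinctIrreducibles factors
    P′ : Fin (suc n) → Poly
    P′ zero    = f
    P′ (suc i) = P i
    irreducible′ : ∀ i → Irreducible (P′ i) × Monic (P′ i)
    irreducible′ zero    = f-irreducible
    irreducible′ (suc i) = irreducible i
    distinct′ : ∀ i j → i ≢ j → ¬ (P′ i ≋ P′ j)
    distinct′ zero    zero    0≢0 _   = 0≢0 ≡.refl
    distinct′ zero    (suc j) _   f≋P = f∤h (∣-respˡ (≋-sym f≋P) (factor∣ j))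
    distinct′ (suc i) zero    _   P≋f = f∤h (∣-respˡ P≋f (factor∣ i))
    distinct′ (suc i) (suc j) i≢j P≋P = distinct i j (i≢j ∘ ≡.cong suc) P≋P

  squareFree⇒distinctIrreducibles : ∀ {p} → Monic p → SquareFree p → DistinctIrreducibles p
  squareFree⇒distinctIrreducibles {p} (d , monic) = <-rec Claim step d p monic
    where
    Claim : ℕ → Set (c ⊔ ℓ)
    Claim d = ∀ p → IsMonic p d → SquareFree p → DistinctIrreducibles p
    step : ∀ d → (∀ {e} → e ℕ.< d → Claim e) → Claim d
    step zero rec p monic _ = record
      { n = 0 ; P = λ () ; irreducible = λ () ; distinct = λ () ; product = monic-degree-zero monic }
    step (suc d) rec p monic squareFree = fromFactor (irreducibleFactor (proj₁ monic))
      where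
      fromFactor : ∃[ f ] ∃[ e ] IsMonic f (suc e) × Irreducible f × f ∣ p → DistinctIrreducibles p
      fromFactor (f , e , f-monic , f-irreducible , h , hf≋p) =
        distinctIrreducibles-∷ (f-irreducible , suc e , f-monic) hf≋p f∤h (rec m<d h (proj₂ h-monic) h-squareFree)
        where
        h-monic : Monic h
        h-monic = monic-/ h f hf≋p (suc e , f-monic) (suc d , monic)
        m<d : proj₁ h-monic ℕ.< suc d
        m<d = ℕ.<-≤-trans (ℕ.m<m+n (proj₁ h-monic) (s≤s z≤n))
          (ℕ.≤-reflexive (degree-unique p
            (degree-≋ hf≋p (degree-* h f (proj₁ (proj₂ h-monic)) (proj₁ f-monic))) (proj₁ monic)))
        h-squareFree : SquareFree h
        h-squareFree q n hq q²∣h = squareFree q n hq (∣-respʳ hf≋p (x∣y*z f q²∣h))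
        f∤h : ¬ f ∣ h
        f∤h f∣h = squareFree f e (proj₁ f-monic) (∣-respʳ hf≋p (∙-cong-∣ f∣h (∣-refl {f})))

  record PrescribedFactorisation (μ : Poly) : Set (c ⊔ ℓ) where
    constructor prescribed
    field
      factorisation :
        ∃[ n ] Σ[ P ∈ (Fin n → Poly) ] ∃[ Q ] ∃[ δ ] ∃[ m ]
          (∀ i → Irreducible (P i) × Monic (P i)) ×
          (Irreducible Q × Monic Q × HasDegree Q 1) ×
          (∀ i j → i ≢ j → ¬ (P i ≋ P j)) ×
          (∀ i → ¬ (P i ≋ Q)) ×
          (δ ≡ 0 ⊎ δ ≡ 1) ×
          (m ≡ 2 ⊎ m ≡ 3) ×
          μ ≋ ∏ P *ᴾ Q ^ (m ℕ.* δ)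

  module _ (infinite : IsInfinite setoid) {μ : Poly} (μ-monic : Monic μ)
           (deg<2 : ∀ f d → HasDegree f (suc (suc d)) → ¬ f *ᴾ f ∣ μ) where

    -- Even with `δ = 0` a linear `Q` different from every `P i` has to be named. The field is
    -- infinite, so some `T + k` is not among the finitely many factors.
    squareFree⇒prescribed : SquareFree μ → PrescribedFactorisation μ
    squareFree⇒prescribed squareFree = fromRoot (avoid {S = setoid} infinite (λ i k → P i ≋ (k ∷ 1# ∷ [])) (allFin n)
        (λ i k l P≋k P≋l → at (≋-trans (≋-sym P≋k) P≋l) 0))
      where
      open DistinctIrreducibles (squareFree⇒distinctIrreducibles μ-monic squareFree)
      fromRoot : ∃[ k ] ¬ Any (λ i → P i ≋ (k ∷ 1# ∷ [])) (allFin n) → PrescribedFactorisation μ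
      fromRoot (k , avoids) = prescribed
        -- With `δ = 0` the exponent `m * δ` is 0; `m = 2` is a default value.
        (n , P , Q , 0 , 2 , irreducible , (degree-one⇒irreducible hQ , (1 , monic-linear k) , hQ) , distinct
          , (λ i P≋Q → avoids (lose (∈-allFin i) P≋Q)) , inj₁ ≡.refl , inj₁ ≡.refl
          , ≋-trans product (≋-sym (≋-trans (*ᴾ-comm (∏ P) 1ᴾ) (*ᴾ-identityˡ (∏ P)))))
        where
        Q  = k ∷ 1# ∷ []
        hQ = proj₁ (monic-linear k)

    -- If `f²` divides the cofactor `R` with `f` nonconstant, then `(f Q)²` divides `μ` although
    -- `f Q` has degree at least 2. Assuming only that `R Q²` divides `μ` treats `m = 2` and `m = 3`
    -- together.
    cofactor⇒prescribed : ∀ {Q R m} → IsMonic Q 1 → Monic R → ¬ Q ∣ R → R *ᴾ (Q *ᴾ Q) ∣ μ →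
                          m ≡ 2 ⊎ m ≡ 3 → μ ≋ R *ᴾ Q ^ (m ℕ.* 1) → PrescribedFactorisation μ
    cofactor⇒prescribed {Q} {R} {m} Q-monic R-monic Q∤R RQ²∣μ m≡ μ≋ = prescribed
      (n , P , Q , 1 , m , irreducible , (degree-one⇒irreducible (proj₁ Q-monic) , (1 , Q-monic) , proj₁ Q-monic)
        , distinct , (λ i P≋Q → Q∤R (∣-respˡ P≋Q (factor∣ i))) , inj₂ ≡.refl , m≡
        , ≋-trans μ≋ (*ᴾ-congʳ (Q ^ (m ℕ.* 1)) product))
      where
      R-squareFree : SquareFree R
      R-squareFree f d hf f²∣R = deg<2 (f *ᴾ Q) d
        (≡.subst (HasDegree (f *ᴾ Q)) (ℕ.+-comm (suc d) 1) (degree-* f Q hf (proj₁ Q-monic)))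
        (∣-trans (∣-respˡ (xy∙zw≈xz∙yw f f Q Q) (∙-cong-∣ f²∣R (∣-refl {Q *ᴾ Q}))) RQ²∣μ)
      open DistinctIrreducibles (squareFree⇒distinctIrreducibles R-monic R-squareFree)

    -- The exponent is 2 if `Q` does not divide the cofactor and 3 if it divides it once. Dividing
    -- it twice would make `(Q²)²` a divisor of `μ`, and `Q²` has degree 2.
    linearSquare⇒prescribed : ∀ {Q} → IsMonic Q 1 → Q *ᴾ Q ∣ μ → PrescribedFactorisation μ
    linearSquare⇒prescribed {Q} Q-monic (R , RQ²≋μ) with em {P = Q ∣ R}
    ... | no Q∤R = cofactor⇒prescribed Q-monic R-monic Q∤R (1ᴾ , ≋-trans (*ᴾ-identityˡ _) RQ²≋μ) (inj₁ ≡.refl)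
      (≋-trans (≋-sym RQ²≋μ) (x∙yy≈x∙y[y1] R Q))
      where
      R-monic = monic-/ R (Q *ᴾ Q) RQ²≋μ (monic-* Q Q (1 , Q-monic) (1 , Q-monic)) μ-monic
    ... | yes (R′ , R′Q≋R) = cofactor⇒prescribed Q-monic R′-monic Q∤R′
      (Q , ≋-trans (≋-sym (xy∙zz≈y∙[x∙zz] R′ Q Q)) eq) (inj₂ ≡.refl)
      (≋-trans (≋-sym eq) (xy∙yy≈x∙y[y[y1]] R′ Q))
      where
      R-monic = monic-/ R (Q *ᴾ Q) RQ²≋μ (monic-* Q Q (1 , Q-monic) (1 , Q-monic)) μ-monic
      R′-monic = monic-/ R′ Q R′Q≋R (1 , Q-monic) R-monic
      eq : R′ *ᴾ Q *ᴾ (Q *ᴾ Q) ≋ μ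
      eq = ≋-trans (*ᴾ-congʳ (Q *ᴾ Q) R′Q≋R) RQ²≋μ
      Q∤R′ : ¬ Q ∣ R′
      Q∤R′ Q∣R′ = deg<2 (Q *ᴾ Q) 0 (degree-* Q Q (proj₁ Q-monic) (proj₁ Q-monic))
        (∣-respʳ eq (∙-cong-∣ (∙-cong-∣ Q∣R′ (∣-refl {Q})) (∣-refl {Q *ᴾ Q})))

    HasLinearSquare : Set (c ⊔ ℓ)
    HasLinearSquare = ∃[ f ] HasDegree f 1 × f *ᴾ f ∣ μ

    prescribedFactorisation : PrescribedFactorisation μ
    prescribedFactorisation = decide em
      where
      decide : Dec HasLinearSquare → PrescribedFactorisation μ
      decide (no ∄) = squareFree⇒prescribed λ where
        f zero    hf f²∣μ → ∄ (f , hf , f²∣μ)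
        f (suc d) hf f²∣μ → deg<2 f d hf f²∣μ
      decide (yes (f , hf , f²∣μ)) =
        let k , kf≈1 , kf-monic = normalise f hf
        in linearSquare⇒prescribed {k · f} kf-monic (∣-trans (∙-cong-∣ (·∣ f kf≈1) (·∣ f kf≈1)) f²∣μ)

-- Subalgebras: generators when there are finitely many, and `K + K w` with `w² = 0`.

module Subalgebras (em : ∀ {e} → ExcludedMiddle e) {K : Field c ℓ} (A : AssociativeAlgebra K a b) where
  private module K = Field K
  open Classical em
  open Polynomial K.commutativeRing hiding (_∣_; _^_; ∏)
  open AssociativeAlgebra A hiding (zero)
  open AlgebraProperties A
  open Subalgebra using (member)
  open SetoidReasoning setoid

  toSubalgebra : {P : Carrier → Set ℓ₁} → IsSubalgebra P → Subalgebra A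
  toSubalgebra {P = P} S = record
    { member   = λ x → Resize _ (P x)
    ; ≈-closed = λ x≈y px → resize (S.≈-closed x≈y (unresize px))
    ; 1∈       = resize S.1∈
    ; +-closed = λ px py → resize (S.+-closed (unresize px) (unresize py))
    ; *-closed = λ px py → resize (S.*-closed (unresize px) (unresize py))
    ; •-closed = λ k px → resize (S.•-closed k (unresize px))
    }
    where module S = IsSubalgebra S

  ∈to : {P : Carrier → Set ℓ₁} (S : IsSubalgebra P) → ∀ {x} → P x → member (toSubalgebra S) x
  ∈to S = resize

  ∈from : {P : Carrier → Set ℓ₁} (S : IsSubalgebra P) → ∀ {x} → member (toSubalgebra S) x → P x
  ∈from S = unresize

  module _ (infinite : IsInfinite K.setoid) {C : Carrier → Set ℓ₁} (C-isSubalgebra : IsSubalgebra C) where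
    private module C = IsSubalgebra C-isSubalgebra

    Proper : Subalgebra A → Set _
    Proper B = ∃[ y ] C y × ¬ member B y

    separate : ∀ {Z : Set ℓ₂} {P : Z → Set ℓ₃} {Q : Z → Set ℓ₄} zs →
               ¬ Any P zs → Any Q zs → Any (λ z → ¬ P z × Q z) zs
    separate (z ∷ zs) ¬any (here q)  = here (¬any ∘ here , q)
    separate (z ∷ zs) ¬any (there q) = there (separate zs (¬any ∘ there) q)

    -- The line y + k x meets B (which contains x but not y) nowhere,
    -- and each of the remaining subspaces (which do not contain x) at
    -- most once.
    avoidProper : ∀ Bs → ∃[ x ] C x × ¬ Any (λ B → Proper B × member B x) Bs
    avoidProper []       = 1# , C.1∈ , λ ()
    avoidProper (B ∷ Bs) = extend (avoidProper Bs)
      where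
      extend : ∃[ x ] C x × ¬ Any (λ B → Proper B × member B x) Bs →
               ∃[ x ] C x × ¬ Any (λ B → Proper B × member B x) (B ∷ Bs)
      extend (x , cx , avoids) with em {P = Proper B × member B x}
      ... | no ¬B = x , cx , λ { (here b) → ¬B b ; (there b) → avoids b }
      ... | yes ((y , cy , y∉B) , x∈B) = line (avoid {S = K.setoid} infinite Hits Bs unique)
        where
        -- The first component, combined with properness, says that `x` is not in `V`. This makes
        -- the predicate hold for at most one `k`: two values would put a nonzero multiple of `x`
        -- into `V`.
        Hits : Subalgebra A → K.Carrier → Set _
        Hits V k = ¬ (Proper V × member V x) × Proper V × member V (ι k * x + y)
        unique : ∀ V k l → Hits V k → Hits V l → k K.≈ l
        unique V k l (x∉V , proper , k∈) (_ , _ , l∈) = ¬¬-elim λ k≉l →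
          let k-l≉0 = λ e → k≉l (x∙y⁻¹≈ε⇒x≈y k l e)
              m , [k-l]m≈1 = K.inverse (k K.- l) k-l≉0
          in x∉V (proper , V.≈-closed (difference m [k-l]m≈1) (V.•-closed m (V.∸-closed k∈ l∈)))
          where
          module V = IsSubalgebra (isSubalgebra V)
          open RingProperties K.ring using (x∙y⁻¹≈ε⇒x≈y)
          difference : ∀ m → (k K.- l) K.* m K.≈ K.1# →
                       ι m * ((ι k * x + y) - (ι l * x + y)) ≈ x
          difference m [k-l]m≈1 = begin
            ι m * ((ι k * x + y) - (ι l * x + y))
              ≈⟨ *-congˡ (+-congˡ (RingProperties.-‿+-comm ring (ι l * x) y)) ⟨
            ι m * ((ι k * x + y) + (- (ι l * x) - y))
              ≈⟨ *-congˡ (interchange _ _ _ _) ⟩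
            ι m * ((ι k * x - ι l * x) + (y - y))
              ≈⟨ *-congˡ (trans (+-congˡ (-‿inverseʳ y)) (+-identityʳ _)) ⟩
            ι m * (ι k * x - ι l * x)
              ≈⟨ *-congˡ (+-congˡ (ι-neg* l x)) ⟨
            ι m * (ι k * x + ι (K.- l) * x)
              ≈⟨ *-congˡ (trans (*-congʳ (ι-+ k (K.- l))) (distribʳ x _ _)) ⟨
            ι m * (ι (k K.- l) * x)
              ≈⟨ ι-*-assoc m (k K.- l) x ⟨
            ι (m K.* (k K.- l)) * x
              ≈⟨ *-congʳ (ι-cong (K.trans (K.*-comm m _) [k-l]m≈1)) ⟩
            ι K.1# * x
              ≈⟨ ι-1* x ⟩
            x ∎
        line : ∃[ k ] ¬ Any (λ V → Hits V k) Bs →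
               ∃[ x ] C x × ¬ Any (λ B → Proper B × member B x) (B ∷ Bs)
        line (k , ¬hits) = ι k * x + y , C.+-closed (C.•-closed k cx) cy , λ
          { (here (_ , kx+y∈B)) → y∉B (B.≈-closed cancel (B.∸-closed kx+y∈B (B.•-closed k x∈B)))
          ; (there hits)        → ¬hits (separate Bs avoids hits) }
          where
          module B = IsSubalgebra (isSubalgebra B)
          cancel : (ι k * x + y) - ι k * x ≈ y
          cancel = begin
            (ι k * x + y) - ι k * x  ≈⟨ +-congʳ (+-comm _ y) ⟩
            (y + ι k * x) - ι k * x  ≈⟨ +-assoc y _ _ ⟩
            y + (ι k * x - ι k * x)  ≈⟨ +-congˡ (-‿inverseʳ _) ⟩
            y + 0#                   ≈⟨ +-identityʳ y ⟩
            y                        ∎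

    -- `g` is chosen in `C` outside every listed subalgebra that misses part of `C`. Now `K[g]` is
    -- itself listed up to equality and contains `g`, so it misses nothing. The relative form in `C`
    -- serves the whole algebra here and each of its subalgebras in (2) ⇒ (1).
    monogenic : FinitelyManySubalgebras A → ∃[ g ] C g × (∀ x → C x → (K[_] A g) x)
    monogenic (Bs , enum) = fromAvoiding (avoidProper Bs)
      where
      fromAvoiding : ∃[ x ] C x × ¬ Any (λ B → Proper B × member B x) Bs →
                     ∃[ g ] C g × (∀ x → C x → (K[_] A g) x)
      fromAvoiding (g , cg , avoids) = g , cg , λ x cx → ¬¬-elim λ x∉K[g] →
        avoids (Any.map (λ {B} (K[g]⊆B , B⊆K[g]) →
          (x , cx , λ x∈B → x∉K[g] (∈from (K[]-isSubalgebra g) (B⊆K[g] x∈B)))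
          , K[g]⊆B (∈to (K[]-isSubalgebra g) generator))
          (enum (toSubalgebra (K[]-isSubalgebra g))))

  SquareZeroExtension : Carrier → Carrier → Set _
  SquareZeroExtension w x = ∃[ k ] ∃[ l ] x ≈ ι k + ι l * w

  squareZeroExtension-isSubalgebra : ∀ {w} → w * w ≈ 0# → IsSubalgebra (SquareZeroExtension w)
  squareZeroExtension-isSubalgebra {w} w²≈0 = record
    { ≈-closed = λ { x≈y (k , l , e) → k , l , trans (sym x≈y) e }
    ; 1∈       = K.1# , K.0# , sym (trans (+-cong ι-1 (ι-0* w)) (+-identityʳ 1#))
    ; +-closed = λ { (k , l , e) (k′ , l′ , e′) → k K.+ k′ , l K.+ l′ , (begin
        _                                       ≈⟨ +-cong e e′ ⟩
        (ι k + ι l * w) + (ι k′ + ι l′ * w)     ≈⟨ interchange _ _ _ _ ⟩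
        (ι k + ι k′) + (ι l * w + ι l′ * w)     ≈⟨ +-congˡ (distribʳ w _ _) ⟨
        (ι k + ι k′) + (ι l + ι l′) * w         ≈⟨ +-cong (ι-+ k k′) (*-congʳ (ι-+ l l′)) ⟨
        ι (k K.+ k′) + ι (l K.+ l′) * w         ∎) }
    ; *-closed = λ { (k , l , e) (k′ , l′ , e′) → k K.* k′ , k K.* l′ K.+ k′ K.* l , (begin
        _                                                     ≈⟨ *-cong e e′ ⟩
        (ι k + ι l * w) * (ι k′ + ι l′ * w)                   ≈⟨ distribʳ _ _ _ ⟩
        ι k * (ι k′ + ι l′ * w) + ι l * w * (ι k′ + ι l′ * w) ≈⟨ +-cong (distribˡ _ _ _) (distribˡ _ _ _) ⟩
        (ι k * ι k′ + ι k * (ι l′ * w)) + (ι l * w * ι k′ + ι l * w * (ι l′ * w))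
          ≈⟨ +-cong (+-cong (sym (ι-* k k′)) (sym (ι-*-assoc k l′ w))) (+-cong
               (trans (sym (ι-central k′ _)) (sym (ι-*-assoc k′ l w))) (vanish l l′)) ⟩
        (ι (k K.* k′) + ι (k K.* l′) * w) + (ι (k′ K.* l) * w + 0#)
          ≈⟨ trans (+-congˡ (+-identityʳ _)) (+-assoc _ _ _) ⟩
        ι (k K.* k′) + (ι (k K.* l′) * w + ι (k′ K.* l) * w)
          ≈⟨ +-congˡ (trans (*-congʳ (ι-+ _ _)) (distribʳ w _ _)) ⟨
        ι (k K.* k′) + ι (k K.* l′ K.+ k′ K.* l) * w          ∎) }
    ; •-closed = λ { m (k , l , e) → m K.* k , m K.* l , (begin
        _                                ≈⟨ *-congˡ e ⟩
        ι m * (ι k + ι l * w)            ≈⟨ distribˡ _ _ _ ⟩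
        ι m * ι k + ι m * (ι l * w)      ≈⟨ +-cong (ι-* m k) (ι-*-assoc m l w) ⟨
        ι (m K.* k) + ι (m K.* l) * w    ∎) }
    }
    where
    vanish : ∀ l l′ → ι l * w * (ι l′ * w) ≈ 0#
    vanish l l′ = begin
      ι l * w * (ι l′ * w)      ≈⟨ x∙ky≈k∙xy l′ _ w ⟩
      ι l′ * (ι l * w * w)      ≈⟨ *-congˡ (*-assoc _ w w) ⟩
      ι l′ * (ι l * (w * w))    ≈⟨ *-congˡ (*-congˡ w²≈0) ⟩
      ι l′ * (ι l * 0#)         ≈⟨ *-congˡ (zeroʳ _) ⟩
      ι l′ * 0#                 ≈⟨ zeroʳ _ ⟩
      0#                        ∎

-- Square divisors of the minimal polynomial yield infinitely many subalgebras.

module FiniteToMonogenic (em : ∀ {e} → ExcludedMiddle e) {K : Field c ℓ} (A : AssociativeAlgebra K a b)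
                         (infinite : IsInfinite (Field.setoid K)) (finite : FinitelyManySubalgebras A) where
  private module K = Field K
  open Classical em
  open Polynomial K.commutativeRing hiding (_∣_; _^_; ∏)
  open PolynomialsOver em K
  open Divisibility polynomialRing
  open RingIdentities polynomialRing
  open Factorisation em K
  open AssociativeAlgebra A hiding (zero)
  open AlgebraProperties A
  open Algebraicity em A
  open Subalgebras em A
  open RingProperties K.ring using () renaming (x∙y⁻¹≈ε⇒x≈y to x-y≈0⇒x≈y)

  -- If q f² = μ with deg f ≥ 2, then N = q f squares to zero modulo μ
  -- and the subalgebras K + K (T + k) N, for k in K, are distinct.
  module _ {g μ} (minimal : IsMinimalPolynomial A μ g) {f q d}
           (hf : HasDegree f (suc (suc d))) (qff≋μ : q *ᴾ (f *ᴾ f) ≋ μ) where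
    open IsMinimalPolynomial minimal

    N : Poly
    N = q *ᴾ f

    line : K.Carrier → Poly
    line k = k ∷ K.1# ∷ []

    w : K.Carrier → Carrier
    w k = eval (line k *ᴾ N) g

    μ≢0 : ¬ μ ≋ []
    μ≢0 = nonzero μ (proj₁ (proj₂ monic))

    Nf≋μ : N *ᴾ f ≋ μ
    Nf≋μ = ≋-trans (*ᴾ-assoc q f f) qff≋μ

    eval-multiple : ∀ p → μ ∣ p → eval p g ≈ 0#
    eval-multiple p (h , hμ≋p) = trans (eval-≋ g (≋-sym hμ≋p))
      (trans (eval-* h μ g) (trans (*-congˡ vanishes) (zeroʳ _)))

    w²≈0 : ∀ k → w k * w k ≈ 0#
    w²≈0 k = trans (sym (eval-* (line k *ᴾ N) (line k *ᴾ N) g))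
      (eval-multiple _ (∣-respʳ (≋-sym (square-product (line k) q f))
        (x∣ʳy⇒x∣ʳzy (line k *ᴾ line k *ᴾ q) (∣-respˡ qff≋μ ∣-refl))))

    B : K.Carrier → Subalgebra A
    B k = toSubalgebra (squareZeroExtension-isSubalgebra (w²≈0 k))

    open Setoid (subalgebraSetoid A) using () renaming (_≈_ to _≈ˢ_)

    -- Suppose `w k = s + t * w l` and put `D = (T + k) - t (T + l)`, so that `μ` divides `D N - s`.
    -- Since `f` divides both `μ` and `N`, it divides the constant `s`, which is therefore 0.
    -- Cancelling `N` from `μ = N f` shows that `f` divides `D`; but `D` has degree at most 1, so
    -- `D = 0`, and its two coefficients give `t = 1` and `k = l`.
    B-injective : ∀ {k l} → B k ≈ˢ B l → k K.≈ l
    B-injective {k} {l} (Bk⊆Bl , _) = fromCombination (∈from (squareZeroExtension-isSubalgebra (w²≈0 l))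
      (Bk⊆Bl (∈to (squareZeroExtension-isSubalgebra (w²≈0 k))
        (K.0# , K.1# , sym (trans (+-cong ι-0 (ι-1* _)) (+-identityˡ _))))))
      where
      fromCombination : SquareZeroExtension (w l) (w k) → k K.≈ l
      fromCombination (s , t , wk≈s+twl) = K.trans k≈tl (K.trans (K.*-congʳ (K.sym 1≈t)) (K.*-identityˡ l))
        where
        D = line k +ᴾ -ᴾ (t · line l)
        μ∣ : μ ∣ D *ᴾ N +ᴾ -ᴾ const s
        μ∣ = divides _ (begin
          eval (D *ᴾ N +ᴾ -ᴾ const s) g        ≈⟨ eval-- (D *ᴾ N) (const s) g ⟩
          eval (D *ᴾ N) g - eval (const s) g   ≈⟨ +-cong eval-DN (-‿cong (eval-const s g)) ⟩
          (w k - ι t * w l) - ι s              ≈⟨ +-congʳ (+-congʳ wk≈s+twl) ⟩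
          ((ι s + ι t * w l) - ι t * w l) - ι s
            ≈⟨ +-congʳ (trans (+-assoc _ _ _) (trans (+-congˡ (-‿inverseʳ _)) (+-identityʳ _))) ⟩
          ι s - ι s                            ≈⟨ -‿inverseʳ _ ⟩
          0#                                   ∎)
          where
          open SetoidReasoning setoid
          eval-DN : eval (D *ᴾ N) g ≈ w k - ι t * w l
          eval-DN = begin
            eval (D *ᴾ N) g
              ≈⟨ eval-≋ g ([x-y]z≈xz-yz (line k) (t · line l) N) ⟩
            eval (line k *ᴾ N +ᴾ -ᴾ ((t · line l) *ᴾ N)) g
              ≈⟨ eval-- (line k *ᴾ N) ((t · line l) *ᴾ N) g ⟩
            w k - eval ((t · line l) *ᴾ N) g
              ≈⟨ +-congˡ (-‿cong (trans (eval-≋ g (·-*ᴾ t (line l) N)) (eval-· t (line l *ᴾ N) g))) ⟩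
            w k - ι t * w l ∎
        s≈0 : s K.≈ K.0#
        s≈0 = at (∣-bound⇒zero (∣-respʳ (x-[x-y]≈y (D *ᴾ N) (const s))
            (∣-+ (x∣ʳy⇒x∣ʳzy D (x∣ʳy⇒x∣ʳzy q ∣-refl)) (∣-neg (∣-trans (N , Nf≋μ) μ∣))))
          hf (λ { (suc i) _ → K.refl })) 0
        f∣D : f ∣ D
        f∣D = cancel μ∣
          where
          open SetoidReasoning ≋-setoid
          cancel : μ ∣ D *ᴾ N +ᴾ -ᴾ const s → f ∣ D
          cancel (h , hμ≋) = h , *-cancelʳ (h *ᴾ f) D N (*-nonzeroˡ N f Nf≋μ μ≢0) (begin
            h *ᴾ f *ᴾ N           ≈⟨ *ᴾ-assoc h f N ⟩
            h *ᴾ (f *ᴾ N)         ≈⟨ *ᴾ-congˡ h (≋-trans (*ᴾ-comm f N) Nf≋μ) ⟩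
            h *ᴾ μ                ≈⟨ hμ≋ ⟩
            D *ᴾ N +ᴾ -ᴾ const s
              ≈⟨ +ᴾ-cong (≋-refl {D *ᴾ N}) (-ᴾ-cong (≋-trans (∷-cong {p = []} s≈0 ≋-refl) 0∷[])) ⟩
            D *ᴾ N +ᴾ []          ≈⟨ +ᴾ-identityʳ (D *ᴾ N) ⟩
            D *ᴾ N                ∎)
        D≋0 : D ≋ []
        D≋0 = ∣-bound⇒zero f∣D hf λ { (suc zero) (s≤s ()) ; (suc (suc i)) _ → K.refl }
        k≈tl : k K.≈ t K.* l
        k≈tl = x-y≈0⇒x≈y k (t K.* l) (at D≋0 0)
        1≈t : K.1# K.≈ t
        1≈t = K.trans (x-y≈0⇒x≈y K.1# (t K.* K.1#) (at D≋0 1)) (K.*-identityʳ t)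

    squareDivisor-absurd : Empty.⊥
    squareDivisor-absurd = infinite (finite-⇒ {S = K.setoid} {P = λ _ → ⊤ {ℓ}} (λ _ → tt)
      (finite-preimage {S = K.setoid} {S′ = subalgebraSetoid A} {Q = λ _ → ⊤ {ℓ}} (λ k C → B k ≈ˢ C)
        (λ k _ → B k , tt , refl′ {B k})
        (λ {k} {l} {C} {D} _ _ k~C l~D C≈D →
          B-injective {k} {l} (trans′ {B k} {C} {B l} k~C (trans′ {C} {D} {B l} C≈D (sym′ {B l} {D} l~D))))
        (proj₁ finite , λ x _ → proj₂ finite x)))
      where open Setoid (subalgebraSetoid A) using () renaming (refl to refl′; sym to sym′; trans to trans′)

  isMonogenic : FiniteDimensional A → IsMonogenicOfPrescribedForm A
  isMonogenic fd = fromGenerator (monogenic infinite {C = λ _ → ⊤ {ℓ}} everything finite)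
    where
    everything : IsSubalgebra (λ _ → ⊤)
    everything = record { ≈-closed = λ _ _ → tt ; 1∈ = tt ; +-closed = λ _ _ → tt
                        ; *-closed = λ _ _ → tt ; •-closed = λ _ _ → tt }
    fromGenerator : ∃[ g ] ⊤ {ℓ} × (∀ x → ⊤ → (K[_] A g) x) → IsMonogenicOfPrescribedForm A
    fromGenerator (g , _ , generates) = g , (λ x → generates x tt) , μ , minimal
      , PrescribedFactorisation.factorisation (prescribedFactorisation infinite (IsMinimalPolynomial.monic minimal) deg<2)
      where
      minimalPolynomial-g = minimalPolynomial (finiteDimensional⇒algebraic fd g)
      μ = proj₁ minimalPolynomial-g
      minimal = proj₂ minimalPolynomial-g
      deg<2 : ∀ f d → HasDegree f (suc (suc d)) → ¬ f *ᴾ f ∣ μ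
      deg<2 f d hf (q , qff≋μ) = squareDivisor-absurd minimal {f} {q} hf qff≋μ

-- Presentations by one generator and quotients of the polynomial ring.

module _ (K : Field c ℓ) where
  private module K = Field K
  open Polynomial K.commutativeRing

  polynomialAlgebra : AssociativeAlgebra K c ℓ
  polynomialAlgebra = record
    { ring               = CommutativeRing.ring polynomialRing
    ; ι                  = λ k → k ∷ []
    ; isRingHomomorphism = record
      { isSemiringHomomorphism = record
        { isNearSemiringHomomorphism = record
          { +-isMonoidHomomorphism = record
            { isMagmaHomomorphism = record
              { isRelHomomorphism = record { cong = λ e → ∷-cong {p = []} {[]} e ≋-refl }
              ; homo              = λ _ _ → ≋-refl
              }
            ; ε-homo = 0∷[]
            }
          ; *-homo = λ x y → ∷-cong {p = []} {[]} (K.sym (K.+-identityʳ (x K.* y))) ≋-refl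
          }
        ; 1#-homo = ≋-refl
        }
      ; -‿homo = λ _ → ≋-refl
      }
    ; ι-central = λ k x → *ᴾ-comm (k ∷ []) x
    }

  evaluation : (A : AssociativeAlgebra K a b) (g : AssociativeAlgebra.Carrier A) →
               AlgebraHomomorphism polynomialAlgebra A
  evaluation A g = record
    { ⟦_⟧     = λ p → eval p g
    ; ⟦⟧-cong = eval-≋ g
    ; +-homo  = λ p q → eval-+ p q g
    ; *-homo  = λ p q → eval-* p q g
    ; ι-homo  = λ k → eval-const k g
    }
    where open AlgebraProperties A

  T*p≋0∷p : ∀ p → T *ᴾ p ≋ (K.0# ∷ p)
  T*p≋0∷p p = ≋-trans (+ᴾ-cong (·-zero p) (∷-cong K.refl
    (≋-trans (+ᴾ-cong (·-identity p) 0∷[]) (+ᴾ-identityʳ p)))) ≋-refl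

  ∷-decompose : ∀ k p → (k ∷ p) ≋ (k ∷ []) +ᴾ T *ᴾ p
  ∷-decompose k p = ≋-trans (∷-cong (K.sym (K.+-identityʳ k)) ≋-refl) (+ᴾ-cong (≋-refl {k ∷ []}) (≋-sym (T*p≋0∷p p)))

  open AlgebraProperties polynomialAlgebra using (eval)

  eval-T≋ : ∀ p → eval p T ≋ p
  eval-T≋ []      = ≋-refl
  eval-T≋ (k ∷ p) = ≋-trans (+ᴾ-cong (≋-refl {k ∷ []}) (*ᴾ-congˡ T (eval-T≋ p))) (≋-sym (∷-decompose k p))

module _ {K : Field c ℓ} {A : AssociativeAlgebra K a b} {B : AssociativeAlgebra K a′ b′} where
  private
    module K = Field K
    module A where
      open AssociativeAlgebra A public
      open AlgebraProperties A public
    module B where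
      open AssociativeAlgebra B public
      open AlgebraProperties B public
  open Polynomial K.commutativeRing hiding (_∣_; _^_; ∏)

  -- Both algebras are quotients of `K[T]`, by evaluation at `g` and by `Φ`, with the same kernel.
  -- `to` applies `Φ` to some polynomial representing its argument, and the inclusion of kernels
  -- makes the choice of that polynomial irrelevant.
  samePresentation⇒≅ : ∀ {g} → (∀ x → (K[_] A g) x) → (Φ : AlgebraHomomorphism (polynomialAlgebra K) B) →
    (let open AlgebraHomomorphism Φ) →
    (∀ p → A.eval p g A.≈ A.0# → ⟦ p ⟧ B.≈ B.0#) →
    (∀ p → ⟦ p ⟧ B.≈ B.0# → A.eval p g A.≈ A.0#) →
    (∀ y → ∃[ p ] ⟦ p ⟧ B.≈ y) →
    A ≅ B
  samePresentation⇒≅ {g} generates Φ ker⊆ ⊆ker surjective = record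
    { to                = to
    ; isRingIsomorphism = record
      { isRingMonomorphism = record
        { isRingHomomorphism = record
          { isSemiringHomomorphism = record
            { isNearSemiringHomomorphism = record
              { +-isMonoidHomomorphism = record
                { isMagmaHomomorphism = record
                  { isRelHomomorphism = record
                    { cong = λ {x} {y} x≈y → eval≈⇒ (A.trans (eval-rep x) (A.trans x≈y (A.sym (eval-rep y)))) }
                  ; homo = λ x y → B.trans
                      (to≈ (rep x +ᴾ rep y) (A.trans (A.eval-+ (rep x) (rep y) g) (A.+-cong (eval-rep x) (eval-rep y))))
                      (φ.+-homo (rep x) (rep y))
                  }
                ; ε-homo = B.trans (to≈ [] A.refl) φ.0-homo
                }
              ; *-homo = λ x y → B.trans
                  (to≈ (rep x *ᴾ rep y) (A.trans (A.eval-* (rep x) (rep y) g) (A.*-cong (eval-rep x) (eval-rep y))))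
                  (φ.*-homo (rep x) (rep y))
              }
            ; 1#-homo = B.trans (to≈ 1ᴾ (A.eval-1 g)) φ.1-homo
            }
          ; -‿homo = λ x → B.trans
              (to≈ (-ᴾ rep x) (A.trans (A.eval-neg (rep x) g) (A.-‿cong (eval-rep x))))
              (φ.neg-homo (rep x))
          }
        ; injective = λ {x} {y} e → A.trans (A.sym (eval-rep x)) (A.trans (≈⇒eval e) (eval-rep y))
        }
      ; surjective = λ y → let p , ⟦p⟧≈y = surjective y in
          A.eval p g , λ {x} x≈ → B.trans (to≈ p (A.sym x≈)) ⟦p⟧≈y
      }
    ; to-ι = λ k → B.trans (to≈ (k ∷ []) (A.eval-const k g)) (φ.ι-homo k)
    }
    where
    module φ = HomomorphismProperties Φ
    open φ using (⟦_⟧)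
    rep : A.Carrier → Poly
    rep x = proj₁ (A.K[]⇒eval (generates x))
    eval-rep : ∀ x → A.eval (rep x) g A.≈ x
    eval-rep x = proj₂ (A.K[]⇒eval (generates x))
    to : A.Carrier → B.Carrier
    to x = ⟦ rep x ⟧
    eval≈⇒ : ∀ {p q} → A.eval p g A.≈ A.eval q g → ⟦ p ⟧ B.≈ ⟦ q ⟧
    eval≈⇒ {p} {q} e = RingProperties.x∙y⁻¹≈ε⇒x≈y B.ring _ _ (B.trans (B.sym (φ.∸-homo p q))
      (ker⊆ (p +ᴾ -ᴾ q) (A.trans (A.eval-- p q g) (RingProperties.x≈y⇒x∙y⁻¹≈ε A.ring e))))
    ≈⇒eval : ∀ {p q} → ⟦ p ⟧ B.≈ ⟦ q ⟧ → A.eval p g A.≈ A.eval q g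
    ≈⇒eval {p} {q} e = RingProperties.x∙y⁻¹≈ε⇒x≈y A.ring _ _ (A.trans (A.sym (A.eval-- p q g))
      (⊆ker (p +ᴾ -ᴾ q) (B.trans (φ.∸-homo p q) (RingProperties.x≈y⇒x∙y⁻¹≈ε B.ring e))))
    to≈ : ∀ {x} p → A.eval p g A.≈ x → to x B.≈ ⟦ p ⟧
    to≈ {x} p e = eval≈⇒ {rep x} {p} (A.trans (eval-rep x) (A.sym e))

module QuotientProperties (em : ∀ {e} → ExcludedMiddle e) (K : Field c ℓ) where
  private module K = Field K
  open Polynomial K.commutativeRing hiding (_∣_; _^_; ∏)
  open PolynomialsOver em K
  open Divisibility polynomialRing
  private
    module P  = CommutativeRing polynomialRing
    module PR = SetoidReasoning ≋-setoid
  open RawMonoidDefs P.+-rawMonoid using (sum)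

  monomial : ℕ → Poly
  monomial zero    = 1ᴾ
  monomial (suc i) = K.0# ∷ monomial i

  const*0∷ : ∀ k p → const k *ᴾ (K.0# ∷ p) ≋ (K.0# ∷ const k *ᴾ p)
  const*0∷ k p = ≋-trans (const* k (K.0# ∷ p))
    (≋-trans (·-0∷ k p) (∷-cong K.refl (≋-sym (const* k p))))

  sum-0∷ : ∀ {n} (k : Fin n → K.Carrier) (e : Fin n → Poly) →
           sum (λ i → const (k i) *ᴾ (K.0# ∷ e i)) ≋ (K.0# ∷ sum (λ i → const (k i) *ᴾ e i))
  sum-0∷ {zero}  k e = ≋-sym 0∷[]
  sum-0∷ {suc n} k e = begin
    const (k zero) *ᴾ (K.0# ∷ e zero) +ᴾ sum (λ i → const (k (suc i)) *ᴾ (K.0# ∷ e (suc i)))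
      ≈⟨ +ᴾ-cong (const*0∷ (k zero) (e zero)) (sum-0∷ (k ∘ suc) (e ∘ suc)) ⟩
    (K.0# ∷ const (k zero) *ᴾ e zero) +ᴾ (K.0# ∷ sum (λ i → const (k (suc i)) *ᴾ e (suc i)))
      ≈⟨ 0∷-+ (const (k zero) *ᴾ e zero) (sum (λ i → const (k (suc i)) *ᴾ e (suc i))) ⟨
    (K.0# ∷ (const (k zero) *ᴾ e zero +ᴾ sum (λ i → const (k (suc i)) *ᴾ e (suc i)))) ∎
    where open PR

  bound⇒sum : ∀ d r → Bound r d → r ≋ sum {d} (λ i → const (coeff r (toℕ i)) *ᴾ monomial (toℕ i))
  bound⇒sum zero    r       bound = bound-zero r bound
  bound⇒sum (suc d) r bound = begin
    r                             ≈⟨ r≋ r ⟩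
    (coeff r 0 ∷ tail r)
      ≈⟨ ∷-cong (K.sym (K.+-identityʳ _)) ≋-refl ⟩
    const (coeff r 0) +ᴾ (K.0# ∷ tail r)
      ≈⟨ +ᴾ-cong (≋-trans (∷-cong {p = []} (K.sym (K.*-identityʳ _)) ≋-refl) (≋-sym (const* (coeff r 0) 1ᴾ)))
           (∷-cong K.refl (bound⇒sum d (tail r) (λ i d≤i → K.trans (coeff-tail r i) (bound (suc i) (s≤s d≤i))))) ⟩
    const (coeff r 0) *ᴾ 1ᴾ +ᴾ (K.0# ∷ sum {d} (λ i → const (coeff (tail r) (toℕ i)) *ᴾ monomial (toℕ i)))
      ≈⟨ +ᴾ-cong (≋-refl {const (coeff r 0) *ᴾ 1ᴾ}) (≋-sym (sum-0∷ {d} (coeff (tail r) ∘ toℕ) (monomial ∘ toℕ))) ⟩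
    const (coeff r 0) *ᴾ 1ᴾ +ᴾ sum {d} (λ i → const (coeff (tail r) (toℕ i)) *ᴾ (K.0# ∷ monomial (toℕ i)))
      ≈⟨ +ᴾ-cong (≋-refl {const (coeff r 0) *ᴾ 1ᴾ}) (sum-coeff-tail r) ⟩
    sum {suc d} (λ i → const (coeff r (toℕ i)) *ᴾ monomial (toℕ i)) ∎
    where
    open PR
    tail : Poly → Poly
    tail []      = []
    tail (_ ∷ p) = p
    r≋ : ∀ r → r ≋ (coeff r 0 ∷ tail r)
    r≋ []      = ≋-sym 0∷[]
    r≋ (_ ∷ _) = ≋-refl
    coeff-tail : ∀ r i → coeff (tail r) i K.≈ coeff r (suc i)
    coeff-tail []      i = K.refl
    coeff-tail (_ ∷ _) i = K.refl
    sum-coeff-tail : ∀ r → sum {d} (λ i → const (coeff (tail r) (toℕ i)) *ᴾ (K.0# ∷ monomial (toℕ i))) ≋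
                           sum {d} (λ i → const (coeff r (suc (toℕ i))) *ᴾ monomial (suc (toℕ i)))
    sum-coeff-tail []      = ≋-refl
    sum-coeff-tail (_ ∷ _) = ≋-refl

  quotient-finiteDimensional : ∀ {f d} → IsMonic f d → FiniteDimensional (K[T]/⟨_⟩ K f)
  quotient-finiteDimensional {f} {d} monic = d , monomial ∘ toℕ , λ x → represent x (x mod monic)
    where
    open PR
    represent : ∀ x → ∃[ q ] ∃[ r ] x ≋ q *ᴾ f +ᴾ r × Bound r d →
                Σ[ k ∈ (Fin d → K.Carrier) ] f ∣ x P.- sum (λ i → const (k i) *ᴾ monomial (toℕ i))
    represent x (q , r , x≋ , bound) = coeff r ∘ toℕ , (q , ≋-sym (begin
      x P.- s               ≈⟨ +ᴾ-cong x≋ (-ᴾ-cong (≋-sym (bound⇒sum d r bound))) ⟩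
      q *ᴾ f +ᴾ r P.- r     ≈⟨ +ᴾ-assoc (q *ᴾ f) r (-ᴾ r) ⟩
      q *ᴾ f +ᴾ (r P.- r)   ≈⟨ +ᴾ-cong (≋-refl {q *ᴾ f}) (-ᴾ-inverseʳ r) ⟩
      q *ᴾ f +ᴾ []          ≈⟨ +ᴾ-identityʳ (q *ᴾ f) ⟩
      q *ᴾ f                ∎))
      where s = sum {d} (λ i → const (coeff r (toℕ i)) *ᴾ monomial (toℕ i))

  -- Vanishing in the quotient by `f` unfolds to divisibility of `p - 0`.
  ∣-0⇒∣ : ∀ {f p} → f ∣ p P.- 0ᴾ → f ∣ p
  ∣-0⇒∣ {p = p} = ∣-respʳ (+ᴾ-identityʳ p)

  ∣⇒∣-0 : ∀ {f p} → f ∣ p → f ∣ p P.- 0ᴾ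
  ∣⇒∣-0 {p = p} = ∣-respʳ (≋-sym (+ᴾ-identityʳ p))

  module _ {f : Poly} (irreducible : Irreducible f) where

    inverseModulo : ∀ x → ¬ f ∣ x P.- 0ᴾ → ∃[ y ] f ∣ x *ᴾ y P.- 1ᴾ
    inverseModulo x x≁0 = fromBezout (irreducible⇒comaximal irreducible (x≁0 ∘ ∣⇒∣-0))
      where
      open PR
      fromBezout : Comaximal f x → ∃[ y ] f ∣ x *ᴾ y P.- 1ᴾ
      fromBezout (bezout u v uf+vx≋1) = v , (-ᴾ u , (begin
        (-ᴾ u) *ᴾ f                      ≈⟨ -x*y≈z*w-[x*y+w*z] u f x v ⟩
        x *ᴾ v P.- (u *ᴾ f +ᴾ v *ᴾ x)    ≈⟨ +ᴾ-cong (≋-refl {x *ᴾ v}) (-ᴾ-cong uf+vx≋1) ⟩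
        x *ᴾ v P.- 1ᴾ                    ∎))
        where open RingIdentities polynomialRing

    quotientField : Field c (c ⊔ ℓ)
    quotientField = record
      { commutativeRing = Quotient.quotientRing polynomialRing f
      ; 1≉0             = λ f∣1-0 → Irreducible.p∤1 irreducible (∣-0⇒∣ f∣1-0)
      ; inverse         = inverseModulo
      }

    quotientExtension : FieldExtension K c (c ⊔ ℓ)
    quotientExtension = record
      { extension          = quotientField
      ; ι                  = const
      ; isRingHomomorphism = AssociativeAlgebra.isRingHomomorphism (K[T]/⟨_⟩ K f)
      }

    quotientExtension-isFiniteSimple : Monic f → IsFiniteSimple quotientExtension
    quotientExtension-isFiniteSimple (d , monic) = quotient-finiteDimensional monic , T , generated
      where
      open Quotient polynomialRing f using (≈⇒∼)
      generated : ∀ p → (K⟮_⟯ quotientExtension T) p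
      generated []      = resp (≈⇒∼ 0∷[]) (scalar K.0#)
      generated (k ∷ p) = resp (≈⇒∼ (≋-sym (∷-decompose K k p))) (add (scalar k) (mul generator (generated p)))

-- Moving the linear factor to `T`, and the decomposition of `K[g]`.

module Translation (em : ∀ {e} → ExcludedMiddle e) (K : Field c ℓ)
                   {Q : List (Field.Carrier K)} (Q-monic : PolynomialsOver.IsMonic em K Q 1) where
  private module K = Field K
  open Polynomial K.commutativeRing hiding (_∣_; _^_; ∏)
  open PolynomialsOver em K
  open Divisibility polynomialRing
  private module PA = AlgebraProperties (polynomialAlgebra K)

  q : K.Carrier
  q = coeff Q 0

  Q≋q+T : Q ≋ (q ∷ K.1# ∷ [])
  Q≋q+T = mk≋ λ where
    zero          → K.refl
    (suc zero)    → proj₂ Q-monic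
    (suc (suc i)) → proj₂ (proj₁ Q-monic) (suc (suc i)) (s≤s (s≤s z≤n))

  T-q : Poly
  T-q = (K.- q) ∷ K.1# ∷ []

  -- Mutually inverse automorphisms of `K[T]`, substituting `T - q` and `T + q` for `T`. As `σ`
  -- takes `Q` to `T`, it turns divisibility by `Q ^ m` into divisibility by `T ^ m`.
  σ τ : AlgebraHomomorphism (polynomialAlgebra K) (polynomialAlgebra K)
  σ = evaluation K (polynomialAlgebra K) T-q
  τ = evaluation K (polynomialAlgebra K) Q

  module σ = HomomorphismProperties σ
  module τ = HomomorphismProperties τ

  σQ≋T : σ.⟦ Q ⟧ ≋ T
  σQ≋T = ≋-trans (PA.eval-≋ T-q Q≋q+T) (≋-trans (PA.eval-linear q T-q)
    (∷-cong (K.-‿inverseʳ q) ≋-refl))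

  τ[T-q]≋T : τ.⟦ T-q ⟧ ≋ T
  τ[T-q]≋T = ≋-trans (PA.eval-linear (K.- q) Q) (≋-trans (+ᴾ-cong (≋-refl {const (K.- q)}) Q≋q+T)
    (∷-cong (K.-‿inverseˡ q) ≋-refl))

  στ : ∀ p → σ.⟦ τ.⟦ p ⟧ ⟧ ≋ p
  στ p = ≋-trans (σ.eval-homo p Q) (≋-trans (PA.eval-cong p σQ≋T) (eval-T≋ K p))

  τσ : ∀ p → τ.⟦ σ.⟦ p ⟧ ⟧ ≋ p
  τσ p = ≋-trans (τ.eval-homo p T-q) (≋-trans (PA.eval-cong p τ[T-q]≋T) (eval-T≋ K p))

  ^-homo : (φ : AlgebraHomomorphism (polynomialAlgebra K) (polynomialAlgebra K)) →
           (let open AlgebraHomomorphism φ) → ∀ p m → ⟦ p ^ m ⟧ ≋ ⟦ p ⟧ ^ m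
  ^-homo φ p zero    = HomomorphismProperties.1-homo φ
  ^-homo φ p (suc m) = ≋-trans (*-homo p (p ^ m)) (*ᴾ-congˡ ⟦ p ⟧ (^-homo φ p m))
    where open AlgebraHomomorphism φ

  ^-cong : ∀ {p p′} m → p ≋ p′ → p ^ m ≋ p′ ^ m
  ^-cong zero    p≋p′ = ≋-refl
  ^-cong {p} {p′} (suc m) p≋p′ = *ᴾ-cong {p} {p′} {p ^ m} {p′ ^ m} p≋p′ (^-cong m p≋p′)

  ∣-homo : (φ : AlgebraHomomorphism (polynomialAlgebra K) (polynomialAlgebra K)) →
           (let open AlgebraHomomorphism φ) → ∀ {p r} → p ∣ r → ⟦ p ⟧ ∣ ⟦ r ⟧
  ∣-homo φ {p} (h , hp≋r) = ⟦ h ⟧ , ≋-trans (≋-sym (*-homo h p)) (⟦⟧-cong hp≋r)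
    where open AlgebraHomomorphism φ

  Q^m∣⇒T^m∣σ : ∀ m {p} → Q ^ m ∣ p → T ^ m ∣ σ.⟦ p ⟧
  Q^m∣⇒T^m∣σ m d = ∣-respˡ (≋-trans (^-homo σ Q m) (^-cong m σQ≋T)) (∣-homo σ d)

  T^m∣σ⇒Q^m∣ : ∀ m {p} → T ^ m ∣ σ.⟦ p ⟧ → Q ^ m ∣ p
  T^m∣σ⇒Q^m∣ m {p} d = ∣-respˡ (≋-trans (^-homo τ T m) (^-cong m (PA.eval-T Q)))
    (∣-respʳ (τσ p) (∣-homo τ d))

  -- `Fin δ` indexes the copies of `K[T] / (T ^ m)`. For `δ = 0` there is no copy and `Q ^ 0`
  -- divides everything, so the conditions on both sides are void.
  Q^mδ∣⇒T^m∣σ : ∀ m δ → δ ≡ 0 ⊎ δ ≡ 1 → ∀ {p} → Q ^ (m ℕ.* δ) ∣ p → Fin δ → T ^ m ∣ σ.⟦ p ⟧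
  Q^mδ∣⇒T^m∣σ m .1 (inj₂ ≡.refl) {p} d zero =
    Q^m∣⇒T^m∣σ m {p} (≡.subst (λ k → Q ^ k ∣ p) (ℕ.*-identityʳ m) d)
  Q^mδ∣⇒T^m∣σ m .0 (inj₁ ≡.refl) d ()

  T^m∣σ⇒Q^mδ∣ : ∀ m δ → δ ≡ 0 ⊎ δ ≡ 1 → ∀ {p} → (Fin δ → T ^ m ∣ σ.⟦ p ⟧) → Q ^ (m ℕ.* δ) ∣ p
  T^m∣σ⇒Q^mδ∣ m .0 (inj₁ ≡.refl) {p} d = ≡.subst (λ k → Q ^ k ∣ p) (≡.sym (ℕ.*-zeroʳ m)) (1∣ p)
  T^m∣σ⇒Q^mδ∣ m .1 (inj₂ ≡.refl) {p} d =
    ≡.subst (λ k → Q ^ k ∣ p) (≡.sym (ℕ.*-identityʳ m)) (T^m∣σ⇒Q^m∣ m {p} (d zero))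

module MonogenicToProduct (em : ∀ {e} → ExcludedMiddle e) {K : Field c ℓ} (A : AssociativeAlgebra K a b) where
  private module K = Field K
  open Polynomial K.commutativeRing hiding (_∣_; _^_; ∏)
  open PolynomialsOver em K
  open Factorisation em K
  open Divisibility polynomialRing
  open QuotientProperties em K
  open AlgebraProperties A
  private
    module A = AssociativeAlgebra A
    module P = CommutativeRing polynomialRing

  module _ {g μ n Q δ m} {P : Fin n → Poly}
           (generates : ∀ x → (K[_] A g) x)
           (minimal : IsMinimalPolynomial A μ g)
           (P-irreducible : ∀ i → Irreducible (P i) × Monic (P i))
           (Q-irreducible : Irreducible Q) (Q-monic : IsMonic Q 1)
           (P-distinct : ∀ i j → i ≢ j → ¬ (P i ≋ P j))
           (P≢Q : ∀ i → ¬ (P i ≋ Q))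
           (δ≡ : δ ≡ 0 ⊎ δ ≡ 1)
           (μ≋ : μ ≋ ∏ P *ᴾ Q ^ (m ℕ.* δ)) where
    open IsMinimalPolynomial minimal
    open Translation em K {Q} Q-monic

    L : Fin n → FieldExtension K c (c ⊔ ℓ)
    L i = quotientExtension (proj₁ (P-irreducible i))

    B : AssociativeAlgebra K c (c ⊔ ℓ)
    B = Π n (λ i → FieldExtension.algebra (L i)) ⊗ K[T]/⟨_⟩ K (T ^ m) ^ᴬ δ

    private module B = AssociativeAlgebra B

    P-comaximal : PairwiseComaximal P
    P-comaximal i j i≢j = irreducible⇒comaximal (proj₁ (P-irreducible i)) λ Pi∣Pj →
      P-distinct i j i≢j (monic-irreducible-∣ (proj₁ (P-irreducible i)) (proj₂ (P-irreducible i))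
                                              (proj₁ (P-irreducible j)) (proj₂ (P-irreducible j)) Pi∣Pj)

    ∏P-comaximal : Comaximal (∏ P) (Q ^ (m ℕ.* δ))
    ∏P-comaximal = comaximal-^ (m ℕ.* δ) (comaximal-sym (comaximal-∏ n {P} λ i →
      irreducible⇒comaximal Q-irreducible λ Q∣Pi →
        P≢Q i (≋-sym (monic-irreducible-∣ Q-irreducible (1 , Q-monic)
                        (proj₁ (P-irreducible i)) (proj₂ (P-irreducible i)) Q∣Pi))))

    toT^m : ∀ {f h} → f ≋ h → T ^ m ∣ f P.- h
    toT^m = Quotient.≈⇒∼ polynomialRing (T ^ m)

    -- All components are quotients with polynomials as carrier and a coarser equality, so reduction
    -- modulo `P i` leaves the representative alone; only the truncated component is moved, by `σ`.
    Φ : AlgebraHomomorphism (polynomialAlgebra K) B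
    Φ = record
      { ⟦_⟧     = λ p → (λ i → p) , (λ j → σ.⟦ p ⟧)
      ; ⟦⟧-cong = λ e → (λ i → Quotient.≈⇒∼ polynomialRing (P i) e) , (λ j → toT^m (σ.⟦⟧-cong e))
      ; +-homo  = λ p r → (λ i → Quotient.∼-refl polynomialRing (P i) (p +ᴾ r)) , (λ j → toT^m (σ.+-homo p r))
      ; *-homo  = λ p r → (λ i → Quotient.∼-refl polynomialRing (P i) (p *ᴾ r)) , (λ j → toT^m (σ.*-homo p r))
      ; ι-homo  = λ k → (λ i → Quotient.∼-refl polynomialRing (P i) (const k)) , (λ j → toT^m (σ.ι-homo k))
      }

    open AlgebraHomomorphism Φ using (⟦_⟧)

    ker⊆ : ∀ p → eval p g A.≈ A.0# → ⟦ p ⟧ B.≈ B.0#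
    ker⊆ p pg≈0 =
        (λ i → ∣⇒∣-0 (∣-trans (factor∣∏ P i) (∣-trans (x∣xy (∏ P) (Q ^ (m ℕ.* δ))) μ∣p)))
      , (λ j → ∣⇒∣-0 (Q^mδ∣⇒T^m∣σ m δ δ≡ (∣-trans (x∣ʳy⇒x∣ʳzy (∏ P) ∣-refl) μ∣p) j))
      where
      μ∣p : ∏ P *ᴾ Q ^ (m ℕ.* δ) ∣ p
      μ∣p = ∣-respˡ μ≋ (divides p pg≈0)

    ⊆ker : ∀ p → ⟦ p ⟧ B.≈ B.0# → eval p g A.≈ A.0#
    ⊆ker p (P∣p , T^m∣σp) = vanish (comaximal⇒*∣ ∏P-comaximal
      (∏∣ n P-comaximal (λ i → ∣-0⇒∣ (P∣p i))) (T^m∣σ⇒Q^mδ∣ m δ δ≡ (λ j → ∣-0⇒∣ (T^m∣σp j))))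
      where
      open SetoidReasoning A.setoid
      vanish : ∏ P *ᴾ Q ^ (m ℕ.* δ) ∣ p → eval p g A.≈ A.0#
      vanish (h , h∏≋p) = begin
        eval p g                                    ≈⟨ eval-≋ g h∏≋p ⟨
        eval (h *ᴾ (∏ P *ᴾ Q ^ (m ℕ.* δ))) g        ≈⟨ eval-≋ g (*ᴾ-congˡ h μ≋) ⟨
        eval (h *ᴾ μ) g                             ≈⟨ eval-* h μ g ⟩
        eval h g A.* eval μ g                       ≈⟨ A.*-congˡ vanishes ⟩
        eval h g A.* A.0#                           ≈⟨ A.zeroʳ _ ⟩
        A.0#                                        ∎

    -- Replaces a family of at most one polynomial by a single polynomial, with 0 as the default for
    -- the empty family, so that the Chinese remainder theorem can be applied once for both values
    -- of `δ`.
    atMostOneComponent : ∀ δ → δ ≡ 0 ⊎ δ ≡ 1 → (z : Fin δ → Poly) → ∃[ w ] ∀ j → w ≡ z j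
    atMostOneComponent .0 (inj₁ ≡.refl) z = 0ᴾ , λ ()
    atMostOneComponent .1 (inj₂ ≡.refl) z = z zero , λ { zero → ≡.refl }

    surjective : ∀ y → ∃[ p ] ⟦ p ⟧ B.≈ y
    surjective (y , z) =
      let w , w≡z        = atMostOneComponent δ δ≡ z
          u , u≡y        = chineseRemainder-∏ n P-comaximal y
          -- The residue prescribed modulo the power of `Q` is `τ w`, which `σ` carries back to `w`.
          v , v≡u , v≡τw = chineseRemainder ∏P-comaximal u τ.⟦ w ⟧
      in v , (λ i → ∣-telescope v (y i) (∣-trans (factor∣∏ P i) v≡u) (u≡y i))
           , (λ j → ∣-telescope σ.⟦ v ⟧ (z j)
               (∣-respʳ (σ.∸-homo v τ.⟦ w ⟧) (Q^mδ∣⇒T^m∣σ m δ δ≡ v≡τw j))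
               (toT^m (≋-trans (στ w) (≋-reflexive (w≡z j)))))
      where
      ≋-reflexive : ∀ {f h} → f ≡ h → f ≋ h
      ≋-reflexive ≡.refl = ≋-refl

    ≅product : A ≅ B
    ≅product = samePresentation⇒≅ generates Φ ker⊆ ⊆ker surjective

  isProduct : IsMonogenicOfPrescribedForm A → IsProductOfPrescribedForm A
  isProduct (g , generates , μ , minimal , n , P , Q , δ , m , P-irreducible ,
             (Q-irreducible , (d , Q-monic) , hQ) , P-distinct , P≢Q , δ≡ , m≡ , μ≋) =
    n , (λ i → quotientExtension (proj₁ (P-irreducible i))) , δ , m
      , (λ i → quotientExtension-isFiniteSimple (proj₁ (P-irreducible i)) (proj₂ (P-irreducible i)))
      , δ≡ , m≡
      , ≅product {g} {μ} {n} {Q} {δ} {m} {P} generates minimal P-irreducible Q-irreducible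
          (≡.subst (IsMonic Q) (degree-unique Q (proj₁ Q-monic) hQ) Q-monic) P-distinct P≢Q δ≡ μ≋

-- Images of subalgebras under homomorphisms.

module Images (em : ∀ {e} → ExcludedMiddle e) {K : Field c ℓ}
              {A : AssociativeAlgebra K a b} {B : AssociativeAlgebra K a′ b′}
              (φ : AlgebraHomomorphism A B) where
  private
    module K = Field K
    module A where
      open AssociativeAlgebra A public
      open AlgebraProperties A public
      open Subalgebras em A public
      open Algebraicity em A public
    module B where
      open AssociativeAlgebra B public
      open AlgebraProperties B public
      open Subalgebras em B public
      open Algebraicity em B public
    module SA = Setoid (subalgebraSetoid A)
    module SB = Setoid (subalgebraSetoid B)
  open Classical em
  open HomomorphismProperties φ
  open Subalgebra using (member)

  Image : Subalgebra A → B.Carrier → Set _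
  Image S y = ∃[ x ] member S x × ⟦ x ⟧ B.≈ y

  image-isSubalgebra : ∀ S → B.IsSubalgebra (Image S)
  image-isSubalgebra S = record
    { ≈-closed = λ { y≈z (x , x∈ , e) → x , x∈ , B.trans e y≈z }
    ; 1∈       = A.1# , S.1∈ , 1-homo
    ; +-closed = λ { (x , x∈ , e) (y , y∈ , e′) →
        x A.+ y , S.+-closed x∈ y∈ , B.trans (+-homo x y) (B.+-cong e e′) }
    ; *-closed = λ { (x , x∈ , e) (y , y∈ , e′) →
        x A.* y , S.*-closed x∈ y∈ , B.trans (*-homo x y) (B.*-cong e e′) }
    ; •-closed = λ { k (x , x∈ , e) →
        A.ι k A.* x , S.•-closed k x∈ , B.trans (*-homo (A.ι k) x) (B.*-cong (ι-homo k) e) }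
    }
    where module S = Subalgebra S

  image : Subalgebra A → Subalgebra B
  image S = B.toSubalgebra (image-isSubalgebra S)

  ∈image : ∀ S {x} → member S x → member (image S) ⟦ x ⟧
  ∈image S {x} x∈ = B.∈to (image-isSubalgebra S) (x , x∈ , B.refl)

  preimage : ∀ S {y} → member (image S) y → Image S y
  preimage S = B.∈from (image-isSubalgebra S)

  module _ (injective : ∀ {x y} → ⟦ x ⟧ B.≈ ⟦ y ⟧ → x A.≈ y) where

    image-injective : ∀ S S′ → (∀ {y} → member (image S) y → member (image S′) y) →
                      ∀ {x} → member S x → member S′ x
    image-injective S S′ S⊆S′ {x} x∈ = let x′ , x′∈ , e = preimage S′ (S⊆S′ (∈image S x∈)) in
      Subalgebra.≈-closed S′ (injective e) x′∈

    injective⇒finitelyMany : FinitelyManySubalgebras B → FinitelyManySubalgebras A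
    injective⇒finitelyMany (Cs , enum) = finite-⇒ {S = subalgebraSetoid A} {P = λ _ → ⊤ {ℓ}} (λ _ → tt)
      (finite-preimage {S = subalgebraSetoid A} {S′ = subalgebraSetoid B} {Q = λ _ → ⊤ {ℓ}}
        (λ S C → image S SB.≈ C)
        (λ S _ → image S , tt , SB.refl {image S})
        (λ {S} {S′} {C} {C′} _ _ S~C S′~C′ C≈C′ →
            image-injective S S′ (λ y∈ → proj₂ S′~C′ (proj₁ C≈C′ (proj₁ S~C y∈)))
          , image-injective S′ S (λ y∈ → proj₂ S~C (proj₂ C≈C′ (proj₁ S′~C′ y∈))))
        (Cs , λ C _ → enum C))

    injective⇒algebraic : (∀ y → B.Algebraic y) → ∀ x → A.Algebraic x
    injective⇒algebraic algebraic x = let p , p≢0 , py≈0 = algebraic ⟦ x ⟧ in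
      p , p≢0 , injective (B.trans (eval-homo p x) (B.trans py≈0 (B.sym 0-homo)))

-- Subalgebras of an algebra embedded in the product of a field with an algebra.

module SubdirectProduct (em : ∀ {e} → ExcludedMiddle e) {K : Field c ℓ} (infinite : IsInfinite (Field.setoid K))
  {a₁ b₁ a₂ b₂ : Level} {A : AssociativeAlgebra K a b}
  (L : FieldExtension K a₁ b₁) {B : AssociativeAlgebra K a₂ b₂}
  (π₁ : AlgebraHomomorphism A (FieldExtension.algebra L)) (π₂ : AlgebraHomomorphism A B) where
  private
    module K = Field K
    module A where
      open AssociativeAlgebra A public
      open AlgebraProperties A public
      open Algebraicity em A public
    module L where
      open FieldExtension L public
      open AlgebraProperties algebra public
      open Algebraicity em algebra public
    module B where
      open AssociativeAlgebra B public
      open AlgebraProperties B public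
      open Algebraicity em B public
      open Subalgebras em B public
    module SA = Setoid (subalgebraSetoid A)
    module SL = Setoid (subalgebraSetoid L.algebra)
    module SB = Setoid (subalgebraSetoid B)
    module π₁ where
      open HomomorphismProperties π₁ public
      open Images em π₁ public
    module π₂ where
      open HomomorphismProperties π₂ public
      open Images em π₂ public
  open Classical em
  open Polynomial K.commutativeRing hiding (_∣_; _^_; ∏)
  open PolynomialsOver em K using (*-nonzero)
  open Subalgebra using (member)

  module _ (injective : ∀ {x y} → π₁.⟦ x ⟧ L.≈ π₁.⟦ y ⟧ → π₂.⟦ x ⟧ B.≈ π₂.⟦ y ⟧ → x A.≈ y) where

    -- A product of annihilating polynomials of the two projections kills both of them.
    jointlyInjective⇒algebraic : (∀ y → L.Algebraic y) → (∀ z → B.Algebraic z) → ∀ x → A.Algebraic x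
    jointlyInjective⇒algebraic algebraicL algebraicB x =
      let p , p≢0 , py≈0 = algebraicL π₁.⟦ x ⟧
          q , q≢0 , qz≈0 = algebraicB π₂.⟦ x ⟧
      in p *ᴾ q , *-nonzero p q p≢0 q≢0 , injective
        (L.trans (L.trans (π₁.eval-homo (p *ᴾ q) x) (L.trans (L.eval-* p q π₁.⟦ x ⟧)
          (L.trans (L.*-congʳ py≈0) (L.zeroˡ _)))) (L.sym π₁.0-homo))
        (B.trans (B.trans (π₂.eval-homo (p *ᴾ q) x) (B.trans (B.eval-* p q π₂.⟦ x ⟧)
          (B.trans (B.*-congˡ qz≈0) (B.zeroʳ _)))) (B.sym π₂.0-homo))

    -- The idempotent `(1 , 0)` is described through its projections, since `A` is only known to
    -- embed in the product.
    Splits : Subalgebra A → Set _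
    Splits S = ∃[ e ] member S e × π₁.⟦ e ⟧ L.≈ L.1# × π₂.⟦ e ⟧ B.≈ B.0#

    -- This is `e x + (1 - e) y`: for `e = (1 , 0)` it takes its first projection from `x` and its
    -- second from `y`.
    glue : A.Carrier → A.Carrier → A.Carrier → A.Carrier
    glue e x y = e A.* x A.+ (y A.- e A.* y)

    π₁-glue : ∀ {e} x y → π₁.⟦ e ⟧ L.≈ L.1# → π₁.⟦ glue e x y ⟧ L.≈ π₁.⟦ x ⟧
    π₁-glue {e} x y e≈1 = begin
      π₁.⟦ glue e x y ⟧                                  ≈⟨ π₁.+-homo _ _ ⟩
      π₁.⟦ e A.* x ⟧ L.+ π₁.⟦ y A.- e A.* y ⟧            ≈⟨ L.+-cong (absorb x) (π₁.∸-homo _ _) ⟩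
      π₁.⟦ x ⟧ L.+ (π₁.⟦ y ⟧ L.- π₁.⟦ e A.* y ⟧)         ≈⟨ L.+-congˡ (L.+-congˡ (L.-‿cong (absorb y))) ⟩
      π₁.⟦ x ⟧ L.+ (π₁.⟦ y ⟧ L.- π₁.⟦ y ⟧)               ≈⟨ L.+-congˡ (L.-‿inverseʳ _) ⟩
      π₁.⟦ x ⟧ L.+ L.0#                                  ≈⟨ L.+-identityʳ _ ⟩
      π₁.⟦ x ⟧                                           ∎
      where
      open SetoidReasoning L.setoid
      absorb : ∀ x → π₁.⟦ e A.* x ⟧ L.≈ π₁.⟦ x ⟧
      absorb x = L.trans (π₁.*-homo e x) (L.trans (L.*-congʳ e≈1) (L.*-identityˡ _))

    π₂-glue : ∀ {e} x y → π₂.⟦ e ⟧ B.≈ B.0# → π₂.⟦ glue e x y ⟧ B.≈ π₂.⟦ y ⟧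
    π₂-glue {e} x y e≈0 = begin
      π₂.⟦ glue e x y ⟧                                  ≈⟨ π₂.+-homo _ _ ⟩
      π₂.⟦ e A.* x ⟧ B.+ π₂.⟦ y A.- e A.* y ⟧            ≈⟨ B.+-cong (vanish x) (π₂.∸-homo _ _) ⟩
      B.0# B.+ (π₂.⟦ y ⟧ B.- π₂.⟦ e A.* y ⟧)             ≈⟨ B.+-identityˡ _ ⟩
      π₂.⟦ y ⟧ B.- π₂.⟦ e A.* y ⟧                        ≈⟨ B.+-congˡ (B.-‿cong (vanish y)) ⟩
      π₂.⟦ y ⟧ B.- B.0#                                  ≈⟨ B.+-congˡ (RingProperties.-0#≈0# B.ring) ⟩
      π₂.⟦ y ⟧ B.+ B.0#                                  ≈⟨ B.+-identityʳ _ ⟩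
      π₂.⟦ y ⟧                                           ∎
      where
      open SetoidReasoning B.setoid
      vanish : ∀ x → π₂.⟦ e A.* x ⟧ B.≈ B.0#
      vanish x = B.trans (π₂.*-homo e x) (B.trans (B.*-congʳ e≈0) (B.zeroˡ _))

    HasImages : Subalgebra L.algebra → Subalgebra B → Subalgebra A → Set _
    HasImages C D S = Splits S × π₁.image S SL.≈ C × π₂.image S SB.≈ D

    split-⊆ : ∀ {C D} S S′ → HasImages C D S → HasImages C D S′ → ∀ {x} → member S x → member S′ x
    split-⊆ S S′ (_ , π₁S~C , π₂S~D) ((e , e∈ , e≈1 , e≈0) , π₁S′~C , π₂S′~D) x∈ =
      let y , y∈ , y≈ = π₁.preimage S′ (proj₂ π₁S′~C (proj₁ π₁S~C (π₁.∈image S x∈)))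
          z , z∈ , z≈ = π₂.preimage S′ (proj₂ π₂S′~D (proj₁ π₂S~D (π₂.∈image S x∈)))
      in S′.≈-closed
           (injective (L.trans (π₁-glue y z e≈1) y≈) (B.trans (π₂-glue y z e≈0) z≈))
           (S′.+-closed (S′.*-closed e∈ y∈) (S′.∸-closed z∈ (S′.*-closed e∈ z∈)))
      where module S′ = A.IsSubalgebra (A.isSubalgebra S′)

    finite-split : FinitelyManySubalgebras L.algebra → FinitelyManySubalgebras B →
                   FinitelyMany (subalgebraSetoid A) Splits
    finite-split (Cs , enumC) (Ds , enumD) = finite-⊆ {S = subalgebraSetoid A}
      (λ S splits → Any.map (λ {C} π₁S~C → Any.map (λ {D} π₂S~D → splits , π₁S~C , π₂S~D)
                                                   (enumD (π₂.image S)))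
                            (enumC (π₁.image S)))
      (finite-⋃ {S = subalgebraSetoid A} Cs λ C →
       finite-⋃ {S = subalgebraSetoid A} {Q = λ D S → HasImages C D S} Ds λ D →
       atMostOne⇒finite {S = subalgebraSetoid A} (HasImages C D) λ S S′ S~ S′~ →
         split-⊆ {C} {D} S S′ S~ S′~ , split-⊆ {C} {D} S′ S S′~ S~)

    module _ (algebraicL : ∀ y → L.Algebraic y) where

      -- If `x` were nonzero, `π₁ x` would be nonzero by joint injectivity, hence invertible with
      -- inverse `p(π₁ x)` for some polynomial `p`. Then `x * p(x)` lies in `S` and projects to
      -- `(1 , 0)`, so `S` would split.
      kernel-trivial : ∀ S → ¬ Splits S → ∀ {x} → member S x → π₂.⟦ x ⟧ B.≈ B.0# → x A.≈ A.0#
      kernel-trivial S ¬splits {x} x∈ π₂x≈0 = ¬¬-elim λ x≉0 →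
        let y , π₁x*y≈1 = L.inverse π₁.⟦ x ⟧ λ π₁x≈0 →
              x≉0 (injective (L.trans π₁x≈0 (L.sym π₁.0-homo)) (B.trans π₂x≈0 (B.sym π₂.0-homo)))
            p , pπ₁x≈y = L.leftInverse∈K[x] (algebraicL π₁.⟦ x ⟧) (L.trans (L.*-comm y _) π₁x*y≈1)
        in ¬splits (x A.* A.eval p x , S.*-closed x∈ (S.eval∈ p x∈)
          , L.trans (π₁.*-homo x _) (L.trans (L.*-congˡ (L.trans (π₁.eval-homo p x) pπ₁x≈y)) π₁x*y≈1)
          , B.trans (π₂.*-homo x _) (B.trans (B.*-congʳ π₂x≈0) (B.zeroˡ _)))
        where module S = A.IsSubalgebra (A.isSubalgebra S)

      kernel-trivial′ : ∀ S → ¬ Splits S → ∀ {x y} → member S x → member S y → π₂.⟦ x ⟧ B.≈ π₂.⟦ y ⟧ → x A.≈ y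
      kernel-trivial′ S ¬splits x∈ y∈ e = RingProperties.x∙y⁻¹≈ε⇒x≈y A.ring _ _
        (kernel-trivial S ¬splits (S.∸-closed x∈ y∈)
          (B.trans (π₂.∸-homo _ _) (RingProperties.x≈y⇒x∙y⁻¹≈ε B.ring e)))
        where module S = A.IsSubalgebra (A.isSubalgebra S)

      NonSplitOver : Subalgebra B → Subalgebra A → Set _
      NonSplitOver D S = ¬ Splits S × π₂.image S SB.≈ D

      -- A nonsplit subalgebra is the graph of a homomorphism D → L, which
      -- is determined by the image of a generator of D.
      Over : B.Carrier → Subalgebra A → L.Carrier → Set _
      Over d S y = ∃[ x ] member S x × π₂.⟦ x ⟧ B.≈ d × π₁.⟦ x ⟧ L.≈ y

      -- The lifts `u` and `u′` of `d` agree in `L` and in `B`, so they coincide. If `p` expresses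
      -- `π₂ x` through `d`, then `x` and `p(u)` have the same image in `B`, and the trivial kernel
      -- gives `x = p(u) = p(u′)`, an element of `S′`.
      nonSplit-⊆ : ∀ {D d y y′} S S′ → NonSplitOver D S → (∀ z → member D z → (K[_] B d) z) →
                   Over d S y → Over d S′ y′ → y L.≈ y′ → ∀ {x} → member S x → member S′ x
      nonSplit-⊆ {D} {d} S S′ (¬splits , π₂S~D) generates
                 (u , u∈ , π₂u≈d , π₁u≈y) (u′ , u′∈ , π₂u′≈d , π₁u′≈y′) y≈y′ {x} x∈ =
        let p , pd≈π₂x = B.K[]⇒eval (generates π₂.⟦ x ⟧ (proj₁ π₂S~D (π₂.∈image S x∈)))
            x≈pu = kernel-trivial′ S ¬splits x∈ (S.eval∈ p u∈)
              (B.sym (B.trans (π₂.eval-homo p u) (B.trans (B.eval-cong p π₂u≈d) pd≈π₂x)))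
            u≈u′ = injective (L.trans π₁u≈y (L.trans y≈y′ (L.sym π₁u′≈y′)))
                             (B.trans π₂u≈d (B.sym π₂u′≈d))
        in S′.≈-closed (A.trans (A.eval-cong p (A.sym u≈u′)) (A.sym x≈pu)) (S′.eval∈ p u′∈)
        where
        module S  = A.IsSubalgebra (A.isSubalgebra S)
        module S′ = A.IsSubalgebra (A.isSubalgebra S′)

      finite-nonSplit :
        (∀ {p} → ¬ p ≋ [] → FinitelyMany L.setoid (λ y → L.eval p y L.≈ L.0#)) →
        (∀ z → B.Algebraic z) → FinitelyManySubalgebras B →
        FinitelyMany (subalgebraSetoid A) (λ S → ¬ Splits S)
      finite-nonSplit finiteRoots algebraicB finiteB = finite-⊆ {S = subalgebraSetoid A}
        (λ S ¬splits → Any.map (λ {D} π₂S~D → ¬splits , π₂S~D) (proj₂ finiteB (π₂.image S)))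
        (finite-⋃ {S = subalgebraSetoid A} {Q = NonSplitOver} (proj₁ finiteB) λ D →
          over D (B.monogenic infinite (B.isSubalgebra D) finiteB))
        where
        over : ∀ D → ∃[ d ] member D d × (∀ z → member D z → (K[_] B d) z) →
               FinitelyMany (subalgebraSetoid A) (NonSplitOver D)
        over D (d , d∈D , generates) = finite-preimage {S = subalgebraSetoid A} {S′ = L.setoid} (Over d)
          total
          (λ {S} {S′} nonSplit nonSplit′ S~y S′~y′ y≈y′ →
              nonSplit-⊆ {D} S S′ nonSplit generates S~y S′~y′ y≈y′
            , nonSplit-⊆ {D} S′ S nonSplit′ generates S′~y′ S~y (L.sym y≈y′))
          (finiteRoots p≢0)
          where
          p    = proj₁ (algebraicB d)
          p≢0  = proj₁ (proj₂ (algebraicB d))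
          pd≈0 = proj₂ (proj₂ (algebraicB d))
          total : ∀ S → NonSplitOver D S → ∃[ y ] L.eval p y L.≈ L.0# × Over d S y
          total S (¬splits , π₂S~D) =
            let x , x∈ , π₂x≈d = π₂.preimage S (proj₂ π₂S~D d∈D)
                -- `p(x)` lies in `S` and vanishes in `B`, so it is zero; hence `π₁ x` is one of the
                -- finitely many roots of `p` in `L`.
                px≈0 = kernel-trivial S ¬splits (A.IsSubalgebra.eval∈ (A.isSubalgebra S) p x∈)
                  (B.trans (π₂.eval-homo p x) (B.trans (B.eval-cong p π₂x≈d) pd≈0))
            in π₁.⟦ x ⟧
               , L.trans (L.sym (π₁.eval-homo p x)) (L.trans (π₁.⟦⟧-cong px≈0) π₁.0-homo)
               , x , x∈ , π₂x≈d , L.refl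

      jointlyInjective⇒finitelyMany :
        (∀ {p} → ¬ p ≋ [] → FinitelyMany L.setoid (λ y → L.eval p y L.≈ L.0#)) →
        FinitelyManySubalgebras L.algebra →
        (∀ z → B.Algebraic z) → FinitelyManySubalgebras B →
        FinitelyManySubalgebras A
      jointlyInjective⇒finitelyMany finiteRoots finiteL algebraicB finiteB =
        finite-⇒ {S = subalgebraSetoid A} split?
          (finite-∪ {S = subalgebraSetoid A} (finite-split finiteL finiteB)
                    (finite-nonSplit finiteRoots algebraicB finiteB))
        where
        split? : ∀ S → Splits S ⊎ ¬ Splits S
        split? S with em {P = Splits S}
        ... | yes splits = inj₁ splits
        ... | no ¬splits = inj₂ ¬splits

-- Roots in a field extension and subfields of a simple extension.

module SimpleExtension (em : ∀ {e} → ExcludedMiddle e) {K : Field c ℓ} {a b : Level} (L : FieldExtension K a b) where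
  private
    module K = Field K
    module PK where
      open Polynomial K.commutativeRing public hiding (_∣_; _^_; ∏)
      open PolynomialsOver em K public
  open Classical em
  open FieldExtension L hiding (zero; isRingHomomorphism)
  open AlgebraProperties algebra
    using (eval; ι-0; ι-1; ι-*; ι-cong; K[]⇒eval; isSubalgebra; IsSubalgebra)
  open Algebraicity em algebra
  open Polynomial commutativeRing hiding (_∣_; _^_; ∏)
  open PolynomialsOver em extension
  open Divisibility polynomialRing
  private module S = SetoidReasoning setoid
  open Subalgebra using (member)

  -- `L` over itself, so that polynomials with coefficients in `L` are evaluated by the same theory
  -- as those over `K`.
  selfAlgebra : AssociativeAlgebra extension a b
  selfAlgebra = record
    { ring               = ring
    ; ι                  = λ x → x
    ; isRingHomomorphism = record
      { isSemiringHomomorphism = record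
        { isNearSemiringHomomorphism = record
          { +-isMonoidHomomorphism = record
            { isMagmaHomomorphism = record
              { isRelHomomorphism = record { cong = λ x≈y → x≈y }
              ; homo              = λ _ _ → refl
              }
            ; ε-homo = refl
            }
          ; *-homo = λ _ _ → refl
          }
        ; 1#-homo = refl
        }
      ; -‿homo = λ _ → refl
      }
    ; ι-central = *-comm
    }

  private module Self = AlgebraProperties selfAlgebra

  extend : PK.Poly → Poly
  extend = map ι

  coeff-extend : ∀ p i → coeff (extend p) i ≈ ι (PK.coeff p i)
  coeff-extend []      i       = sym ι-0
  coeff-extend (k ∷ p) zero    = refl
  coeff-extend (k ∷ p) (suc i) = coeff-extend p i

  eval-extend : ∀ p x → Self.eval (extend p) x ≈ eval p x
  eval-extend []      x = refl
  eval-extend (k ∷ p) x = +-congˡ (*-congˡ (eval-extend p x))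

  ι-injective : ∀ {k} → ι k ≈ 0# → k K.≈ K.0#
  ι-injective {k} ιk≈0 = ¬¬-elim λ k≉0 → let k⁻¹ , kk⁻¹≈1 = K.inverse k k≉0 in 1≉0 (S.begin
    1#              S.≈⟨ ι-1 ⟨
    ι K.1#          S.≈⟨ ι-cong kk⁻¹≈1 ⟨
    ι (k K.* k⁻¹)   S.≈⟨ ι-* k k⁻¹ ⟩
    ι k * ι k⁻¹     S.≈⟨ *-congʳ ιk≈0 ⟩
    0# * ι k⁻¹      S.≈⟨ zeroˡ _ ⟩
    0#              S.∎)

  extend-nonzero : ∀ {p} → ¬ p PK.≋ [] → ¬ extend p ≋ []
  extend-nonzero {p} p≢0 ep≋0 = p≢0 (PK.mk≋ λ i → ι-injective (trans (sym (coeff-extend p i)) (at ep≋0 i)))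

  eval-remainder : ∀ {f p x} q r → p ≋ q *ᴾ f +ᴾ r → Self.eval f x ≈ 0# → Self.eval p x ≈ Self.eval r x
  eval-remainder {f} {p} {x} q r p≋ fx≈0 = S.begin
    Self.eval p x                                   S.≈⟨ Self.eval-≋ x p≋ ⟩
    Self.eval (q *ᴾ f +ᴾ r) x                       S.≈⟨ Self.eval-+ (q *ᴾ f) r x ⟩
    Self.eval (q *ᴾ f) x + Self.eval r x            S.≈⟨ +-congʳ (Self.eval-* q f x) ⟩
    Self.eval q x * Self.eval f x + Self.eval r x   S.≈⟨ +-congʳ (trans (*-congˡ fx≈0) (zeroʳ _)) ⟩
    0# + Self.eval r x                              S.≈⟨ +-identityˡ _ ⟩
    Self.eval r x                                   S.∎

  factorTheorem : ∀ f x → Self.eval f x ≈ 0# → ((- x) ∷ 1# ∷ []) ∣ f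
  factorTheorem f x fx≈0 = fromDivision (f mod monic-linear (- x))
    where
    T-x = (- x) ∷ 1# ∷ []
    fromDivision : ∃[ q ] ∃[ r ] f ≋ q *ᴾ T-x +ᴾ r × Bound r 1 → T-x ∣ f
    fromDivision (q , r , f≋ , bound) = remainder-zero⇒∣ q f≋ r≋0
      where
      r≋r₀ : r ≋ const (coeff r 0)
      r≋r₀ = mk≋ λ { zero → refl ; (suc i) → bound (suc i) (s≤s z≤n) }
      r₀≈0 : coeff r 0 ≈ 0#
      r₀≈0 = S.begin
        coeff r 0                                   S.≈⟨ Self.eval-const (coeff r 0) x ⟨
        Self.eval (const (coeff r 0)) x             S.≈⟨ Self.eval-≋ x r≋r₀ ⟨
        Self.eval r x
          S.≈⟨ eval-remainder q r f≋ (trans (Self.eval-linear (- x) x) (-‿inverseˡ x)) ⟨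
        Self.eval f x                               S.≈⟨ fx≈0 ⟩
        0#                                          S.∎
      r≋0 : r ≋ []
      r≋0 = ≋-trans r≋r₀ (≋-trans (∷-cong {p = []} r₀≈0 ≋-refl) 0∷[])

  -- A root `x` is recorded by the linear polynomial `T - x`, a monic divisor of the extended
  -- polynomial.
  finiteRoots : ∀ {p} → ¬ p PK.≋ [] → FinitelyMany setoid (λ x → eval p x ≈ 0#)
  finiteRoots {p} p≢0 = finite-preimage {S = setoid} {S′ = ≋-setoid} (λ x f → ((- x) ∷ 1# ∷ []) ≋ f)
    (λ x px≈0 → ((- x) ∷ 1# ∷ [])
      , ((1 , monic-linear (- x)) , factorTheorem (extend p) x (trans (eval-extend p x) px≈0)) , ≋-refl)
    (λ {x} {y} _ _ x~f y~g f≋g →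
      RingProperties.-‿injective ring (at (≋-trans x~f (≋-trans f≋g (≋-sym y~g))) 0))
    (finitelyManyMonicDivisors (extend-nonzero p≢0))

  module _ (algebraic : ∀ x → Algebraic x) {α : Carrier} (generates : ∀ x → (K⟮_⟯ L α) x) where

    -- Only inverses go beyond ring operations, and the inverse of an algebraic element is a
    -- polynomial in it.
    K⟮α⟯⇒eval : ∀ {x} → (K⟮_⟯ L α) x → (K[_] algebra α) x
    K⟮α⟯⇒eval (scalar k)   = resp (*-identityʳ (ι k)) (smul k one)
    K⟮α⟯⇒eval generator    = generator
    K⟮α⟯⇒eval (add x y)    = add (K⟮α⟯⇒eval x) (K⟮α⟯⇒eval y)
    K⟮α⟯⇒eval (neg x)      = IsSubalgebra.neg-closed (AlgebraProperties.K[]-isSubalgebra algebra α) (K⟮α⟯⇒eval x)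
    K⟮α⟯⇒eval (mul x y)    = mul (K⟮α⟯⇒eval x) (K⟮α⟯⇒eval y)
    K⟮α⟯⇒eval (inv {x} {y} x∈ xy≈1) =
      let p , px≈y = leftInverse∈K[x] (algebraic x) (trans (*-comm y x) xy≈1)
      in resp px≈y (IsSubalgebra.eval∈ (AlgebraProperties.K[]-isSubalgebra algebra α) p (K⟮α⟯⇒eval x∈))
    K⟮α⟯⇒eval (resp x≈y x) = resp x≈y (K⟮α⟯⇒eval x)

    module _ {ℓ₁} {S : Carrier → Set ℓ₁} (S-isSubalgebra : IsSubalgebra S) where
      private module S′ = IsSubalgebra S-isSubalgebra

      subalgebra⇒subring : IsSubring S
      subalgebra⇒subring = record
        { ≈-closed = S′.≈-closed ; 0∈ = S′.0∈ ; +-closed = S′.+-closed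
        ; neg-closed = S′.neg-closed ; *-closed = S′.*-closed }

      coeffs-extend : ∀ p → Coeffs S (extend p)
      coeffs-extend p i = S′.≈-closed (sym (coeff-extend p i)) (S′.ι∈ _)

      coeffs-const : ∀ {x} → S x → Coeffs S (const x)
      coeffs-const x∈ zero    = x∈
      coeffs-const x∈ (suc i) = S′.0∈

      -- Makes subalgebras of `L` closed under inverses, so that polynomials over them can be
      -- normalised without leaving them.
      leftInverse∈ : ∀ {x y} → S x → y * x ≈ 1# → S y
      leftInverse∈ {x} x∈ yx≈1 = let p , px≈y = leftInverse∈K[x] (algebraic x) yx≈1 in
        S′.≈-closed px≈y (S′.eval∈ p x∈)

    -- The minimal polynomial of `α` over the subfield `B`, kept as a polynomial over `L` with
    -- constrained coefficients; minimal polynomials over different subfields are thus compared in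
    -- one ring.
    record IsMinimalOver (B : Subalgebra algebra) (f : Poly) : Set (lsuc (c ⊔ ℓ ⊔ a ⊔ b)) where
      field
        {degree} : ℕ
        monic    : IsMonic f degree
        coeffs   : Coeffs (member B) f
        root     : Self.eval f α ≈ 0#
        minimal  : ∀ p → Coeffs (member B) p → Bound p degree → Self.eval p α ≈ 0# → p ≋ []

    -- Dividing by a common minimal polynomial expresses b = r(α) as r₀(α)
    -- with r₀ of smaller degree and coefficients in both fields; then r₀ = b.
    minimal-⊆ : ∀ {B B′ f f′} → IsMinimalOver B f → IsMinimalOver B′ f′ → f ≋ f′ →
                ∀ {x} → member B x → member B′ x
    minimal-⊆ {B} {B′} {f} {f′} f-minimal f′-minimal f≋f′ {x} x∈B =
      fromDivision (K[]⇒eval (K⟮α⟯⇒eval (generates x)))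
      where
      open IsMinimalOver f-minimal
      module B  = IsSubalgebra (isSubalgebra B)
      module B′ = IsSubalgebra (isSubalgebra B′)
      B∩B′ : IsSubalgebra (λ x → member B x × member B′ x)
      B∩B′ = record
        { ≈-closed = λ { e (x∈ , x∈′) → B.≈-closed e x∈ , B′.≈-closed e x∈′ }
        ; 1∈       = B.1∈ , B′.1∈
        ; +-closed = λ { (x∈ , x∈′) (y∈ , y∈′) → B.+-closed x∈ y∈ , B′.+-closed x∈′ y∈′ }
        ; *-closed = λ { (x∈ , x∈′) (y∈ , y∈′) → B.*-closed x∈ y∈ , B′.*-closed x∈′ y∈′ }
        ; •-closed = λ { k (x∈ , x∈′) → B.•-closed k x∈ , B′.•-closed k x∈′ }
        }
      f-coeffs : Coeffs (λ x → member B x × member B′ x) f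
      f-coeffs i = coeffs i , B′.≈-closed (sym (at f≋f′ i)) (IsMinimalOver.coeffs f′-minimal i)
      -- The constant `x` has to lie below `degree` for minimality to apply to `r - x`. Degree 0 is
      -- impossible: `f` would be 1, which does not vanish at `α`.
      degree>0 : 0 ℕ.< degree
      degree>0 = ℕ.n≢0⇒n>0 λ d≡0 → 1≉0 (trans (sym (Self.eval-1 α))
        (trans (Self.eval-≋ α (≋-sym (monic-degree-zero {f} (≡.subst (IsMonic f) d≡0 monic)))) root))
      fromRemainder : ∀ p → eval p α ≈ x → ∃[ q ] ∃[ r ] extend p ≋ q *ᴾ f +ᴾ r × Bound r degree ×
                      Coeffs (λ x → member B x × member B′ x) r → member B′ x
      fromRemainder p pα≈x (q , r , p≋ , bound , r-coeffs) = B′.≈-closed r₀≈x (proj₂ (r-coeffs 0))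
        where
        rα≈x : Self.eval r α ≈ x
        rα≈x = trans (sym (eval-remainder q r p≋ root)) (trans (eval-extend p α) pα≈x)
        r-x≋0 : r +ᴾ -ᴾ const x ≋ []
        r-x≋0 = minimal (r +ᴾ -ᴾ const x)
          (coeffs-+ (subalgebra⇒subring (isSubalgebra B)) r (-ᴾ const x) (proj₁ ∘ r-coeffs)
            (coeffs-neg (subalgebra⇒subring (isSubalgebra B)) (const x) (coeffs-const (isSubalgebra B) x∈B)))
          (bound-+ r (-ᴾ const x) bound (bound-neg (const x) const-bound))
          (trans (Self.eval-- r (const x) α) (trans (+-cong rα≈x (-‿cong (Self.eval-const x α))) (-‿inverseʳ x)))
          where
          const-bound : Bound (const x) degree
          const-bound zero    d≤0 = contradiction (ℕ.<-≤-trans degree>0 d≤0) (ℕ.n≮n 0)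
          const-bound (suc i) _   = refl
        r₀≈x : coeff r 0 ≈ x
        r₀≈x = RingProperties.x∙y⁻¹≈ε⇒x≈y ring _ _ (trans (sym (coeff-+ r (-ᴾ const x) 0)) (at r-x≋0 0))
      fromDivision : ∃[ p ] eval p α ≈ x → member B′ x
      fromDivision (p , pα≈x) = fromRemainder p pα≈x
        (divMod (subalgebra⇒subring B∩B′) monic f-coeffs (extend p) (coeffs-extend B∩B′ p))

    module _ {p d} (p-monic : PK.IsMonic p d) (pα≈0 : eval p α ≈ 0#) where

      extend-monic : IsMonic (extend p) d
      extend-monic = isMonic (extend p)
        (trans (coeff-extend p d) (trans (ι-cong (proj₂ p-monic)) ι-1))
        (λ i d<i → trans (coeff-extend p i) (trans (ι-cong (proj₂ (proj₁ p-monic) i d<i)) ι-0))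

      -- Take a monic polynomial over `B` of least degree among those vanishing at `α`; the
      -- extension of `p` is a candidate. Dividing it by this polynomial leaves a remainder over `B`
      -- that vanishes at `α`, so the remainder is zero.
      minimalOver : ∀ B → ∃[ f ] MonicDivisor (extend p) f × IsMinimalOver B f
      minimalOver B = fromLeast (least
        (d , extend p , extend-monic , coeffs-extend (isSubalgebra B) p , trans (eval-extend p α) pα≈0))
        where
        module B = IsSubalgebra (isSubalgebra B)
        isSubring = subalgebra⇒subring (isSubalgebra B)
        Vanishing : ℕ → Set _
        Vanishing d = ∃[ f ] IsMonic f d × Coeffs (member B) f × Self.eval f α ≈ 0#
        fromLeast : ∃[ d ] Vanishing d × (∀ e → e ℕ.< d → ¬ Vanishing e) →
                    ∃[ f ] MonicDivisor (extend p) f × IsMinimalOver B f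
        fromLeast (d , (f , monic , coeffs , fα≈0) , least-d) =
          f , ((d , monic) , f∣p (divMod isSubring monic coeffs (extend p) (coeffs-extend (isSubalgebra B) p)))
            , record { monic = monic ; coeffs = coeffs ; root = fα≈0 ; minimal = minimal }
          where
          minimal : ∀ p → Coeffs (member B) p → Bound p d → Self.eval p α ≈ 0# → p ≋ []
          minimal p p-coeffs bound pα≈0 = ¬¬-elim λ p≢0 →
            let e , hp = hasDegree p p≢0
                k , kp≈1 , kp-monic = normalise p hp
            in least-d e (degree< p hp bound) (k · p , kp-monic
              , coeffs-· isSubring p (leftInverse∈ (isSubalgebra B) (p-coeffs e) kp≈1) p-coeffs
              , trans (Self.eval-· k p α) (trans (*-congˡ pα≈0) (zeroʳ k)))
          f∣p : ∃[ q ] ∃[ r ] extend p ≋ q *ᴾ f +ᴾ r × Bound r d × Coeffs (member B) r → f ∣ extend p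
          f∣p (q , r , p≋ , bound , r-coeffs) = remainder-zero⇒∣ q p≋ (minimal r r-coeffs bound
            (trans (sym (eval-remainder q r p≋ fα≈0)) (trans (eval-extend p α) pα≈0)))

    finitelyManySubfields : FinitelyManySubalgebras algebra
    finitelyManySubfields = fromMinimal (minimalPolynomial (algebraic α))
      where
      fromMinimal : ∃[ μ ] IsMinimalPolynomial algebra μ α → FinitelyManySubalgebras algebra
      fromMinimal (μ , μ-minimal) =
        finite-⇒ {S = subalgebraSetoid algebra} {P = λ _ → ⊤ {ℓ}} (λ _ → tt)
          (finite-preimage {S = subalgebraSetoid algebra} {S′ = ≋-setoid} IsMinimalOver
            (λ B _ → minimalOver {μ} (proj₂ monic) vanishes B)
            (λ {B} {B′} _ _ B~f B′~f′ f≋f′ →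
              minimal-⊆ {B} {B′} B~f B′~f′ f≋f′ , minimal-⊆ {B′} {B} B′~f′ B~f (≋-sym f≋f′))
            (finitelyManyMonicDivisors (nonzero (extend μ) (proj₁ (extend-monic {μ} (proj₂ monic) vanishes)))))
        where open IsMinimalPolynomial μ-minimal

-- Subalgebras of `K[T] / (f)` for `f` dividing `T ^ 3`, which covers `m = 2` and `m = 3` at once.

module TruncatedPolynomials (em : ∀ {e} → ExcludedMiddle e) (K : Field c ℓ) where
  private module K = Field K
  open Classical em
  open Polynomial K.commutativeRing hiding (_∣_; _^_; ∏)
  open PolynomialsOver em K
  open Divisibility polynomialRing
  open RingSolver K.commutativeRing using (solve; _:=_; con; _:+_; _:*_; _:-_; :-_)
  open RingProperties K.ring using () renaming (x≈y⇒x∙y⁻¹≈ε to x≈y⇒x-y≈0; -0#≈0# to -0≈0)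
  private
    module P  = CommutativeRing polynomialRing
    module PR = SetoidReasoning ≋-setoid
  open Subalgebra using (member)

  coeff-drop₃ : ∀ p i → coeff (drop 3 p) i ≡ coeff p (3 ℕ.+ i)
  coeff-drop₃ []              i = ≡.refl
  coeff-drop₃ (_ ∷ [])        i = ≡.refl
  coeff-drop₃ (_ ∷ _ ∷ [])    i = ≡.refl
  coeff-drop₃ (_ ∷ _ ∷ _ ∷ p) i = ≡.refl

  T³∣ : ∀ p → coeff p 0 K.≈ K.0# → coeff p 1 K.≈ K.0# → coeff p 2 K.≈ K.0# → T ^ 3 ∣ p
  T³∣ p p₀≈0 p₁≈0 p₂≈0 = h , (begin
    h *ᴾ T ^ 3                     ≈⟨ *ᴾ-comm h (T ^ 3) ⟩
    T ^ 3 *ᴾ h                     ≈⟨ *ᴾ-assoc T (T ^ 2) h ⟩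
    T *ᴾ (T ^ 2 *ᴾ h)              ≈⟨ *ᴾ-congˡ T (*ᴾ-assoc T (T ^ 1) h) ⟩
    T *ᴾ (T *ᴾ (T ^ 1 *ᴾ h))       ≈⟨ *ᴾ-congˡ T (*ᴾ-congˡ T (*ᴾ-assoc T 1ᴾ h)) ⟩
    T *ᴾ (T *ᴾ (T *ᴾ (1ᴾ *ᴾ h)))   ≈⟨ *ᴾ-congˡ T (*ᴾ-congˡ T (*ᴾ-congˡ T (*ᴾ-identityˡ h))) ⟩
    T *ᴾ (T *ᴾ (T *ᴾ h))           ≈⟨ *ᴾ-congˡ T (*ᴾ-congˡ T (T*p≋0∷p K h)) ⟩
    T *ᴾ (T *ᴾ (K.0# ∷ h))         ≈⟨ *ᴾ-congˡ T (T*p≋0∷p K (K.0# ∷ h)) ⟩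
    T *ᴾ (K.0# ∷ K.0# ∷ h)         ≈⟨ T*p≋0∷p K (K.0# ∷ K.0# ∷ h) ⟩
    K.0# ∷ K.0# ∷ K.0# ∷ h         ≈⟨ mk≋ agree ⟩
    p                              ∎)
    where
    open PR
    h = drop 3 p
    agree : ∀ i → coeff (K.0# ∷ K.0# ∷ K.0# ∷ h) i K.≈ coeff p i
    agree zero                = K.sym p₀≈0
    agree (suc zero)          = K.sym p₁≈0
    agree (suc (suc zero))    = K.sym p₂≈0
    agree (suc (suc (suc i))) = K.reflexive (coeff-drop₃ p i)

  module _ {f : Poly} (f∣T³ : f ∣ T ^ 3) where
    private module E = AlgebraProperties (K[T]/⟨_⟩ K f)
    open AssociativeAlgebra (K[T]/⟨_⟩ K f) using () renaming (_≈_ to _∼_)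

    ≋⇒∼ : ∀ {x y} → x ≋ y → x ∼ y
    ≋⇒∼ = Quotient.≈⇒∼ polynomialRing f

    -- The difference is divisible by `T ^ 3` and therefore by `f`.
    agree⇒∼ : ∀ x y → coeff x 0 K.≈ coeff y 0 → coeff x 1 K.≈ coeff y 1 → coeff x 2 K.≈ coeff y 2 → x ∼ y
    agree⇒∼ x y e₀ e₁ e₂ = ∣-trans f∣T³ (T³∣ (x P.- y) (difference 0 e₀) (difference 1 e₁) (difference 2 e₂))
      where
      difference : ∀ i → coeff x i K.≈ coeff y i → coeff (x P.- y) i K.≈ K.0#
      difference i e = K.trans (coeff-+ x (-ᴾ y) i) (K.trans (K.+-congˡ (coeff-neg y i)) (x≈y⇒x-y≈0 e))

    T² : Poly
    T² = K.0# ∷ K.0# ∷ K.1# ∷ []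

    module _ (S : Subalgebra (K[T]/⟨_⟩ K f)) where
      private module S = E.IsSubalgebra (E.isSubalgebra S)

      -- Clears the constant term and scales by `k`, which is later the inverse of the first nonzero
      -- remaining coefficient.
      normalised : K.Carrier → Poly → Poly
      normalised k x = const k *ᴾ (x P.- const (coeff x 0))

      coeff-normalised : ∀ k x i → coeff (normalised k x) i K.≈ k K.* (coeff x i K.- coeff (const (coeff x 0)) i)
      coeff-normalised k x i = K.trans (at (const* k (x P.- const (coeff x 0))) i)
        (K.trans (coeff-· k (x P.- const (coeff x 0)) i) (K.*-congˡ
          (K.trans (coeff-+ x (-ᴾ const (coeff x 0)) i) (K.+-congˡ (coeff-neg (const (coeff x 0)) i)))))

      coeff-normalised₀ : ∀ k x → coeff (normalised k x) 0 K.≈ K.0#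
      coeff-normalised₀ k x = K.trans (coeff-normalised k x 0)
        (K.trans (K.*-congˡ (K.-‿inverseʳ _)) (K.zeroʳ k))

      coeff-normalised₊ : ∀ k x i → coeff (normalised k x) (suc i) K.≈ k K.* coeff x (suc i)
      coeff-normalised₊ k x i = K.trans (coeff-normalised k x (suc i))
        (K.*-congˡ (K.trans (K.+-congˡ -0≈0) (K.+-identityʳ _)))

      normalised∈ : ∀ k {x} → member S x → member S (normalised k x)
      normalised∈ k {x} x∈ = S.•-closed k (S.∸-closed x∈ (S.ι∈ (coeff x 0)))

      T∈⇒everything : member S T → ∀ x → member S x
      T∈⇒everything T∈ []      = S.0∈
      T∈⇒everything T∈ (k ∷ x) = S.≈-closed (≋⇒∼ (≋-sym (∷-decompose K k x)))
        (S.+-closed (S.ι∈ k) (S.*-closed T∈ (T∈⇒everything T∈ x)))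

      -- (T + l T²)² ≡ T² modulo T³.
      T+lT²∈⇒T∈ : ∀ l → member S (K.0# ∷ K.1# ∷ l ∷ []) → member S T
      T+lT²∈⇒T∈ l t∈ = S.≈-closed
        (agree⇒∼ (t P.- const l *ᴾ T²) T
          (solve 1 (λ l → con (+ 0) :+ :- (l :* con (+ 0) :+ con (+ 0)) := con (+ 0)) K.refl l)
          (solve 1 (λ l → con (+ 1) :+ :- (l :* con (+ 0)) := con (+ 1)) K.refl l)
          (solve 1 (λ l → l :+ :- (l :* con (+ 1)) := con (+ 0)) K.refl l))
        (S.∸-closed t∈ (S.•-closed l T²∈))
        where
        t = K.0# ∷ K.1# ∷ l ∷ []
        T²∈ : member S T²
        T²∈ = S.≈-closed
          (agree⇒∼ (t *ᴾ t) T²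
            (solve 0 (con (+ 0) :* con (+ 0) :+ con (+ 0) := con (+ 0)) K.refl)
            (solve 0 (con (+ 0) :* con (+ 1) :+ (con (+ 1) :* con (+ 0) :+ con (+ 0)) := con (+ 0)) K.refl)
            (solve 1 (λ l → con (+ 0) :* l :+ (con (+ 1) :* con (+ 1) :+ (l :* con (+ 0) :+ con (+ 0))) := con (+ 1)) K.refl l))
          (S.*-closed t∈ t∈)

      -- A nonzero coefficient at `T` would let `x` be normalised to `T + l T²`, and that element
      -- generates `T`.
      T∉⇒coeff₁≈0 : ¬ member S T → ∀ {x} → member S x → coeff x 1 K.≈ K.0#
      T∉⇒coeff₁≈0 T∉ {x} x∈ = ¬¬-elim λ x₁≉0 →
        let k , x₁k≈1 = K.inverse (coeff x 1) x₁≉0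
        in T∉ (T+lT²∈⇒T∈ (k K.* coeff x 2) (S.≈-closed
          (agree⇒∼ (normalised k x) _ (coeff-normalised₀ k x)
            (K.trans (coeff-normalised₊ k x 0) (K.trans (K.*-comm k _) x₁k≈1)) (coeff-normalised₊ k x 1))
          (normalised∈ k x∈)))

      T²∉⇒coeff₂≈0 : ¬ member S T² → ∀ {x} → member S x → coeff x 1 K.≈ K.0# → coeff x 2 K.≈ K.0#
      T²∉⇒coeff₂≈0 T²∉ {x} x∈ x₁≈0 = ¬¬-elim λ x₂≉0 →
        let k , x₂k≈1 = K.inverse (coeff x 2) x₂≉0
        in T²∉ (S.≈-closed
          (agree⇒∼ (normalised k x) T² (coeff-normalised₀ k x)
            (K.trans (coeff-normalised₊ k x 0) (K.trans (K.*-congˡ x₁≈0) (K.zeroʳ k)))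
            (K.trans (coeff-normalised₊ k x 1) (K.trans (K.*-comm k _) x₂k≈1)))
          (normalised∈ k x∈))

      T²∈⇒∈ : member S T² → ∀ x → coeff x 1 K.≈ K.0# → member S x
      T²∈⇒∈ T²∈ x x₁≈0 = S.≈-closed
        (agree⇒∼ (const (coeff x 0) +ᴾ const (coeff x 2) *ᴾ T²) x
          (solve 2 (λ x₀ x₂ → x₀ :+ (x₂ :* con (+ 0) :+ con (+ 0)) := x₀) K.refl (coeff x 0) (coeff x 2))
          (K.trans (K.zeroʳ _) (K.sym x₁≈0))
          (K.*-identityʳ _))
        (S.+-closed (S.ι∈ (coeff x 0)) (S.•-closed (coeff x 2) T²∈))

      constant∈ : ∀ x → coeff x 1 K.≈ K.0# → coeff x 2 K.≈ K.0# → member S x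
      constant∈ x x₁≈0 x₂≈0 = S.≈-closed
        (agree⇒∼ (const (coeff x 0)) x K.refl (K.sym x₁≈0) (K.sym x₂≈0)) (S.ι∈ (coeff x 0))

    -- The three subalgebras are everything, K + K T² and K.
    Everything ContainsT² Constants : Subalgebra (K[T]/⟨_⟩ K f) → Set _
    Everything  S = member S T
    ContainsT² S = ¬ member S T × member S T²
    Constants   S = ¬ member S T × ¬ member S T²

    -- Membership of `T` and of `T²` determines the subalgebra. A class may be empty: for
    -- `f = T ^ 2` the element `T²` is zero and lies in every subalgebra.
    finitelyManySubalgebras : FinitelyManySubalgebras (K[T]/⟨_⟩ K f)
    finitelyManySubalgebras = finite-⇒ {S = setoid} classify
      (finite-∪ {S = setoid} (atMostOne⇒finite {S = setoid} Everything unique₁)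
        (finite-∪ {S = setoid} (atMostOne⇒finite {S = setoid} ContainsT² unique₂)
                               (atMostOne⇒finite {S = setoid} Constants unique₃)))
      where
      setoid = subalgebraSetoid (K[T]/⟨_⟩ K f)
      open Setoid setoid using (_≈_)
      classify : ∀ S → Everything S ⊎ ContainsT² S ⊎ Constants S
      classify S with em {P = member S T} | em {P = member S T²}
      ... | yes T∈ | _       = inj₁ T∈
      ... | no T∉  | yes T²∈ = inj₂ (inj₁ (T∉ , T²∈))
      ... | no T∉  | no T²∉  = inj₂ (inj₂ (T∉ , T²∉))
      unique₁ : ∀ S S′ → Everything S → Everything S′ → S ≈ S′
      unique₁ S S′ T∈ T∈′ = (λ {x} _ → T∈⇒everything S′ T∈′ x) , (λ {x} _ → T∈⇒everything S T∈ x)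
      unique₂ : ∀ S S′ → ContainsT² S → ContainsT² S′ → S ≈ S′
      unique₂ S S′ (T∉ , T²∈) (T∉′ , T²∈′) =
          (λ {x} x∈ → T²∈⇒∈ S′ T²∈′ x (T∉⇒coeff₁≈0 S T∉ x∈))
        , (λ {x} x∈ → T²∈⇒∈ S T²∈ x (T∉⇒coeff₁≈0 S′ T∉′ x∈))
      unique₃ : ∀ S S′ → Constants S → Constants S′ → S ≈ S′
      unique₃ S S′ (T∉ , T²∉) (T∉′ , T²∉′) =
          (λ {x} x∈ → let x₁≈0 = T∉⇒coeff₁≈0 S T∉ x∈ in
            constant∈ S′ x x₁≈0 (T²∉⇒coeff₂≈0 S T²∉ x∈ x₁≈0))
        , (λ {x} x∈ → let x₁≈0 = T∉⇒coeff₁≈0 S′ T∉′ x∈ in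
            constant∈ S x x₁≈0 (T²∉⇒coeff₂≈0 S′ T²∉′ x∈ x₁≈0))

  monic-T^ : ∀ m → Monic (T ^ m)
  monic-T^ zero    = monic-1
  monic-T^ (suc m) = monic-* T (T ^ m) (1 , monic-linear K.0#) (monic-T^ m)

  T^m∣T³ : ∀ {m} → m ≡ 2 ⊎ m ≡ 3 → T ^ m ∣ T ^ 3
  T^m∣T³ (inj₁ ≡.refl) = T , ≋-refl
  T^m∣T³ (inj₂ ≡.refl) = ∣-refl

-- Induction over the factors of the product.

module ProductToFinite (em : ∀ {e} → ExcludedMiddle e) {K : Field c ℓ} (infinite : IsInfinite (Field.setoid K)) where
  private module K = Field K
  open Classical em
  open Polynomial K.commutativeRing hiding (_∣_; _^_; ∏)
  open PolynomialsOver em K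
  open Divisibility polynomialRing using (_∣_; _^_)
  open TruncatedPolynomials em K
  open QuotientProperties em K using (quotient-finiteDimensional)

  -- Algebraicity belongs to the induction hypothesis: the step with one more field needs
  -- annihilating polynomials in the remaining product. It also passes along injective
  -- homomorphisms.
  Good : AssociativeAlgebra K a b → Set _
  Good A = FinitelyManySubalgebras A × (∀ x → Algebraicity.Algebraic em A x)

  good-injective : {A : AssociativeAlgebra K a b} {B : AssociativeAlgebra K a′ b′}
                   (φ : AlgebraHomomorphism A B) →
                   (let open AlgebraHomomorphism φ) (let open AssociativeAlgebra) →
                   (∀ {x y} → _≈_ B ⟦ x ⟧ ⟦ y ⟧ → _≈_ A x y) → Good B → Good A
  good-injective φ injective (finite , algebraic) =
    injective⇒finitelyMany injective finite , injective⇒algebraic injective algebraic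
    where open Images em φ

  good-extension : (L : FieldExtension K a b) → IsFiniteSimple L → Good (FieldExtension.algebra L)
  good-extension L (finiteDimensional , α , generates) =
    SimpleExtension.finitelyManySubfields em L algebraic generates , algebraic
    where algebraic = Algebraicity.finiteDimensional⇒algebraic em (FieldExtension.algebra L) finiteDimensional

  good-subdirect : ∀ {a₁ b₁ a₂ b₂} {A : AssociativeAlgebra K a b}
                   (L : FieldExtension K a₁ b₁) {B : AssociativeAlgebra K a₂ b₂}
                   (π₁ : AlgebraHomomorphism A (FieldExtension.algebra L)) (π₂ : AlgebraHomomorphism A B) →
                   (let open AlgebraHomomorphism) (let open AssociativeAlgebra) →
                   (∀ {x y} → FieldExtension._≈_ L (⟦ π₁ ⟧ x) (⟦ π₁ ⟧ y) → _≈_ B (⟦ π₂ ⟧ x) (⟦ π₂ ⟧ y) → _≈_ A x y) →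
                   IsFiniteSimple L → Good B → Good A
  good-subdirect L π₁ π₂ injective simple (finiteB , algebraicB) =
    let finiteL , algebraicL = good-extension L simple in
      jointlyInjective⇒finitelyMany injective algebraicL (SimpleExtension.finiteRoots em L) finiteL algebraicB finiteB
    , jointlyInjective⇒algebraic injective algebraicL algebraicB
    where open SubdirectProduct em infinite L π₁ π₂

  good-quotient : ∀ {f} → Monic f → f ∣ T ^ 3 → Good (K[T]/⟨_⟩ K f)
  good-quotient {f} (_ , monic) f∣T³ = finitelyManySubalgebras {f} f∣T³
    , Algebraicity.finiteDimensional⇒algebraic em (K[T]/⟨_⟩ K f) (quotient-finiteDimensional {f} monic)

  good-^ : {A : AssociativeAlgebra K a b} → ∀ {δ} → δ ≡ 0 ⊎ δ ≡ 1 → Good A → Good (A ^ᴬ δ)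
  -- The empty power is the zero ring: all its elements are equal to 1, so every subalgebra is the
  -- whole ring and the constant polynomial 1 kills everything.
  good-^ {A = A} (inj₁ ≡.refl) _ =
      finite-⇒ {S = subalgebraSetoid (A ^ᴬ 0)} {P = λ _ → ⊤ {ℓ}} (λ _ → tt)
        (atMostOne⇒finite {S = subalgebraSetoid (A ^ᴬ 0)} _ λ S S′ _ _ →
            (λ _ → Subalgebra.≈-closed S′ (λ ()) (Subalgebra.1∈ S′))
          , (λ _ → Subalgebra.≈-closed S (λ ()) (Subalgebra.1∈ S)))
    , (λ x → 1ᴾ , nonzero 1ᴾ degree-1 , λ ())
  good-^ {A = A} (inj₂ ≡.refl) = good-injective {A = A ^ᴬ 1} {B = A} π λ { e zero → e }
    where
    module A = AssociativeAlgebra A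
    π : AlgebraHomomorphism (A ^ᴬ 1) A
    π = record { ⟦_⟧ = λ x → x zero ; ⟦⟧-cong = λ e → e zero ; +-homo = λ _ _ → A.refl
               ; *-homo = λ _ _ → A.refl ; ι-homo = λ _ → A.refl }

  -- Joint injectivity of the projections to `L zero` and to the remaining product takes the place
  -- of an isomorphism that rebrackets the product.
  good-Π⊗ : ∀ n (L : Fin n → FieldExtension K a b) {B : AssociativeAlgebra K a′ b′} →
            (∀ i → IsFiniteSimple (L i)) → Good B → Good (Π n (λ i → FieldExtension.algebra (L i)) ⊗ B)
  good-Π⊗ zero L {B} simple =
    good-injective {A = Π zero (λ i → FieldExtension.algebra (L i)) ⊗ B} {B = B} π (λ e → (λ ()) , e)
    where
    module B = AssociativeAlgebra B
    π : AlgebraHomomorphism (Π zero (λ i → FieldExtension.algebra (L i)) ⊗ B) B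
    π = record { ⟦_⟧ = proj₂ ; ⟦⟧-cong = proj₂ ; +-homo = λ _ _ → B.refl
               ; *-homo = λ _ _ → B.refl ; ι-homo = λ _ → B.refl }
  good-Π⊗ (suc n) L {B} simple goodB = good-subdirect {A = A} (L zero) {B = A′} π₁ π₂
    (λ e (e′ , e″) → (λ { zero → e ; (suc i) → e′ i }) , e″)
    (simple zero) (good-Π⊗ n (L ∘ suc) {B} (simple ∘ suc) goodB)
    where
    A  = Π (suc n) (λ i → FieldExtension.algebra (L i)) ⊗ B
    A′ = Π n (λ i → FieldExtension.algebra (L (suc i))) ⊗ B
    module A′ = AssociativeAlgebra A′
    module L₀ = FieldExtension (L zero)
    π₁ : AlgebraHomomorphism A L₀.algebra
    π₁ = record { ⟦_⟧ = λ x → proj₁ x zero ; ⟦⟧-cong = λ e → proj₁ e zero ; +-homo = λ _ _ → L₀.refl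
                ; *-homo = λ _ _ → L₀.refl ; ι-homo = λ _ → L₀.refl }
    π₂ : AlgebraHomomorphism A A′
    π₂ = record { ⟦_⟧ = λ x → proj₁ x ∘ suc , proj₂ x ; ⟦⟧-cong = λ e → proj₁ e ∘ suc , proj₂ e
                ; +-homo = λ _ _ → A′.refl ; *-homo = λ _ _ → A′.refl ; ι-homo = λ _ → A′.refl }

  finitelyMany : (A : AssociativeAlgebra K a b) → IsProductOfPrescribedForm A → FinitelyManySubalgebras A
  finitelyMany A (n , L , δ , m , simple , δ≡ , m≡ , iso) =
    proj₁ (good-injective {A = A} {B = B} φ injective
      (good-Π⊗ n L {E ^ᴬ δ} simple
        (good-^ {A = E} {δ} δ≡ (good-quotient {T ^ m} (monic-T^ m) (T^m∣T³ {m} m≡)))))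
    where
    E = K[T]/⟨_⟩ K (T ^ m)
    B = Π n (λ i → FieldExtension.algebra (L i)) ⊗ E ^ᴬ δ
    open _≅_ iso
    open RingMorphisms.IsRingIsomorphism isRingIsomorphism
    φ : AlgebraHomomorphism A B
    φ = record { ⟦_⟧ = to ; ⟦⟧-cong = ⟦⟧-cong ; +-homo = +-homo ; *-homo = *-homo ; ι-homo = to-ι }

theorem3p12 : (∀ {e} → ExcludedMiddle e) →
    ∀ {c ℓ a b} (K : Field c ℓ) (A : AssociativeAlgebra K a b) →
    IsInfinite (Field.setoid K) →
    FiniteDimensional A →
    (FinitelyManySubalgebras A ⇔ IsProductOfPrescribedForm A) ×
    (IsProductOfPrescribedForm A ⇔ IsMonogenicOfPrescribedForm A)
theorem3p12 em K A infinite finiteDimensional = mk⇔ 1⇒2 2⇒1 , mk⇔ 2⇒3 3⇒2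
  where
  1⇒3 : FinitelyManySubalgebras A → IsMonogenicOfPrescribedForm A
  1⇒3 finite = FiniteToMonogenic.isMonogenic em A infinite finite finiteDimensional
  3⇒2 : IsMonogenicOfPrescribedForm A → IsProductOfPrescribedForm A
  3⇒2 monogenic = MonogenicToProduct.isProduct em A monogenic
  2⇒1 : IsProductOfPrescribedForm A → FinitelyManySubalgebras A
  2⇒1 product = ProductToFinite.finitelyMany em {K = K} infinite A product
  1⇒2 : FinitelyManySubalgebras A → IsProductOfPrescribedForm A
  1⇒2 finite = 3⇒2 (1⇒3 finite)
  -- The generator `g` is obtained from finiteness by avoiding proper subalgebras, not from
  -- generators of the factors.
  2⇒3 : IsProductOfPrescribedForm A → IsMonogenicOfPrescribedForm A
  2⇒3 product = 1⇒3 (2⇒1 product)
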